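{- For $k\ge0$ let $(\mathfrak{S}Sym)^k$ be the span of $\{\mathcal{M}_u:u\in\mathfrak{S}^k\}$, where $\mathfrak{S}^0=\mathfrak{S}_0$ and, for $k\ge1$, $\mathfrak{S}^k=\bigsqcup_{n\ge1}\{u\in\mathfrak{S}_n: \#\mathrm{GDes}(u)=k-1\}$. Then $\mathfrak{S}Sym=\bigoplus_{k\ge0}(\mathfrak{S}Sym)^k$ is a coalgebra grading, i.e. $\Delta((\mathfrak{S}Sym)^k)\subseteq\bigoplus_{i=0}^k(\mathfrak{S}Sym)^i\otimes(\mathfrak{S}Sym)^{k-i}$, and with this grading $\mathfrak{S}Sym$ is isomorphic as a graded coalgebra to the cofree graded coalgebra $Q(V)$ on $V=(\mathfrak{S}Sym)^1$.
   Context: Permutations in one-line notation, product is composition; $\mathfrak{S}_0$ has one element. $\mathrm{GDes}(u)=\{p\in[n-1]:u_i>u_j\text{ for all }i\le p<j\}$. $\mathrm{st}(a_1,\ldots,a_m)\in\mathfrak{S}_m$ is the permutation with the same relative order as the distinct integers $a_i$; $u\times v\in\mathfrak{S}_{p+q}$ for $u\in\mathfrak{S}_p,v\in\mathfrak{S}_q$ has $(u\times v)(i)=u_i$ ($i\le p$), $(u\times v)(p+j)=p+v_j$. $\mathfrak{S}Sym$ is the Hopf algebra over $\mathbb{Q}$ with basis $\{\mathcal{F}_u:u\in\mathfrak{S}_n,n\ge0\}$, product $\mathcal{F}_u\cdot\mathcal{F}_v=\sum_\zeta\mathcal{F}_{(u\times v)\zeta^{ -1}}$ over $\zeta\in\mathfrak{S}_{p+q}$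 increasing on $[1,p]$ and on $[p+1,p+q]$, coproduct $\Delta(\mathcal{F}_u)=\sum_{p=0}^n\mathcal{F}_{\mathrm{st}(u_1..u_p)}\otimes\mathcal{F}_{\mathrm{st}(u_{p+1}..u_n)}$. Weak order: $u\le v$ iff $\mathrm{Inv}(u)\subseteq\mathrm{Inv}(v)$, $\mathrm{Inv}(u)=\{(i,j):i<j,u_i>u_j\}$; Möbius function $\mu$. $\mathcal{M}_u=\sum_{v\ge u}\mu(u,v)\mathcal{F}_v$. For a vector space $V$, $Q(V)=\bigoplus_{k\ge0}V^{\otimes k}$ graded by $k$, with deconcatenation coproduct $\Delta(v_1\otimes\cdots\otimes v_k)=\sum_{i=0}^k(v_1\otimes\cdots\otimes v_i)\otimes(v_{i+1}\otimes\cdots\otimes v_k)$ and counit vanishing on $V^{\otimes k}$, $k\ge1$. -}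

module Defs where

open import Algebra.Bundles using (CommutativeMonoid)
open import Algebra.Module.Bundles using (LeftModule)
import Algebra.Module.Construct.TensorUnit as TensorUnit
open import Algebra.Module.Morphism.Structures using (module LeftModuleMorphisms)
import Algebra.Properties.CommutativeSemigroup as CommSemigroup
import Algebra.Properties.Group as GroupProperties
open import Data.Fin.Base using (Fin; zero; suc; toℕ; fromℕ<; punchOut)
  renaming (_<_ to _<ᶠ_; _>_ to _>ᶠ_)
open import Data.Fin.Permutation using (Permutation′; permutation; _⟨$⟩ʳ_; _⟨$⟩ˡ_; insert; inverseˡ; inverseʳ)
  renaming (_≈_ to _≈ₚ_; id to idₚ)
import Data.Fin.Properties as Fin
open import Data.List.Base using (List; []; _∷_; [_]; foldr; map; filter; length; lookup; take; drop; tabulate; allFin; upTo; applyUpTo; cartesianProduct; cartesianProductWith)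
open import Data.List.Membership.Propositional using () renaming (_∈_ to _∈ˡ_)
import Data.List.Membership.Propositional.Properties as ∈ˡ
import Data.List.Properties as List
open import Data.List.Relation.Unary.All as All using ([]; _∷_)
open import Data.List.Relation.Unary.AllPairs using ([]; _∷_)
open import Data.List.Relation.Unary.Any as Any using (here; there)
open import Data.List.Relation.Unary.Unique.Propositional using (Unique)
import Data.List.Relation.Unary.Unique.Propositional.Properties as Unique
open import Data.Nat.Base using (ℕ; zero; suc; _∸_; _≤_; _<_; z≤n; s≤s)
open import Data.Nat.Induction using (<-wellFounded)
import Data.Nat.Properties as ℕ
open import Data.List.Relation.Unary.Unique.DecPropositional ℕ._≟_ using (unique?)
open import Data.Product.Base using (Σ; ∃; _×_; _,_; proj₁; proj₂)
open import Data.Rational.Base using (ℚ; 0ℚ; 1ℚ)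
  renaming (_+_ to _+ℚ_; _*_ to _*ℚ_; -_ to -ℚ_)
import Data.Rational.Properties as ℚ
open import Function.Base using (_∘_)
open import Function.Definitions using (Bijective)
open import Induction.WellFounded using (WellFounded; Acc; acc; module Subrelation)
open import Level using (0ℓ)
import Relation.Binary.Construct.On as On
open import Relation.Binary.Core using (Rel)
open import Relation.Binary.Definitions using (tri<; tri≈; tri>)
open import Relation.Binary.PropositionalEquality as ≡ using (_≡_)
import Relation.Binary.Reasoning.Setoid as ≈-Reasoning
open import Relation.Nullary using (¬_; Dec; yes; no; contradiction)
open import Relation.Nullary.Decidable using (map′; _×-dec_; _→-dec_; ¬?)
open import Relation.Unary using (Pred; Decidable; _⊆_)

VectorSpace : Set₁
VectorSpace = LeftModule ℚ.+-*-ring 0ℓ 0ℓ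

∣_∣ : VectorSpace → Set
∣ V ∣ = LeftModule.Carrierᴹ V

infix 4 _[_≈_]
_[_≈_] : (V : VectorSpace) → ∣ V ∣ → ∣ V ∣ → Set
V [ x ≈ y ] = LeftModule._≈ᴹ_ V x y

ℚ¹ : VectorSpace
ℚ¹ = TensorUnit.leftModule {R = ℚ.+-*-ring}

infixr 1 _⊸_
record _⊸_ (V W : VectorSpace) : Set where
  field
    fn : ∣ V ∣ → ∣ W ∣
    isLeftModuleHomomorphism : LeftModuleMorphisms.IsLeftModuleHomomorphism
      (LeftModule.rawLeftModule V) (LeftModule.rawLeftModule W) fn
  open LeftModuleMorphisms.IsLeftModuleHomomorphism isLeftModuleHomomorphism public

infixr 9 _$_
_$_ : {V W : VectorSpace} → V ⊸ W → ∣ V ∣ → ∣ W ∣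
_$_ = _⊸_.fn

module _ {V W : VectorSpace} where
  private
    module V = LeftModule V
    module W = LeftModule W

  linear : (f : ∣ V ∣ → ∣ W ∣) →
           (∀ {x y} → V [ x ≈ y ] → W [ f x ≈ f y ]) →
           (∀ x y → W [ f (x V.+ᴹ y) ≈ f x W.+ᴹ f y ]) →
           (∀ c x → W [ f (c V.*ₗ x) ≈ c W.*ₗ f x ]) →
           V ⊸ W
  linear f f-cong f-+ f-• = record
    { fn = f
    ; isLeftModuleHomomorphism = record
      { +ᴹ-isGroupHomomorphism = record
        { isMonoidHomomorphism = record
          { isMagmaHomomorphism = record
            { isRelHomomorphism = record { cong = f-cong }
            ; homo = f-+
            }
          ; ε-homo = f-0
          }
        ; ⁻¹-homo = λ x → GroupProperties.inverseˡ-unique W.+ᴹ-group _ _ (begin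
            f (V.-ᴹ x) W.+ᴹ f x  ≈⟨ f-+ _ _ ⟨
            f (V.-ᴹ x V.+ᴹ x)    ≈⟨ f-cong (V.-ᴹ‿inverseˡ x) ⟩
            f V.0ᴹ               ≈⟨ f-0 ⟩
            W.0ᴹ                 ∎)
        }
      ; *ₗ-homo = f-•
      }
    }
    where
    open ≈-Reasoning W.≈ᴹ-setoid
    f-0 : W [ f V.0ᴹ ≈ W.0ᴹ ]
    f-0 = begin
      f V.0ᴹ               ≈⟨ f-cong (V.*ₗ-zeroˡ V.0ᴹ) ⟨
      f (0ℚ V.*ₗ V.0ᴹ)     ≈⟨ f-• 0ℚ V.0ᴹ ⟩
      0ℚ W.*ₗ f V.0ᴹ       ≈⟨ W.*ₗ-zeroˡ _ ⟩
      W.0ᴹ                 ∎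

  infixl 6 _+ₗ_
  _+ₗ_ : V ⊸ W → V ⊸ W → V ⊸ W
  f +ₗ g = linear (λ x → f $ x W.+ᴹ g $ x)
    (λ e → W.+ᴹ-cong (f.⟦⟧-cong e) (g.⟦⟧-cong e))
    (λ x y → W.≈ᴹ-trans (W.+ᴹ-cong (f.+ᴹ-homo x y) (g.+ᴹ-homo x y))
                        (interchange _ _ _ _))
    (λ c x → W.≈ᴹ-trans (W.+ᴹ-cong (f.*ₗ-homo c x) (g.*ₗ-homo c x))
                        (W.≈ᴹ-sym (W.*ₗ-distribˡ c _ _)))
    where
    module f = _⊸_ f
    module g = _⊸_ g
    open CommSemigroup (CommutativeMonoid.commutativeSemigroup W.+ᴹ-commutativeMonoid) using (interchange)

  infixr 7 _•ₗ_
  _•ₗ_ : ℚ → V ⊸ W → V ⊸ W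
  c •ₗ f = linear (λ x → c W.*ₗ f $ x)
    (λ e → W.*ₗ-cong ≡.refl (f.⟦⟧-cong e))
    (λ x y → W.≈ᴹ-trans (W.*ₗ-cong ≡.refl (f.+ᴹ-homo x y)) (W.*ₗ-distribˡ c _ _))
    (λ d x → begin
      c W.*ₗ f $ (d V.*ₗ x)       ≈⟨ W.*ₗ-cong ≡.refl (f.*ₗ-homo d x) ⟩
      c W.*ₗ d W.*ₗ f $ x         ≈⟨ W.*ₗ-assoc c d _ ⟨
      (c *ℚ d) W.*ₗ f $ x         ≈⟨ W.*ₗ-cong (ℚ.*-comm c d) W.≈ᴹ-refl ⟩
      (d *ℚ c) W.*ₗ f $ x         ≈⟨ W.*ₗ-assoc d c _ ⟩
      d W.*ₗ c W.*ₗ f $ x         ∎)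
    where
    module f = _⊸_ f
    open ≈-Reasoning W.≈ᴹ-setoid

  0ₗ : V ⊸ W
  0ₗ = linear (λ _ → W.0ᴹ) (λ _ → W.≈ᴹ-refl)
    (λ _ _ → W.≈ᴹ-sym (W.+ᴹ-identityˡ _)) (λ c _ → W.≈ᴹ-sym (W.*ₗ-zeroʳ c))

idₗ : {V : VectorSpace} → V ⊸ V
idₗ {V} = linear (λ x → x) (λ e → e) (λ _ _ → V.≈ᴹ-refl) (λ _ _ → V.≈ᴹ-refl)
  where module V = LeftModule V

infixr 8 _∘ₗ_
_∘ₗ_ : {U V W : VectorSpace} → V ⊸ W → U ⊸ V → U ⊸ W
_∘ₗ_ {W = W} f g = linear (λ x → f $ (g $ x))
  (λ e → f.⟦⟧-cong (g.⟦⟧-cong e))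
  (λ x y → W.≈ᴹ-trans (f.⟦⟧-cong (g.+ᴹ-homo x y)) (f.+ᴹ-homo _ _))
  (λ c x → W.≈ᴹ-trans (f.⟦⟧-cong (g.*ₗ-homo c x)) (f.*ₗ-homo c _))
  where
  module W = LeftModule W
  module f = _⊸_ f
  module g = _⊸_ g

∑ : (V : VectorSpace) {I : Set} → List I → (I → ∣ V ∣) → ∣ V ∣
∑ V is x = foldr (λ i s → LeftModule._+ᴹ_ V (x i) s) (LeftModule.0ᴹ V) is

module _ (V : VectorSpace) {I : Set} where
  private module V = LeftModule V

  ∑-cong : ∀ is {x y : I → ∣ V ∣} → (∀ i → V [ x i ≈ y i ]) → V [ ∑ V is x ≈ ∑ V is y ]
  ∑-cong []       e = V.≈ᴹ-refl
  ∑-cong (i ∷ is) e = V.+ᴹ-cong (e i) (∑-cong is e)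

  $-∑ : {W : VectorSpace} (f : V ⊸ W) → ∀ is (x : I → ∣ V ∣) →
        W [ f $ ∑ V is x ≈ ∑ W is (λ i → f $ x i) ]
  $-∑ f []       x = _⊸_.0ᴹ-homo f
  $-∑ {W} f (i ∷ is) x = W.≈ᴹ-trans (_⊸_.+ᴹ-homo f _ _) (W.+ᴹ-cong W.≈ᴹ-refl ($-∑ f is x))
    where module W = LeftModule W

∑ₗ : {V W : VectorSpace} {I : Set} → List I → (I → V ⊸ W) → V ⊸ W
∑ₗ {V} {W} {I} is f = linear (∑f is) (∑f-cong is) (∑f-+ is) (∑f-• is)
  where
  module V = LeftModule V
  module W = LeftModule W
  open CommSemigroup (CommutativeMonoid.commutativeSemigroup W.+ᴹ-commutativeMonoid) using (interchange)
  ∑f : List I → ∣ V ∣ → ∣ W ∣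
  ∑f is x = ∑ W is (λ i → f i $ x)
  ∑f-cong : ∀ is {x y} → V [ x ≈ y ] → W [ ∑f is x ≈ ∑f is y ]
  ∑f-cong is e = ∑-cong W is (λ i → _⊸_.⟦⟧-cong (f i) e)
  ∑f-+ : ∀ is x y → W [ ∑f is (x V.+ᴹ y) ≈ ∑f is x W.+ᴹ ∑f is y ]
  ∑f-+ []       x y = W.≈ᴹ-sym (W.+ᴹ-identityˡ _)
  ∑f-+ (i ∷ is) x y = W.≈ᴹ-trans
    (W.+ᴹ-cong (_⊸_.+ᴹ-homo (f i) x y) (∑f-+ is x y)) (interchange _ _ _ _)
  ∑f-• : ∀ is c x → W [ ∑f is (c V.*ₗ x) ≈ c W.*ₗ ∑f is x ]
  ∑f-• []       c x = W.≈ᴹ-sym (W.*ₗ-zeroʳ c)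
  ∑f-• (i ∷ is) c x = W.≈ᴹ-trans
    (W.+ᴹ-cong (_⊸_.*ₗ-homo (f i) c x) (∑f-• is c x)) (W.≈ᴹ-sym (W.*ₗ-distribˡ c _ _))

infixl 6 _⊕_
infixr 7 _⊙_

data Combination (G : Set) : Set where
  gen : G → Combination G
  𝟎   : Combination G
  _⊕_ : Combination G → Combination G → Combination G
  _⊙_ : ℚ → Combination G → Combination G

-- Presented R is the vector space with generators G and defining relations R:
-- formal linear combinations modulo the least congruence containing R and the
-- vector space axioms.
module _ {G : Set} (R : Rel (Combination G) 0ℓ) where

  infix 4 _~_

  data _~_ : Rel (Combination G) 0ℓ where
    relation : ∀ {s t} → R s t → s ~ t

    ~refl  : ∀ {s} → s ~ s
    ~sym   : ∀ {s t} → s ~ t → t ~ s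
    ~trans : ∀ {s t u} → s ~ t → t ~ u → s ~ u
    ⊕-cong : ∀ {s s′ t t′} → s ~ s′ → t ~ t′ → s ⊕ t ~ s′ ⊕ t′
    ⊙-cong : ∀ {c s s′} → s ~ s′ → c ⊙ s ~ c ⊙ s′

    ⊕-assoc     : ∀ s t u → (s ⊕ t) ⊕ u ~ s ⊕ (t ⊕ u)
    ⊕-comm      : ∀ s t → s ⊕ t ~ t ⊕ s
    ⊕-identityˡ : ∀ s → 𝟎 ⊕ s ~ s
    ⊙-zeroˡ     : ∀ s → 0ℚ ⊙ s ~ 𝟎
    ⊙-zeroʳ     : ∀ c → c ⊙ 𝟎 ~ 𝟎
    ⊙-distribˡ  : ∀ c s t → c ⊙ (s ⊕ t) ~ c ⊙ s ⊕ c ⊙ t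
    ⊙-distribʳ  : ∀ s c d → (c +ℚ d) ⊙ s ~ c ⊙ s ⊕ d ⊙ s
    ⊙-assoc     : ∀ c d s → (c *ℚ d) ⊙ s ~ c ⊙ (d ⊙ s)
    ⊙-identityˡ : ∀ s → 1ℚ ⊙ s ~ s

  Presented : VectorSpace
  Presented = record
    { Carrierᴹ = Combination G
    ; _≈ᴹ_ = _~_
    ; _+ᴹ_ = _⊕_
    ; _*ₗ_ = _⊙_
    ; 0ᴹ = 𝟎
    ; -ᴹ_ = (-ℚ 1ℚ) ⊙_
    ; isLeftModule = record
      { isLeftSemimodule = record
        { +ᴹ-isCommutativeMonoid = record
          { isMonoid = record
            { isSemigroup = record
              { isMagma = record
                { isEquivalence = record { refl = ~refl ; sym = ~sym ; trans = ~trans }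
                ; ∙-cong = ⊕-cong
                }
              ; assoc = ⊕-assoc
              }
            ; identity = ⊕-identityˡ , λ s → ~trans (⊕-comm s 𝟎) (⊕-identityˡ s)
            }
          ; comm = ⊕-comm
          }
        ; isPreleftSemimodule = record
          { *ₗ-cong = λ where ≡.refl e → ⊙-cong e
          ; *ₗ-zeroˡ = ⊙-zeroˡ
          ; *ₗ-distribʳ = ⊙-distribʳ
          ; *ₗ-identityˡ = ⊙-identityˡ
          ; *ₗ-assoc = ⊙-assoc
          ; *ₗ-zeroʳ = ⊙-zeroʳ
          ; *ₗ-distribˡ = ⊙-distribˡ
          }
        }
      ; -ᴹ‿cong = ⊙-cong
      ; -ᴹ‿inverse = ⊕-inverseˡ , λ s → ~trans (⊕-comm _ _) (⊕-inverseˡ s)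
      }
    }
    where
    ⊕-inverseˡ : ∀ s → (-ℚ 1ℚ) ⊙ s ⊕ s ~ 𝟎
    ⊕-inverseˡ s = ~trans (⊕-cong ~refl (~sym (⊙-identityˡ s)))
                (~trans (~sym (⊙-distribʳ s (-ℚ 1ℚ) 1ℚ)) (⊙-zeroˡ s))

⟦_⟧ : {G : Set} → Combination G → (V : VectorSpace) → (G → ∣ V ∣) → ∣ V ∣
⟦ gen g ⟧ V x = x g
⟦ 𝟎     ⟧ V x = LeftModule.0ᴹ V
⟦ s ⊕ t ⟧ V x = LeftModule._+ᴹ_ V (⟦ s ⟧ V x) (⟦ t ⟧ V x)
⟦ c ⊙ s ⟧ V x = LeftModule._*ₗ_ V c (⟦ s ⟧ V x)

module _ {G : Set} {R : Rel (Combination G) 0ℓ} where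

  extend : (V : VectorSpace) (x : G → ∣ V ∣) →
           (∀ {s t} → R s t → V [ ⟦ s ⟧ V x ≈ ⟦ t ⟧ V x ]) → Presented R ⊸ V
  extend V x respects = linear (λ s → ⟦ s ⟧ V x) ~-sound
    (λ _ _ → V.≈ᴹ-refl) (λ _ _ → V.≈ᴹ-refl)
    where
    module V = LeftModule V
    ~-sound : ∀ {s t} → _~_ R s t → V [ ⟦ s ⟧ V x ≈ ⟦ t ⟧ V x ]
    ~-sound (relation r)       = respects r
    ~-sound ~refl              = V.≈ᴹ-refl
    ~-sound (~sym e)           = V.≈ᴹ-sym (~-sound e)
    ~-sound (~trans e e′)      = V.≈ᴹ-trans (~-sound e) (~-sound e′)
    ~-sound (⊕-cong e e′)      = V.+ᴹ-cong (~-sound e) (~-sound e′)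
    ~-sound (⊙-cong e)         = V.*ₗ-cong ≡.refl (~-sound e)
    ~-sound (⊕-assoc s t u)    = V.+ᴹ-assoc _ _ _
    ~-sound (⊕-comm s t)       = V.+ᴹ-comm _ _
    ~-sound (⊕-identityˡ s)    = V.+ᴹ-identityˡ _
    ~-sound (⊙-zeroˡ s)        = V.*ₗ-zeroˡ _
    ~-sound (⊙-zeroʳ c)        = V.*ₗ-zeroʳ _
    ~-sound (⊙-distribˡ c s t) = V.*ₗ-distribˡ _ _ _
    ~-sound (⊙-distribʳ s c d) = V.*ₗ-distribʳ _ _ _
    ~-sound (⊙-assoc c d s)    = V.*ₗ-assoc _ _ _
    ~-sound (⊙-identityˡ s)    = V.*ₗ-identityˡ _

  linear-ext : {V : VectorSpace} (f g : Presented R ⊸ V) →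
               (∀ x → V [ f $ gen x ≈ g $ gen x ]) → ∀ s → V [ f $ s ≈ g $ s ]
  linear-ext {V} f g e = go
    where
    module V = LeftModule V
    module f = _⊸_ f
    module g = _⊸_ g
    open ≈-Reasoning V.≈ᴹ-setoid
    go : ∀ s → V [ f $ s ≈ g $ s ]
    go (gen x) = e x
    go 𝟎       = V.≈ᴹ-trans f.0ᴹ-homo (V.≈ᴹ-sym g.0ᴹ-homo)
    go (s ⊕ t) = begin
      f $ (s ⊕ t)          ≈⟨ f.+ᴹ-homo s t ⟩
      f $ s V.+ᴹ f $ t     ≈⟨ V.+ᴹ-cong (go s) (go t) ⟩
      g $ s V.+ᴹ g $ t     ≈⟨ g.+ᴹ-homo s t ⟨
      g $ (s ⊕ t)          ∎
    go (c ⊙ s) = begin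
      f $ (c ⊙ s)          ≈⟨ f.*ₗ-homo c s ⟩
      c V.*ₗ f $ s         ≈⟨ V.*ₗ-cong ≡.refl (go s) ⟩
      c V.*ₗ g $ s         ≈⟨ g.*ₗ-homo c s ⟨
      g $ (c ⊙ s)          ∎

infixr 7 _⊗ₜ_
_⊗ₜ_ : {A B : Set} → A → B → Combination (A × B)
v ⊗ₜ w = gen (v , w)

module _ (V W : VectorSpace) where
  private
    module V = LeftModule V
    module W = LeftModule W

  data ⊗-Relation : Rel (Combination (∣ V ∣ × ∣ W ∣)) 0ℓ where
    ⊗-cong : ∀ {v v′ w w′} → V [ v ≈ v′ ] → W [ w ≈ w′ ] → ⊗-Relation (v ⊗ₜ w) (v′ ⊗ₜ w′)
    ⊗-+ˡ   : ∀ v v′ w → ⊗-Relation ((v V.+ᴹ v′) ⊗ₜ w) (v ⊗ₜ w ⊕ v′ ⊗ₜ w)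
    ⊗-+ʳ   : ∀ v w w′ → ⊗-Relation (v ⊗ₜ (w W.+ᴹ w′)) (v ⊗ₜ w ⊕ v ⊗ₜ w′)
    ⊗-•ˡ   : ∀ c v w → ⊗-Relation ((c V.*ₗ v) ⊗ₜ w) (c ⊙ v ⊗ₜ w)
    ⊗-•ʳ   : ∀ c v w → ⊗-Relation (v ⊗ₜ (c W.*ₗ w)) (c ⊙ v ⊗ₜ w)

  infixr 7 _⊗_
  _⊗_ : VectorSpace
  _⊗_ = Presented ⊗-Relation

module _ {V W : VectorSpace} where
  private
    module V = LeftModule V
    module W = LeftModule W

  _⊗ₜ- : ∣ V ∣ → W ⊸ V ⊗ W
  v ⊗ₜ- = linear (v ⊗ₜ_) (λ e → relation (⊗-cong V.≈ᴹ-refl e))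
    (λ w w′ → relation (⊗-+ʳ v w w′)) (λ c w → relation (⊗-•ʳ c v w))

  -⊗ₜ_ : ∣ W ∣ → V ⊸ V ⊗ W
  -⊗ₜ w = linear (_⊗ₜ w) (λ e → relation (⊗-cong e W.≈ᴹ-refl))
    (λ v v′ → relation (⊗-+ˡ v v′ w)) (λ c v → relation (⊗-•ˡ c v w))

  uncurryₗ : {U : VectorSpace} (f : ∣ V ∣ → W ⊸ U) →
             (∀ {v v′} → V [ v ≈ v′ ] → ∀ w → U [ f v $ w ≈ f v′ $ w ]) →
             (∀ v v′ w → U [ f (v V.+ᴹ v′) $ w ≈ (f v +ₗ f v′) $ w ]) →
             (∀ c v w → U [ f (c V.*ₗ v) $ w ≈ (c •ₗ f v) $ w ]) →
             V ⊗ W ⊸ U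
  uncurryₗ {U} f f-cong f-+ f-• = extend U (λ (v , w) → f v $ w) λ where
      (⊗-cong {v′ = v′} e e′) → U.≈ᴹ-trans (f-cong e _) (_⊸_.⟦⟧-cong (f v′) e′)
      (⊗-+ˡ v v′ w)  → f-+ v v′ w
      (⊗-+ʳ v w w′)  → _⊸_.+ᴹ-homo (f v) w w′
      (⊗-•ˡ c v w)   → f-• c v w
      (⊗-•ʳ c v w)   → _⊸_.*ₗ-homo (f v) c w
    where module U = LeftModule U

  ⊗-ext : {U : VectorSpace} (f g : V ⊗ W ⊸ U) →
          (∀ v w → U [ f $ (v ⊗ₜ w) ≈ g $ (v ⊗ₜ w) ]) → ∀ t → U [ f $ t ≈ g $ t ]
  ⊗-ext f g e = linear-ext f g (λ (v , w) → e v w)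

infixr 7 _⊗₁_
_⊗₁_ : {V V′ W W′ : VectorSpace} → V ⊸ V′ → W ⊸ W′ → V ⊗ W ⊸ V′ ⊗ W′
_⊗₁_ {V} {V′} {W} {W′} f g = uncurryₗ (λ v → (f $ v) ⊗ₜ- ∘ₗ g)
  (λ e w → relation (⊗-cong (_⊸_.⟦⟧-cong f e) (LeftModule.≈ᴹ-refl W′)))
  (λ v v′ w → ~trans (relation (⊗-cong (_⊸_.+ᴹ-homo f v v′) (LeftModule.≈ᴹ-refl W′)))
                     (relation (⊗-+ˡ _ _ _)))
  (λ c v w → ~trans (relation (⊗-cong (_⊸_.*ₗ-homo f c v) (LeftModule.≈ᴹ-refl W′)))
                    (relation (⊗-•ˡ _ _ _)))

module _ {V V′ W W′ : VectorSpace} where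
  private
    module V′ = LeftModule V′
    module W′ = LeftModule W′

  ⊗₁-congˡ : (f f′ : V ⊸ V′) (g : W ⊸ W′) → (∀ v → V′ [ f $ v ≈ f′ $ v ]) →
             ∀ t → V′ ⊗ W′ [ (f ⊗₁ g) $ t ≈ (f′ ⊗₁ g) $ t ]
  ⊗₁-congˡ f f′ g e = ⊗-ext (f ⊗₁ g) (f′ ⊗₁ g) λ v w →
    relation (⊗-cong (e v) W′.≈ᴹ-refl)

  ⊗₁-+ˡ : (f f′ : V ⊸ V′) (g : W ⊸ W′) →
          ∀ t → V′ ⊗ W′ [ ((f +ₗ f′) ⊗₁ g) $ t ≈ (f ⊗₁ g +ₗ f′ ⊗₁ g) $ t ]
  ⊗₁-+ˡ f f′ g = ⊗-ext ((f +ₗ f′) ⊗₁ g) (f ⊗₁ g +ₗ f′ ⊗₁ g) λ v w →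
    relation (⊗-+ˡ _ _ _)

  ⊗₁-•ˡ : ∀ c (f : V ⊸ V′) (g : W ⊸ W′) →
          ∀ t → V′ ⊗ W′ [ ((c •ₗ f) ⊗₁ g) $ t ≈ (c •ₗ f ⊗₁ g) $ t ]
  ⊗₁-•ˡ c f g = ⊗-ext ((c •ₗ f) ⊗₁ g) (c •ₗ f ⊗₁ g) λ v w → relation (⊗-•ˡ _ _ _)

  ⊗₁-congʳ : (f : V ⊸ V′) (g g′ : W ⊸ W′) → (∀ w → W′ [ g $ w ≈ g′ $ w ]) →
             ∀ t → V′ ⊗ W′ [ (f ⊗₁ g) $ t ≈ (f ⊗₁ g′) $ t ]
  ⊗₁-congʳ f g g′ e = ⊗-ext (f ⊗₁ g) (f ⊗₁ g′) λ v w →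
    relation (⊗-cong V′.≈ᴹ-refl (e w))

  ⊗₁-+ʳ : (f : V ⊸ V′) (g g′ : W ⊸ W′) →
          ∀ t → V′ ⊗ W′ [ (f ⊗₁ (g +ₗ g′)) $ t ≈ (f ⊗₁ g +ₗ f ⊗₁ g′) $ t ]
  ⊗₁-+ʳ f g g′ = ⊗-ext (f ⊗₁ (g +ₗ g′)) (f ⊗₁ g +ₗ f ⊗₁ g′) λ v w →
    relation (⊗-+ʳ _ _ _)

  ⊗₁-•ʳ : ∀ c (f : V ⊸ V′) (g : W ⊸ W′) →
          ∀ t → V′ ⊗ W′ [ (f ⊗₁ (c •ₗ g)) $ t ≈ (c •ₗ f ⊗₁ g) $ t ]
  ⊗₁-•ʳ c f g = ⊗-ext (f ⊗₁ (c •ₗ g)) (c •ₗ f ⊗₁ g) λ v w → relation (⊗-•ʳ _ _ _)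

-- (u ⊗ v) ⊗ w ↦ u ⊗ (v ⊗ w), as the extension of t ⊗ w ↦ (id ⊗ (- ⊗ w)) t.
assocₗ : {U V W : VectorSpace} → (U ⊗ V) ⊗ W ⊸ U ⊗ (V ⊗ W)
assocₗ {U} {V} {W} = extend (U ⊗ (V ⊗ W)) (λ (t , w) → (idₗ ⊗₁ -⊗ₜ w) $ t) λ where
    (⊗-cong {t} {t′} {w} {w′} e e′) → ~trans (_⊸_.⟦⟧-cong (idₗ ⊗₁ -⊗ₜ w) e)
      (⊗₁-congʳ idₗ (-⊗ₜ w) (-⊗ₜ w′) (λ v → relation (⊗-cong V.≈ᴹ-refl e′)) t′)
    (⊗-+ˡ t t′ w) → _⊸_.+ᴹ-homo (idₗ ⊗₁ -⊗ₜ w) t t′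
    (⊗-+ʳ t w w′) → ~trans
      (⊗₁-congʳ idₗ (-⊗ₜ (w W.+ᴹ w′)) (-⊗ₜ w +ₗ -⊗ₜ w′) (λ v → relation (⊗-+ʳ v w w′)) t)
      (⊗₁-+ʳ idₗ (-⊗ₜ w) (-⊗ₜ w′) t)
    (⊗-•ˡ c t w)  → _⊸_.*ₗ-homo (idₗ ⊗₁ -⊗ₜ w) c t
    (⊗-•ʳ c t w)  → ~trans
      (⊗₁-congʳ idₗ (-⊗ₜ (c W.*ₗ w)) (c •ₗ -⊗ₜ w) (λ v → relation (⊗-•ʳ c v w)) t)
      (⊗₁-•ʳ c idₗ (-⊗ₜ w) t)
  where
  module V = LeftModule V
  module W = LeftModule W

infixl 8 _^⊗_
_^⊗_ : VectorSpace → ℕ → VectorSpace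
V ^⊗ zero  = ℚ¹
V ^⊗ suc k = V ⊗ V ^⊗ k

module _ {I : Set} (V : I → VectorSpace) where
  private module V i = LeftModule (V i)

  data ⨁-Relation : Rel (Combination (Σ I λ i → ∣ V i ∣)) 0ℓ where
    ⨁-cong : ∀ {i v v′} → V i [ v ≈ v′ ] → ⨁-Relation (gen (i , v)) (gen (i , v′))
    ⨁-+    : ∀ i v v′ → ⨁-Relation (gen (i , V._+ᴹ_ i v v′)) (gen (i , v) ⊕ gen (i , v′))
    ⨁-•    : ∀ i c v → ⨁-Relation (gen (i , V._*ₗ_ i c v)) (c ⊙ gen (i , v))

  ⨁ : VectorSpace
  ⨁ = Presented ⨁-Relation

module _ {I : Set} {V : I → VectorSpace} where

  ι : ∀ i → V i ⊸ ⨁ V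
  ι i = linear (λ v → gen (i , v)) (λ e → relation (⨁-cong e))
    (λ v v′ → relation (⨁-+ i v v′)) (λ c v → relation (⨁-• i c v))

  cotuple : {W : VectorSpace} → (∀ i → V i ⊸ W) → ⨁ V ⊸ W
  cotuple {W} f = extend W (λ (i , v) → f i $ v) λ where
    (⨁-cong {i} e) → _⊸_.⟦⟧-cong (f i) e
    (⨁-+ i v v′)   → _⊸_.+ᴹ-homo (f i) v v′
    (⨁-• i c v)    → _⊸_.*ₗ-homo (f i) c v

record Subspace (V : VectorSpace) : Set₁ where
  private module V = LeftModule V
  infix 4 _∈ₛ
  field
    _∈ₛ      : ∣ V ∣ → Set
    ≈-closed : ∀ {x y} → V [ x ≈ y ] → x ∈ₛ → y ∈ₛ
    0-closed : V.0ᴹ ∈ₛ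
    +-closed : ∀ {x y} → x ∈ₛ → y ∈ₛ → x V.+ᴹ y ∈ₛ
    •-closed : ∀ c {x} → x ∈ₛ → c V.*ₗ x ∈ₛ

infix 4 _∈_
_∈_ : {V : VectorSpace} → ∣ V ∣ → Subspace V → Set
x ∈ S = Subspace._∈ₛ S x

module _ {V : VectorSpace} where
  private module V = LeftModule V

  subspace : Subspace V → VectorSpace
  subspace S = record
    { Carrierᴹ = Σ ∣ V ∣ (_∈ S)
    ; _≈ᴹ_ = λ x y → V [ proj₁ x ≈ proj₁ y ]
    ; _+ᴹ_ = λ (x , p) (y , q) → x V.+ᴹ y , S.+-closed p q
    ; _*ₗ_ = λ c (x , p) → c V.*ₗ x , S.•-closed c p
    ; 0ᴹ = V.0ᴹ , S.0-closed
    ; -ᴹ_ = λ (x , p) → V.-ᴹ x , S.≈-closed (neg x) (S.•-closed (-ℚ 1ℚ) p)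
    ; isLeftModule = record
      { isLeftSemimodule = record
        { +ᴹ-isCommutativeMonoid = record
          { isMonoid = record
            { isSemigroup = record
              { isMagma = record
                { isEquivalence = record
                  { refl = V.≈ᴹ-refl ; sym = V.≈ᴹ-sym ; trans = V.≈ᴹ-trans }
                ; ∙-cong = V.+ᴹ-cong
                }
              ; assoc = λ _ _ _ → V.+ᴹ-assoc _ _ _
              }
            ; identity = (λ _ → V.+ᴹ-identityˡ _) , (λ _ → V.+ᴹ-identityʳ _)
            }
          ; comm = λ _ _ → V.+ᴹ-comm _ _
          }
        ; isPreleftSemimodule = record
          { *ₗ-cong = V.*ₗ-cong
          ; *ₗ-zeroˡ = λ _ → V.*ₗ-zeroˡ _
          ; *ₗ-distribʳ = λ _ _ _ → V.*ₗ-distribʳ _ _ _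
          ; *ₗ-identityˡ = λ _ → V.*ₗ-identityˡ _
          ; *ₗ-assoc = λ _ _ _ → V.*ₗ-assoc _ _ _
          ; *ₗ-zeroʳ = λ _ → V.*ₗ-zeroʳ _
          ; *ₗ-distribˡ = λ _ _ _ → V.*ₗ-distribˡ _ _ _
          }
        }
      ; -ᴹ‿cong = V.-ᴹ‿cong
      ; -ᴹ‿inverse = (λ _ → V.-ᴹ‿inverseˡ _) , (λ _ → V.-ᴹ‿inverseʳ _)
      }
    }
    where
    module S = Subspace S
    open ≈-Reasoning V.≈ᴹ-setoid
    neg : ∀ x → V [ (-ℚ 1ℚ) V.*ₗ x ≈ V.-ᴹ x ]
    neg x = GroupProperties.inverseˡ-unique V.+ᴹ-group _ _ (begin
      (-ℚ 1ℚ) V.*ₗ x V.+ᴹ x             ≈⟨ V.+ᴹ-cong V.≈ᴹ-refl (V.*ₗ-identityˡ x) ⟨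
      (-ℚ 1ℚ) V.*ₗ x V.+ᴹ 1ℚ V.*ₗ x     ≈⟨ V.*ₗ-distribʳ x (-ℚ 1ℚ) 1ℚ ⟨
      0ℚ V.*ₗ x                         ≈⟨ V.*ₗ-zeroˡ x ⟩
      V.0ᴹ                              ∎)

  incl : (S : Subspace V) → subspace S ⊸ V
  incl S = linear proj₁ (λ e → e) (λ _ _ → V.≈ᴹ-refl) (λ _ _ → V.≈ᴹ-refl)

  span : {I : Set} → (I → ∣ V ∣) → Subspace V
  span x = record
    { _∈ₛ      = λ v → ∃ λ s → V [ ⟦ s ⟧ V x ≈ v ]
    ; ≈-closed = λ e (s , p) → s , V.≈ᴹ-trans p e
    ; 0-closed = 𝟎 , V.≈ᴹ-refl
    ; +-closed = λ (s , p) (t , q) → s ⊕ t , V.+ᴹ-cong p q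
    ; •-closed = λ c (s , p) → c ⊙ s , V.*ₗ-cong ≡.refl p
    }

image : {V W : VectorSpace} → V ⊸ W → Subspace W
image {V} {W} f = record
  { _∈ₛ      = λ w → ∃ λ v → W [ f $ v ≈ w ]
  ; ≈-closed = λ e (v , p) → v , W.≈ᴹ-trans p e
  ; 0-closed = V.0ᴹ , f.0ᴹ-homo
  ; +-closed = λ (v , p) (v′ , q) → v V.+ᴹ v′ , W.≈ᴹ-trans (f.+ᴹ-homo v v′) (W.+ᴹ-cong p q)
  ; •-closed = λ c (v , p) → c V.*ₗ v , W.≈ᴹ-trans (f.*ₗ-homo c v) (W.*ₗ-cong ≡.refl p)
  }
  where
  module V = LeftModule V
  module W = LeftModule W
  module f = _⊸_ f

IsInternalDirectSum : {V : VectorSpace} {I : Set} → (I → Subspace V) → Set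
IsInternalDirectSum {V} S =
  Bijective (LeftModule._≈ᴹ_ (⨁ (λ i → subspace (S i)))) (LeftModule._≈ᴹ_ V)
            (cotuple (λ i → incl (S i)) $_)

record Coalgebra : Set₁ where
  field
    space    : VectorSpace
    Δ        : space ⊸ space ⊗ space
    ε        : space ⊸ ℚ¹
    coassoc  : ∀ x → space ⊗ (space ⊗ space)
                 [ assocₗ {space} {space} {space} $ ((Δ ⊗₁ idₗ {space}) $ (Δ $ x))
                 ≈ (idₗ {space} ⊗₁ Δ) $ (Δ $ x) ]
    counitˡ  : ∀ x → ℚ¹ ⊗ space [ (ε ⊗₁ idₗ {space}) $ (Δ $ x) ≈ 1ℚ ⊗ₜ x ]
    counitʳ  : ∀ x → space ⊗ ℚ¹ [ (idₗ {space} ⊗₁ ε) $ (Δ $ x) ≈ x ⊗ₜ 1ℚ ]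

module _ {V : VectorSpace} (S : ℕ → Subspace V) where

  -- ⨁ᵢ₌₀ᵏ Sⁱ ⊗ Sᵏ⁻ⁱ, as a subspace of V ⊗ V
  ⊗-degree : ℕ → Subspace (V ⊗ V)
  ⊗-degree k = image (cotuple {I = Fin (suc k)}
    {V = λ i → subspace (S (toℕ i)) ⊗ subspace (S (k ∸ toℕ i))}
    (λ i → incl (S (toℕ i)) ⊗₁ incl (S (k ∸ toℕ i))))

record IsCoalgebraGrading (C : Coalgebra) (grade : ℕ → Subspace (Coalgebra.space C)) : Set where
  open Coalgebra C
  field
    directSum : IsInternalDirectSum grade
    Δ-graded  : ∀ k x → x ∈ grade k → Δ $ x ∈ ⊗-degree grade k

record GradedCoalgebra : Set₁ where
  constructor mkGraded
  field
    coalgebra : Coalgebra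
    grade     : ℕ → Subspace (Coalgebra.space coalgebra)
    isGrading : IsCoalgebraGrading coalgebra grade
  open Coalgebra coalgebra public

record GradedCoalgebraHom (C D : GradedCoalgebra) : Set where
  private
    module C = GradedCoalgebra C
    module D = GradedCoalgebra D
  field
    hom      : C.space ⊸ D.space
    Δ-homo   : ∀ x → D.space ⊗ D.space [ D.Δ $ (hom $ x) ≈ (hom ⊗₁ hom) $ (C.Δ $ x) ]
    ε-homo   : ∀ x → D.ε $ (hom $ x) ≡ C.ε $ x
    graded   : ∀ k x → x ∈ C.grade k → hom $ x ∈ D.grade k

infix 4 _≅_
record _≅_ (C D : GradedCoalgebra) : Set where
  private
    module C = GradedCoalgebra C
    module D = GradedCoalgebra D
  open GradedCoalgebraHom using (hom)
  field
    to      : GradedCoalgebraHom C D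
    from    : GradedCoalgebraHom D C
    from-to : ∀ x → C.space [ hom from $ (hom to $ x) ≈ x ]
    to-from : ∀ y → D.space [ hom to $ (hom from $ y) ≈ y ]

∑-tabulate : (W : VectorSpace) {I : Set} (x : I → ∣ W ∣) → ∀ {n} (g : Fin n → I) →
             ∑ W (tabulate g) x ≡ ∑ W (allFin n) (x ∘ g)
∑-tabulate W x {zero}  g = ≡.refl
∑-tabulate W x {suc n} g = ≡.cong (LeftModule._+ᴹ_ W (x (g zero)))
  (≡.trans (∑-tabulate W x (g ∘ suc)) (≡.sym (∑-tabulate W (x ∘ g) suc)))

module Cofree (V : VectorSpace) where

  space : VectorSpace
  space = ⨁ (V ^⊗_)

  -- v₁ ⊗ ⋯ ⊗ vₖ ↦ (v₁ ⊗ ⋯ ⊗ vᵢ) ⊗ (vᵢ₊₁ ⊗ ⋯ ⊗ vₖ)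
  split : ∀ k (i : Fin (suc k)) → V ^⊗ k ⊸ V ^⊗ toℕ i ⊗ V ^⊗ (k ∸ toℕ i)
  split k       zero    = 1ℚ ⊗ₜ-
  split (suc k) (suc i) = uncurryₗ (λ v → (v ⊗ₜ- ⊗₁ idₗ) ∘ₗ split k i)
    (λ {v} {v′} e w → ⊗₁-congˡ (v ⊗ₜ-) (v′ ⊗ₜ-) idₗ
      (λ _ → relation (⊗-cong e (LeftModule.≈ᴹ-refl (V ^⊗ toℕ i)))) (split k i $ w))
    (λ v v′ w → ~trans
      (⊗₁-congˡ (LeftModule._+ᴹ_ V v v′ ⊗ₜ-) (v ⊗ₜ- +ₗ v′ ⊗ₜ-) idₗ
        (λ _ → relation (⊗-+ˡ v v′ _)) (split k i $ w))
      (⊗₁-+ˡ (v ⊗ₜ-) (v′ ⊗ₜ-) idₗ (split k i $ w)))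
    (λ c v w → ~trans
      (⊗₁-congˡ (LeftModule._*ₗ_ V c v ⊗ₜ-) (c •ₗ v ⊗ₜ-) idₗ
        (λ _ → relation (⊗-•ˡ c v _)) (split k i $ w))
      (⊗₁-•ˡ c (v ⊗ₜ-) idₗ (split k i $ w)))

  deconcatenate : ∀ k → V ^⊗ k ⊸ space ⊗ space
  deconcatenate k = ∑ₗ (allFin (suc k)) λ i → (ι (toℕ i) ⊗₁ ι (k ∸ toℕ i)) ∘ₗ split k i

  Δ : space ⊸ space ⊗ space
  Δ = cotuple deconcatenate

  ε : space ⊸ ℚ¹
  ε = cotuple λ where
    zero    → idₗ
    (suc _) → 0ₗ

  private
    id = idₗ {space}
    assoc = assocₗ {space} {space} {space}
    module S² = LeftModule (space ⊗ space)
    module S³ = LeftModule (space ⊗ (space ⊗ space))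

  one : ∣ space ∣
  one = gen (0 , 1ℚ)

  prepend : ∣ V ∣ → space ⊸ space
  prepend v = cotuple (λ k → ι (suc k) ∘ₗ v ⊗ₜ-)

  Δ-0 : ∀ c → space ⊗ space [ Δ $ gen (0 , c) ≈ one ⊗ₜ gen (0 , c) ]
  Δ-0 c = S².+ᴹ-identityʳ _

  Δ-prepend : ∀ v q → space ⊗ space
    [ Δ $ (prepend v $ q) ≈ one ⊗ₜ (prepend v $ q) ⊕ (prepend v ⊗₁ id) $ (Δ $ q) ]
  Δ-prepend v = linear-ext (Δ ∘ₗ prepend v)
    (one ⊗ₜ- ∘ₗ prepend v +ₗ (prepend v ⊗₁ id) ∘ₗ Δ) λ (k , w) → ⊕-cong ~refl (rest k w)
    where
    term : ∀ k w → Fin (suc k) → ∣ space ⊗ space ∣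
    term k w i = (ι (toℕ i) ⊗₁ ι (k ∸ toℕ i)) $ (split k i $ w)

    rest : ∀ k w → space ⊗ space
      [ ∑ (space ⊗ space) (tabulate suc) (term (suc k) (v ⊗ₜ w))
      ≈ (prepend v ⊗₁ id) $ (deconcatenate k $ w) ]
    rest k w = begin
      ∑ (space ⊗ space) (tabulate suc) (term (suc k) (v ⊗ₜ w))
        ≡⟨ ∑-tabulate (space ⊗ space) (term (suc k) (v ⊗ₜ w)) suc ⟩
      ∑ (space ⊗ space) (allFin (suc k)) (term (suc k) (v ⊗ₜ w) ∘ suc)
        ≈⟨ ∑-cong (space ⊗ space) (allFin (suc k)) (λ i →
             ⊗-ext ((ι (suc (toℕ i)) ⊗₁ ι (k ∸ toℕ i)) ∘ₗ (v ⊗ₜ- ⊗₁ idₗ))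
                   ((prepend v ⊗₁ id) ∘ₗ (ι (toℕ i) ⊗₁ ι (k ∸ toℕ i)))
                   (λ _ _ → ~refl) (split k i $ w)) ⟩
      ∑ (space ⊗ space) (allFin (suc k)) (λ i → (prepend v ⊗₁ id) $ term k w i)
        ≈⟨ $-∑ (space ⊗ space) (prepend v ⊗₁ id) (allFin (suc k)) (term k w) ⟨
      (prepend v ⊗₁ id) $ (deconcatenate k $ w) ∎
      where open ≈-Reasoning S².≈ᴹ-setoid

  prepend-induction : {W : VectorSpace} (f g : space ⊸ W) →
    (∀ c → W [ f $ gen (0 , c) ≈ g $ gen (0 , c) ]) →
    (∀ v q → W [ f $ q ≈ g $ q ] → W [ f $ (prepend v $ q) ≈ g $ (prepend v $ q) ]) →
    ∀ q → W [ f $ q ≈ g $ q ]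
  prepend-induction f g base step = linear-ext f g (λ (k , w) → go k w)
    where
    go : ∀ k w → _
    go zero    c = base c
    go (suc k) t = ⊗-ext (f ∘ₗ ι (suc k)) (g ∘ₗ ι (suc k))
      (λ v w → step v (gen (k , w)) (go k w)) t

  coassoc : ∀ q → space ⊗ (space ⊗ space)
    [ assoc $ ((Δ ⊗₁ id) $ (Δ $ q)) ≈ (id ⊗₁ Δ) $ (Δ $ q) ]
  coassoc = prepend-induction (assoc ∘ₗ (Δ ⊗₁ id) ∘ₗ Δ) ((id ⊗₁ Δ) ∘ₗ Δ) base step
    where
    open ≈-Reasoning S³.≈ᴹ-setoid

    Δ-one : ∀ q → space ⊗ (space ⊗ space)
      [ assoc $ ((Δ ⊗₁ id) $ (one ⊗ₜ q)) ≈ one ⊗ₜ (one ⊗ₜ q) ]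
    Δ-one q = S³.+ᴹ-identityʳ _

    base : ∀ c → _
    base c = begin
      assoc $ ((Δ ⊗₁ id) $ (Δ $ gen (0 , c)))
        ≈⟨ _⊸_.⟦⟧-cong (assoc ∘ₗ (Δ ⊗₁ id)) (Δ-0 c) ⟩
      assoc $ ((Δ ⊗₁ id) $ (one ⊗ₜ gen (0 , c)))
        ≈⟨ Δ-one (gen (0 , c)) ⟩
      one ⊗ₜ (one ⊗ₜ gen (0 , c))
        ≈⟨ _⊸_.⟦⟧-cong (one ⊗ₜ-) (Δ-0 c) ⟨
      one ⊗ₜ (Δ $ gen (0 , c))
        ≈⟨ _⊸_.⟦⟧-cong (id ⊗₁ Δ) (Δ-0 c) ⟨
      (id ⊗₁ Δ) $ (Δ $ gen (0 , c)) ∎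

    step : ∀ v q → _ → _
    step v q ih = begin
      assoc $ ((Δ ⊗₁ id) $ (Δ $ (L $ q)))
        ≈⟨ _⊸_.⟦⟧-cong (assoc ∘ₗ (Δ ⊗₁ id)) (Δ-prepend v q) ⟩
      assoc $ ((Δ ⊗₁ id) $ (one ⊗ₜ (L $ q))) ⊕ assoc $ ((Δ ⊗₁ id) $ ((L ⊗₁ id) $ (Δ $ q)))
        ≈⟨ ⊕-cong (Δ-one (L $ q)) (left (Δ $ q)) ⟩
      one ⊗ₜ (one ⊗ₜ (L $ q))
        ⊕ (one ⊗ₜ ((L ⊗₁ id) $ (Δ $ q)) ⊕ (L ⊗₁ idₗ) $ (assoc $ ((Δ ⊗₁ id) $ (Δ $ q))))
        ≈⟨ ⊕-assoc _ _ _ ⟨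
      (one ⊗ₜ (one ⊗ₜ (L $ q)) ⊕ one ⊗ₜ ((L ⊗₁ id) $ (Δ $ q)))
        ⊕ (L ⊗₁ idₗ) $ (assoc $ ((Δ ⊗₁ id) $ (Δ $ q)))
        ≈⟨ ⊕-cong (relation (⊗-+ʳ _ _ _)) (_⊸_.⟦⟧-cong (L ⊗₁ idₗ) (~sym ih)) ⟨
      one ⊗ₜ (one ⊗ₜ (L $ q) ⊕ (L ⊗₁ id) $ (Δ $ q)) ⊕ (L ⊗₁ idₗ) $ ((id ⊗₁ Δ) $ (Δ $ q))
        ≈⟨ ⊕-cong (_⊸_.⟦⟧-cong (one ⊗ₜ-) (~sym (Δ-prepend v q))) (right (Δ $ q)) ⟩
      (id ⊗₁ Δ) $ (one ⊗ₜ (L $ q)) ⊕ (id ⊗₁ Δ) $ ((L ⊗₁ id) $ (Δ $ q))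
        ≈⟨ _⊸_.⟦⟧-cong (id ⊗₁ Δ) (Δ-prepend v q) ⟨
      (id ⊗₁ Δ) $ (Δ $ (L $ q)) ∎
      where
      L = prepend v

      right : ∀ t → space ⊗ (space ⊗ space)
        [ (L ⊗₁ idₗ) $ ((id ⊗₁ Δ) $ t) ≈ (id ⊗₁ Δ) $ ((L ⊗₁ id) $ t) ]
      right = ⊗-ext ((L ⊗₁ idₗ) ∘ₗ (id ⊗₁ Δ)) ((id ⊗₁ Δ) ∘ₗ (L ⊗₁ id)) (λ _ _ → ~refl)

      left : ∀ t → space ⊗ (space ⊗ space)
        [ assoc $ ((Δ ⊗₁ id) $ ((L ⊗₁ id) $ t))
        ≈ one ⊗ₜ ((L ⊗₁ id) $ t) ⊕ (L ⊗₁ idₗ) $ (assoc $ ((Δ ⊗₁ id) $ t)) ]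
      left = ⊗-ext (assoc ∘ₗ (Δ ⊗₁ id) ∘ₗ (L ⊗₁ id))
        (one ⊗ₜ- ∘ₗ (L ⊗₁ id) +ₗ (L ⊗₁ idₗ) ∘ₗ assoc ∘ₗ (Δ ⊗₁ id)) λ a b → begin
        assoc $ ((Δ $ (L $ a)) ⊗ₜ b)
          ≈⟨ _⊸_.⟦⟧-cong (idₗ ⊗₁ -⊗ₜ b) (Δ-prepend v a) ⟩
        one ⊗ₜ ((L $ a) ⊗ₜ b) ⊕ (id ⊗₁ -⊗ₜ b) $ ((L ⊗₁ id) $ (Δ $ a))
          ≈⟨ ⊕-cong ~refl (⊗-ext ((id ⊗₁ -⊗ₜ b) ∘ₗ (L ⊗₁ id)) ((L ⊗₁ idₗ) ∘ₗ (id ⊗₁ -⊗ₜ b))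
               (λ _ _ → ~refl) (Δ $ a)) ⟩
        one ⊗ₜ ((L $ a) ⊗ₜ b) ⊕ (L ⊗₁ idₗ) $ ((id ⊗₁ -⊗ₜ b) $ (Δ $ a)) ∎

  ε-prepend : ∀ v q → ε $ (prepend v $ q) ≡ 0ℚ
  ε-prepend v = linear-ext (ε ∘ₗ prepend v) 0ₗ (λ _ → ≡.refl)

  ⊗ₜ-0 : ∀ {U W : VectorSpace} (u : ∣ U ∣) → U ⊗ W [ u ⊗ₜ LeftModule.0ᴹ W ≈ 𝟎 ]
  ⊗ₜ-0 u = _⊸_.0ᴹ-homo (u ⊗ₜ-)

  counitˡ : ∀ q → ℚ¹ ⊗ space [ (ε ⊗₁ id) $ (Δ $ q) ≈ 1ℚ ⊗ₜ q ]
  counitˡ = prepend-induction ((ε ⊗₁ id) ∘ₗ Δ) (1ℚ ⊗ₜ-)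
    (λ c → _⊸_.⟦⟧-cong (ε ⊗₁ id) (Δ-0 c))
    λ v q _ → begin
      (ε ⊗₁ id) $ (Δ $ (prepend v $ q))
        ≈⟨ _⊸_.⟦⟧-cong (ε ⊗₁ id) (Δ-prepend v q) ⟩
      1ℚ ⊗ₜ (prepend v $ q) ⊕ (ε ⊗₁ id) $ ((prepend v ⊗₁ id) $ (Δ $ q))
        ≈⟨ ⊕-cong ~refl (⊗-ext ((ε ⊗₁ id) ∘ₗ (prepend v ⊗₁ id)) 0ₗ
             (λ a b → ~trans (relation (⊗-cong (ε-prepend v a) ~refl)) (_⊸_.0ᴹ-homo (-⊗ₜ b)))
             (Δ $ q)) ⟩
      1ℚ ⊗ₜ (prepend v $ q) ⊕ 𝟎
        ≈⟨ LeftModule.+ᴹ-identityʳ (ℚ¹ ⊗ space) _ ⟩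
      1ℚ ⊗ₜ (prepend v $ q) ∎
    where open ≈-Reasoning (LeftModule.≈ᴹ-setoid (ℚ¹ ⊗ space))

  counitʳ : ∀ q → space ⊗ ℚ¹ [ (id ⊗₁ ε) $ (Δ $ q) ≈ q ⊗ₜ 1ℚ ]
  counitʳ = prepend-induction ((id ⊗₁ ε) ∘ₗ Δ) (-⊗ₜ 1ℚ)
    (λ c → begin
      (id ⊗₁ ε) $ (Δ $ gen (0 , c))  ≈⟨ _⊸_.⟦⟧-cong (id ⊗₁ ε) (Δ-0 c) ⟩
      one ⊗ₜ c                       ≡⟨ ≡.cong (one ⊗ₜ_) (ℚ.*-identityʳ c) ⟨
      one ⊗ₜ (c *ℚ 1ℚ)               ≈⟨ relation (⊗-•ʳ c one 1ℚ) ⟩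
      c ⊙ one ⊗ₜ 1ℚ                  ≈⟨ relation (⊗-•ˡ c one 1ℚ) ⟨
      (c ⊙ one) ⊗ₜ 1ℚ                ≈⟨ relation (⊗-cong (relation (⨁-• 0 c 1ℚ)) ≡.refl) ⟨
      gen (0 , c *ℚ 1ℚ) ⊗ₜ 1ℚ        ≡⟨ ≡.cong (λ d → gen (0 , d) ⊗ₜ 1ℚ) (ℚ.*-identityʳ c) ⟩
      gen (0 , c) ⊗ₜ 1ℚ              ∎)
    λ v q ih → begin
      (id ⊗₁ ε) $ (Δ $ (prepend v $ q))
        ≈⟨ _⊸_.⟦⟧-cong (id ⊗₁ ε) (Δ-prepend v q) ⟩
      one ⊗ₜ (ε $ (prepend v $ q)) ⊕ (id ⊗₁ ε) $ ((prepend v ⊗₁ id) $ (Δ $ q))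
        ≈⟨ ⊕-cong (~trans (relation (⊗-cong ~refl (ε-prepend v q))) (⊗ₜ-0 {space} {ℚ¹} one))
             (⊗-ext ((id ⊗₁ ε) ∘ₗ (prepend v ⊗₁ id)) ((prepend v ⊗₁ idₗ {ℚ¹}) ∘ₗ (id ⊗₁ ε))
               (λ _ _ → ~refl) (Δ $ q)) ⟩
      𝟎 ⊕ (prepend v ⊗₁ idₗ {ℚ¹}) $ ((id ⊗₁ ε) $ (Δ $ q))
        ≈⟨ ⊕-identityˡ _ ⟩
      (prepend v ⊗₁ idₗ {ℚ¹}) $ ((id ⊗₁ ε) $ (Δ $ q))
        ≈⟨ _⊸_.⟦⟧-cong (prepend v ⊗₁ idₗ {ℚ¹}) ih ⟩
      (prepend v $ q) ⊗ₜ 1ℚ ∎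
    where open ≈-Reasoning (LeftModule.≈ᴹ-setoid (space ⊗ ℚ¹))

  coalgebra : Coalgebra
  coalgebra = record
    { space = space ; Δ = Δ ; ε = ε
    ; coassoc = coassoc ; counitˡ = counitˡ ; counitʳ = counitʳ }

  grade : ℕ → Subspace space
  grade k = image (ι k)

  corestrict : ∀ k → V ^⊗ k ⊸ subspace (grade k)
  corestrict k = linear (λ w → gen (k , w) , w , ~refl)
    (λ e → relation (⨁-cong e)) (λ w w′ → relation (⨁-+ k w w′)) (λ c w → relation (⨁-• k c w))

  total : ⨁ (λ k → subspace (grade k)) ⊸ space
  total = cotuple (λ k → incl (grade k))

  untotal : space ⊸ ⨁ (λ k → subspace (grade k))
  untotal = cotuple (λ k → ι k ∘ₗ corestrict k)

  untotal-total : ∀ s → ⨁ (λ k → subspace (grade k)) [ untotal $ (total $ s) ≈ s ]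
  untotal-total = linear-ext (untotal ∘ₗ total) idₗ λ (k , y , w , e) →
    ~trans (~sym (_⊸_.⟦⟧-cong untotal e)) (relation (⨁-cong e))

  total-untotal : ∀ q → space [ total $ (untotal $ q) ≈ q ]
  total-untotal = linear-ext (total ∘ₗ untotal) idₗ (λ _ → ~refl)

  Δ-graded : ∀ k q → q ∈ grade k → Δ $ q ∈ ⊗-degree grade k
  Δ-graded k q (w , e) =
    Subspace.≈-closed (⊗-degree grade k) (_⊸_.⟦⟧-cong Δ e) (∑-∈ (allFin (suc k)))
    where
    term : Fin (suc k) → ∣ space ⊗ space ∣
    term i = (ι (toℕ i) ⊗₁ ι (k ∸ toℕ i)) $ (split k i $ w)
    term-∈ : ∀ i → term i ∈ ⊗-degree grade k
    term-∈ i = gen (i , (corestrict (toℕ i) ⊗₁ corestrict (k ∸ toℕ i)) $ (split k i $ w)) ,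
      ⊗-ext ((incl (grade (toℕ i)) ⊗₁ incl (grade (k ∸ toℕ i)))
               ∘ₗ (corestrict (toℕ i) ⊗₁ corestrict (k ∸ toℕ i)))
            (ι (toℕ i) ⊗₁ ι (k ∸ toℕ i)) (λ _ _ → ~refl) (split k i $ w)
    ∑-∈ : ∀ is → ∑ (space ⊗ space) is term ∈ ⊗-degree grade k
    ∑-∈ []       = Subspace.0-closed (⊗-degree grade k)
    ∑-∈ (i ∷ is) = Subspace.+-closed (⊗-degree grade k) (term-∈ i) (∑-∈ is)

  gradedCoalgebra : GradedCoalgebra
  gradedCoalgebra = record
    { coalgebra = coalgebra
    ; grade = grade
    ; isGrading = record
      { directSum =
          (λ {s} {t} e → ~trans (~sym (untotal-total s))
                        (~trans (_⊸_.⟦⟧-cong untotal e) (untotal-total t))) ,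
          (λ q → untotal $ q , λ e → ~trans (_⊸_.⟦⟧-cong total e) (total-untotal q))
      ; Δ-graded = Δ-graded
      }
    }

Q : VectorSpace → GradedCoalgebra
Q = Cofree.gradedCoalgebra

𝔖 : ℕ → Set
𝔖 = Permutation′

private variable n : ℕ

count : {A : Set} {P : Pred A 0ℓ} → Decidable P → List A → ℕ
count P? xs = length (filter P? xs)

module _ {A : Set} {P Q : Pred A 0ℓ} (P? : Decidable P) (Q? : Decidable Q) where

  count-≤ : ∀ xs → (∀ {x} → x ∈ˡ xs → P x → Q x) → count P? xs ≤ count Q? xs
  count-≤ []       P⊆Q = z≤n
  count-≤ (x ∷ xs) P⊆Q with P? x | Q? x
  ... | yes p | yes q = s≤s (count-≤ xs (P⊆Q ∘ there))
  ... | yes p | no ¬q = contradiction (P⊆Q (here ≡.refl) p) ¬q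
  ... | no ¬p | yes q = ℕ.m≤n⇒m≤1+n (count-≤ xs (P⊆Q ∘ there))
  ... | no ¬p | no ¬q = count-≤ xs (P⊆Q ∘ there)

  count-< : ∀ xs → (∀ {x} → x ∈ˡ xs → P x → Q x) →
            ∀ {x} → x ∈ˡ xs → ¬ P x → Q x → count P? xs < count Q? xs
  count-< (x ∷ xs) P⊆Q (here ≡.refl) ¬Px Qx with P? x | Q? x
  ... | yes p | _     = contradiction p ¬Px
  ... | no ¬p | yes q = s≤s (count-≤ xs (P⊆Q ∘ there))
  ... | no ¬p | no ¬q = contradiction Qx ¬q
  count-< (x ∷ xs) P⊆Q (there i) ¬Px Qx with P? x | Q? x
  ... | yes p | yes q = s≤s (count-< xs (P⊆Q ∘ there) i ¬Px Qx)
  ... | yes p | no ¬q = contradiction (P⊆Q (here ≡.refl) p) ¬q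
  ... | no ¬p | yes q = ℕ.m≤n⇒m≤1+n (count-< xs (P⊆Q ∘ there) i ¬Px Qx)
  ... | no ¬p | no ¬q = count-< xs (P⊆Q ∘ there) i ¬Px Qx

count-map : {P Q : Pred ℕ 0ℓ} (P? : Decidable P) (Q? : Decidable Q)
            (g : ℕ → ℕ) → ∀ xs →
            (∀ {x} → x ∈ˡ xs → P (g x) → Q x) → (∀ {x} → x ∈ˡ xs → Q x → P (g x)) →
            count P? (map g xs) ≡ count Q? xs
count-map P? Q? g []       _ _ = ≡.refl
count-map P? Q? g (x ∷ xs) P⇒Q Q⇒P with P? (g x) | Q? x
... | yes p | yes q = ≡.cong suc (count-map P? Q? g xs (P⇒Q ∘ there) (Q⇒P ∘ there))
... | yes p | no ¬q = contradiction (P⇒Q (here ≡.refl) p) ¬q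
... | no ¬p | yes q = contradiction (Q⇒P (here ≡.refl) q) ¬p
... | no ¬p | no ¬q = count-map P? Q? g xs (P⇒Q ∘ there) (Q⇒P ∘ there)

lookup-injective : {A : Set} {xs : List A} → Unique xs →
                   ∀ {i j} → lookup xs i ≡ lookup xs j → i ≡ j
lookup-injective (x ∷ u) {zero}  {zero}  e = ≡.refl
lookup-injective (x ∷ u) {zero}  {suc j} e = contradiction e (All.lookup x (∈ˡ.∈-lookup j))
lookup-injective (x ∷ u) {suc i} {zero}  e = contradiction (≡.sym e) (All.lookup x (∈ˡ.∈-lookup i))
lookup-injective (x ∷ u) {suc i} {suc j} e = ≡.cong suc (lookup-injective u e)

injective⇒surjective : (f : Fin n → Fin n) → (∀ {i j} → f i ≡ f j → i ≡ j) →
                       ∀ y → ∃ λ x → f x ≡ y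
injective⇒surjective {suc n} f inj y with Fin.any? (λ x → f x Fin.≟ y)
... | yes p = p
... | no ¬p = contradiction (Fin.injective⇒≤ {f = λ x → punchOut (λ e → ¬p (x , ≡.sym e))}
                (λ {i} {j} e → inj (Fin.punchOut-injective (λ e → ¬p (i , ≡.sym e)) (λ e → ¬p (j , ≡.sym e)) e))) ℕ.1+n≰n

injective⇒permutation : (f : Fin n → Fin n) → (∀ {i j} → f i ≡ f j → i ≡ j) → 𝔖 n
injective⇒permutation f inj = permutation f (proj₁ ∘ surj) (proj₂ ∘ surj)
  (λ x → inj (proj₂ (surj (f x))))
  where surj = injective⇒surjective f inj

injective : (u : 𝔖 n) → ∀ {i j} → u ⟨$⟩ʳ i ≡ u ⟨$⟩ʳ j → i ≡ j
injective u e = ≡.trans (≡.sym (inverseˡ u)) (≡.trans (≡.cong (u ⟨$⟩ˡ_) e) (inverseˡ u))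

word : 𝔖 n → List ℕ
word u = tabulate (λ i → toℕ (u ⟨$⟩ʳ i))

word-unique : (u : 𝔖 n) → Unique (word u)
word-unique u = Unique.tabulate⁺ (injective u ∘ Fin.toℕ-injective)

rank : List ℕ → ℕ → ℕ
rank w a = count (ℕ._<? a) w

rank-< : ∀ w {a b} → a ∈ˡ w → a < b → rank w a < rank w b
rank-< w {a} {b} a∈w a<b = count-< (ℕ._<? a) (ℕ._<? b) w (λ _ x<a → ℕ.<-trans x<a a<b)
  a∈w (ℕ.<-irrefl ≡.refl) a<b

rank-<⁻ : ∀ w {a b} → b ∈ˡ w → rank w a < rank w b → a < b
rank-<⁻ w {a} {b} b∈w r with ℕ.<-cmp a b
... | tri< a<b _ _    = a<b
... | tri≈ _ ≡.refl _ = contradiction r (ℕ.<-irrefl ≡.refl)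
... | tri> _ _ b<a    = contradiction r (ℕ.<-asym (rank-< w b∈w b<a))

rank-injective : ∀ w {a b} → a ∈ˡ w → b ∈ˡ w → rank w a ≡ rank w b → a ≡ b
rank-injective w {a} {b} a∈w b∈w e with ℕ.<-cmp a b
... | tri< a<b _ _ = contradiction e (ℕ.<⇒≢ (rank-< w a∈w a<b))
... | tri≈ _ a≡b _ = a≡b
... | tri> _ _ b<a = contradiction (≡.sym e) (ℕ.<⇒≢ (rank-< w b∈w b<a))

rank-bound : ∀ w {a} → a ∈ˡ w → rank w a < length w
rank-bound w {a} a∈w = List.filter-notAll (ℕ._<? a) w
  (Any.map (λ where ≡.refl → ℕ.<-irrefl ≡.refl) a∈w)

-- The letter in position i becomes #{j : wⱼ < wᵢ}, values being numbered from 0.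
st : (w : List ℕ) → Unique w → 𝔖 (length w)
st w unique = injective⇒permutation
  (λ i → fromℕ< (rank-bound w (∈ˡ.∈-lookup i)))
  (λ {i} {j} e → lookup-injective unique (rank-injective w (∈ˡ.∈-lookup i) (∈ˡ.∈-lookup j)
    (Fin.fromℕ<-injective _ _ _ _ e)))

data 𝔖Sym-Relation : Rel (Combination (Σ ℕ 𝔖)) 0ℓ where
  ≈ₚ⇒~ : {u v : 𝔖 n} → u ≈ₚ v → 𝔖Sym-Relation (gen (n , u)) (gen (n , v))

𝔖Sym-space : VectorSpace
𝔖Sym-space = Presented 𝔖Sym-Relation

F : 𝔖 n → Combination (Σ ℕ 𝔖)
F {n} u = gen (n , u)

ΔF : (u : 𝔖 n) → ∣ 𝔖Sym-space ⊗ 𝔖Sym-space ∣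
ΔF {n} u = ∑ (𝔖Sym-space ⊗ 𝔖Sym-space) (upTo (suc n)) λ p →
  F (st (take p (word u)) (Unique.take⁺ p (word-unique u))) ⊗ₜ
  F (st (drop p (word u)) (Unique.drop⁺ p (word-unique u)))

εF : 𝔖 n → ℚ
εF {zero}  _ = 1ℚ
εF {suc _} _ = 0ℚ

increasing⇒≤ : (h : Fin n → Fin n) → (∀ {i j} → i <ᶠ j → h i <ᶠ h j) → ∀ i → toℕ i ≤ toℕ (h i)
increasing⇒≤ {n} h mono i = go (toℕ i) i ≡.refl
  where
  go : ∀ k (i : Fin n) → toℕ i ≡ k → k ≤ toℕ (h i)
  go zero    i       e = z≤n
  go (suc k) i e = ℕ.≤-<-trans (go k j j≡k) (mono j<i)
    where
    k<n : k < n
    k<n = ℕ.<-trans (ℕ.≤-reflexive (≡.sym e)) (Fin.toℕ<n i)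
    j : Fin n
    j = fromℕ< k<n
    j≡k : toℕ j ≡ k
    j≡k = Fin.toℕ-fromℕ< k<n
    j<i : j <ᶠ i
    j<i = ≡.subst₂ _<_ (≡.sym j≡k) (≡.sym e) ℕ.≤-refl

sameOrder⇒≤ : (u v : 𝔖 n) → (∀ {i j} → u ⟨$⟩ʳ i <ᶠ u ⟨$⟩ʳ j → v ⟨$⟩ʳ i <ᶠ v ⟨$⟩ʳ j) →
              ∀ i → toℕ (u ⟨$⟩ʳ i) ≤ toℕ (v ⟨$⟩ʳ i)
sameOrder⇒≤ u v o i = ≡.subst (λ k → toℕ (u ⟨$⟩ʳ i) ≤ toℕ (v ⟨$⟩ʳ k)) (inverseˡ u)
  (increasing⇒≤ (λ a → v ⟨$⟩ʳ (u ⟨$⟩ˡ a))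
    (λ a<b → o (≡.subst₂ _<ᶠ_ (≡.sym (inverseʳ u)) (≡.sym (inverseʳ u)) a<b)) (u ⟨$⟩ʳ i))

sameOrder⇒≈ : (u v : 𝔖 n) → (∀ {i j} → u ⟨$⟩ʳ i <ᶠ u ⟨$⟩ʳ j → v ⟨$⟩ʳ i <ᶠ v ⟨$⟩ʳ j) →
              (∀ {i j} → v ⟨$⟩ʳ i <ᶠ v ⟨$⟩ʳ j → u ⟨$⟩ʳ i <ᶠ u ⟨$⟩ʳ j) → u ≈ₚ v
sameOrder⇒≈ u v o o′ i =
  Fin.toℕ-injective (ℕ.≤-antisym (sameOrder⇒≤ u v o i) (sameOrder⇒≤ v u o′ i))

tabulate-injective : {A : Set} {f g : Fin n → A} → tabulate f ≡ tabulate g → ∀ i → f i ≡ g i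
tabulate-injective {suc n} e zero    = List.∷-injectiveˡ e
tabulate-injective {suc n} e (suc i) = tabulate-injective (List.∷-injectiveʳ e) i

F-word : ∀ {m n} (u : 𝔖 m) (v : 𝔖 n) → word u ≡ word v → 𝔖Sym-space [ F u ≈ F v ]
F-word u v e with ≡.trans (≡.sym (List.length-tabulate (λ i → toℕ (u ⟨$⟩ʳ i))))
                  (≡.trans (≡.cong length e) (List.length-tabulate (λ i → toℕ (v ⟨$⟩ʳ i))))
... | ≡.refl = relation (≈ₚ⇒~ (λ i → Fin.toℕ-injective (tabulate-injective e i)))

word-st : ∀ w unique → word (st w unique) ≡ map (rank w) w
word-st w unique = begin
  tabulate (λ i → toℕ (fromℕ< (rank-bound w (∈ˡ.∈-lookup i))))
    ≡⟨ List.tabulate-cong (λ i → Fin.toℕ-fromℕ< (rank-bound w (∈ˡ.∈-lookup i))) ⟩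
  tabulate (λ i → rank w (lookup w i))  ≡⟨ List.map-tabulate (lookup w) (rank w) ⟨
  map (rank w) (tabulate (lookup w))    ≡⟨ ≡.cong (map (rank w)) (List.tabulate-lookup w) ⟩
  map (rank w) w                        ∎
  where open ≡.≡-Reasoning

map-rank-word : (u : 𝔖 n) → map (rank (word u)) (word u) ≡ word u
map-rank-word u = ≡.trans (List.map-tabulate _ (rank (word u)))
  (List.tabulate-cong λ i → ≡.trans (≡.sym (r≡ i)) (≡.cong toℕ (sameOrder⇒≈ r u r⇒u u⇒r i)))
  where
  ∈w : ∀ i → toℕ (u ⟨$⟩ʳ i) ∈ˡ word u
  ∈w = ∈ˡ.∈-tabulate⁺
  bound : ∀ i → rank (word u) (toℕ (u ⟨$⟩ʳ i)) < _
  bound i = ℕ.<-≤-trans (rank-bound (word u) (∈w i)) (ℕ.≤-reflexive (List.length-tabulate _))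
  r : 𝔖 _
  r = injective⇒permutation (λ i → fromℕ< (bound i)) λ {i} {j} e → injective u (Fin.toℕ-injective
    (rank-injective (word u) (∈w i) (∈w j) (Fin.fromℕ<-injective _ _ _ _ e)))
  r≡ : ∀ i → toℕ (r ⟨$⟩ʳ i) ≡ rank (word u) (toℕ (u ⟨$⟩ʳ i))
  r≡ i = Fin.toℕ-fromℕ< (bound i)
  r⇒u : ∀ {i j} → r ⟨$⟩ʳ i <ᶠ r ⟨$⟩ʳ j → u ⟨$⟩ʳ i <ᶠ u ⟨$⟩ʳ j
  r⇒u {i} {j} lt = rank-<⁻ (word u) (∈w j) (≡.subst₂ _<_ (r≡ i) (r≡ j) lt)
  u⇒r : ∀ {i j} → u ⟨$⟩ʳ i <ᶠ u ⟨$⟩ʳ j → r ⟨$⟩ʳ i <ᶠ r ⟨$⟩ʳ j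
  u⇒r {i} {j} lt = ≡.subst₂ _<_ (≡.sym (r≡ i)) (≡.sym (r≡ j)) (rank-< (word u) (∈w i) lt)

map-rank-map : (g : ℕ → ℕ) → ∀ w → (∀ {a b} → a ∈ˡ w → b ∈ˡ w → a < b → g a < g b) →
               (∀ {a b} → a ∈ˡ w → b ∈ˡ w → g a < g b → a < b) →
               map (rank (map g w)) (map g w) ≡ map (rank w) w
map-rank-map g w o o′ = ≡.trans (≡.sym (List.map-∘ w)) (List.map-cong-local
  (All.tabulate λ {a} a∈w → count-map (ℕ._<? g a) (ℕ._<? a) g w
    (λ x∈w → o′ x∈w a∈w) (λ x∈w → o x∈w a∈w)))

-- F (st w), extended by 0 to words with repetitions
Fst : List ℕ → ∣ 𝔖Sym-space ∣
Fst w with unique? w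
... | yes u = F (st w u)
... | no _  = 𝟎

FF : List ℕ → List ℕ → ∣ 𝔖Sym-space ⊗ 𝔖Sym-space ∣
FF x y = Fst x ⊗ₜ Fst y

F-Fst : (u : 𝔖 n) → ∀ w → Unique w → word u ≡ map (rank w) w → 𝔖Sym-space [ F u ≈ Fst w ]
F-Fst u w unique e with unique? w
... | yes p = F-word u (st w p) (≡.trans e (≡.sym (word-st w p)))
... | no ¬p = contradiction unique ¬p

module _ (W : VectorSpace) where
  private
    module W = LeftModule W
    open CommSemigroup (CommutativeMonoid.commutativeSemigroup W.+ᴹ-commutativeMonoid) using (interchange)

  ∑-applyUpTo : {I : Set} (x : I → ∣ W ∣) (g : ℕ → I) → ∀ k →
                ∑ W (applyUpTo g k) x ≡ ∑ W (upTo k) (x ∘ g)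
  ∑-applyUpTo x g zero    = ≡.refl
  ∑-applyUpTo x g (suc k) = ≡.cong (W._+ᴹ_ (x (g 0)))
    (≡.trans (∑-applyUpTo x (g ∘ suc) k) (≡.sym (∑-applyUpTo (x ∘ g) suc k)))

  ∑-+ : {I : Set} (x y : I → ∣ W ∣) → ∀ is →
        W [ ∑ W is (λ i → x i W.+ᴹ y i) ≈ ∑ W is x W.+ᴹ ∑ W is y ]
  ∑-+ x y []       = W.≈ᴹ-sym (W.+ᴹ-identityˡ _)
  ∑-+ x y (i ∷ is) = W.≈ᴹ-trans (W.+ᴹ-cong W.≈ᴹ-refl (∑-+ x y is)) (interchange _ _ _ _)

  cuts : {A : Set} → List A → (List A → List A → ∣ W ∣) → ∣ W ∣
  cuts w f = ∑ W (upTo (suc (length w))) (λ p → f (take p w) (drop p w))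

  module _ {A : Set} where
    cuts-[] : (f : List A → List A → ∣ W ∣) → W [ cuts [] f ≈ f [] [] ]
    cuts-[] f = W.+ᴹ-identityʳ _

    cuts-∷ : ∀ (a : A) w f → cuts (a ∷ w) f ≡ f [] (a ∷ w) W.+ᴹ cuts w (λ x y → f (a ∷ x) y)
    cuts-∷ a w f = ≡.cong (W._+ᴹ_ (f [] (a ∷ w)))
      (∑-applyUpTo (λ p → f (take p (a ∷ w)) (drop p (a ∷ w))) suc (suc (length w)))

    cuts-cong : ∀ (w : List A) {f g} → (∀ x y → W [ f x y ≈ g x y ]) → W [ cuts w f ≈ cuts w g ]
    cuts-cong w e = ∑-cong W (upTo (suc (length w))) (λ p → e (take p w) (drop p w))

    cuts-cuts : ∀ w (T : List A → List A → List A → ∣ W ∣) →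
      W [ cuts w (λ x y → cuts x (λ x₁ x₂ → T x₁ x₂ y))
        ≈ cuts w (λ x y → cuts y (λ y₁ y₂ → T x y₁ y₂)) ]
    cuts-cuts []      T = W.≈ᴹ-refl
    cuts-cuts (a ∷ w) T = begin
      cuts (a ∷ w) (λ x y → cuts x (λ x₁ x₂ → T x₁ x₂ y))
        ≡⟨ cuts-∷ a w (λ x y → cuts x (λ x₁ x₂ → T x₁ x₂ y)) ⟩
      cuts [] (λ x₁ x₂ → T x₁ x₂ (a ∷ w))
        W.+ᴹ cuts w (λ x y → cuts (a ∷ x) (λ x₁ x₂ → T x₁ x₂ y))
        ≈⟨ W.+ᴹ-cong (cuts-[] (λ x₁ x₂ → T x₁ x₂ (a ∷ w)))
             (cuts-cong w (λ x y → W.≈ᴹ-reflexive (cuts-∷ a x (λ x₁ x₂ → T x₁ x₂ y)))) ⟩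
      T [] [] (a ∷ w)
        W.+ᴹ cuts w (λ x y → T [] (a ∷ x) y W.+ᴹ cuts x (λ x₁ x₂ → T (a ∷ x₁) x₂ y))
        ≈⟨ W.+ᴹ-cong W.≈ᴹ-refl (∑-+ _ _ (upTo (suc (length w)))) ⟩
      T [] [] (a ∷ w) W.+ᴹ (cuts w (λ x y → T [] (a ∷ x) y)
        W.+ᴹ cuts w (λ x y → cuts x (λ x₁ x₂ → T (a ∷ x₁) x₂ y)))
        ≈⟨ W.+ᴹ-assoc _ _ _ ⟨
      (T [] [] (a ∷ w) W.+ᴹ cuts w (λ x y → T [] (a ∷ x) y))
        W.+ᴹ cuts w (λ x y → cuts x (λ x₁ x₂ → T (a ∷ x₁) x₂ y))
        ≈⟨ W.+ᴹ-cong (W.≈ᴹ-reflexive (≡.sym (cuts-∷ a w (T [])))) (cuts-cuts w (T ∘ (a ∷_))) ⟩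
      cuts (a ∷ w) (T []) W.+ᴹ cuts w (λ x y → cuts y (T (a ∷ x)))
        ≡⟨ cuts-∷ a w (λ x y → cuts y (T x)) ⟨
      cuts (a ∷ w) (λ x y → cuts y (T x)) ∎
      where open ≈-Reasoning W.≈ᴹ-setoid

$-cuts : {V W : VectorSpace} (f : V ⊸ W) → ∀ (w : List ℕ) g →
         W [ f $ cuts V w g ≈ cuts W w (λ x y → f $ g x y) ]
$-cuts {V} f w g = $-∑ V f (upTo (suc (length w))) _

take-∈ : ∀ p {a} (w : List ℕ) → a ∈ˡ take p w → a ∈ˡ w
take-∈ (suc p) (b ∷ w) (here e)  = here e
take-∈ (suc p) (b ∷ w) (there i) = there (take-∈ p w i)

drop-∈ : ∀ p {a} (w : List ℕ) → a ∈ˡ drop p w → a ∈ˡ w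
drop-∈ zero    w       i = i
drop-∈ (suc p) (b ∷ w) i = there (drop-∈ p w i)

ΔF-cuts : (u : 𝔖 n) → ∀ w → Unique w → word u ≡ map (rank w) w →
          𝔖Sym-space ⊗ 𝔖Sym-space [ ΔF u ≈ cuts (𝔖Sym-space ⊗ 𝔖Sym-space) w FF ]
ΔF-cuts {n} u w unique e = ≡.subst
  (λ k → 𝔖Sym-space ⊗ 𝔖Sym-space [ ΔF u ≈ ∑ (𝔖Sym-space ⊗ 𝔖Sym-space) (upTo (suc k)) (λ p → Fst (take p w) ⊗ₜ Fst (drop p w)) ])
  length≡
  (∑-cong (𝔖Sym-space ⊗ 𝔖Sym-space) (upTo (suc n)) λ p → relation (⊗-cong
    (F-Fst _ (take p w) (Unique.take⁺ p unique) (≡.trans (word-st _ (Unique.take⁺ p (word-unique u)))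
      (same (take p (word u)) (take p w) (≡.trans (≡.cong (take p) e) (List.take-map p w)) (take-∈ p w))))
    (F-Fst _ (drop p w) (Unique.drop⁺ p unique) (≡.trans (word-st _ (Unique.drop⁺ p (word-unique u)))
      (same (drop p (word u)) (drop p w) (≡.trans (≡.cong (drop p) e) (List.drop-map p w)) (drop-∈ p w))))))
  where
  length≡ : n ≡ length w
  length≡ = ≡.trans (≡.sym (List.length-tabulate (λ i → toℕ (u ⟨$⟩ʳ i))))
            (≡.trans (≡.cong length e) (List.length-map (rank w) w))
  same : ∀ x y → x ≡ map (rank w) y → (∀ {a} → a ∈ˡ y → a ∈ˡ w) → map (rank x) x ≡ map (rank y) y
  same _ y ≡.refl y⊆w = map-rank-map (rank w) y
    (λ a∈ _ → rank-< w (y⊆w a∈)) (λ _ b∈ → rank-<⁻ w (y⊆w b∈))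

ΔF-word : (u : 𝔖 n) → 𝔖Sym-space ⊗ 𝔖Sym-space [ ΔF u ≈ cuts (𝔖Sym-space ⊗ 𝔖Sym-space) (word u) FF ]
ΔF-word u = ΔF-cuts u (word u) (word-unique u) (≡.sym (map-rank-word u))

F-Fst-word : (u : 𝔖 n) → 𝔖Sym-space [ F u ≈ Fst (word u) ]
F-Fst-word u = F-Fst u (word u) (word-unique u) (≡.sym (map-rank-word u))

word-cong : (u v : 𝔖 n) → u ≈ₚ v → word u ≡ word v
word-cong u v e = List.tabulate-cong (λ i → ≡.cong toℕ (e i))

𝔖Sym : Coalgebra
𝔖Sym = record
  { space = 𝔖Sym-space ; Δ = Δ ; ε = ε
  ; coassoc = linear-ext (assoc ∘ₗ (Δ ⊗₁ id) ∘ₗ Δ) ((id ⊗₁ Δ) ∘ₗ Δ) λ (_ , u) → coassoc u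
  ; counitˡ = linear-ext ((ε ⊗₁ id) ∘ₗ Δ) (1ℚ ⊗ₜ-) λ (_ , u) → counitˡ u
  ; counitʳ = linear-ext ((id ⊗₁ ε) ∘ₗ Δ) (-⊗ₜ 1ℚ) λ (_ , u) → counitʳ u
  }
  where
  S² S³ : VectorSpace
  S² = 𝔖Sym-space ⊗ 𝔖Sym-space
  S³ = 𝔖Sym-space ⊗ (𝔖Sym-space ⊗ 𝔖Sym-space)
  id = idₗ {𝔖Sym-space}
  assoc = assocₗ {𝔖Sym-space} {𝔖Sym-space} {𝔖Sym-space}

  Δ : 𝔖Sym-space ⊸ S²
  Δ = extend S² (λ (_ , u) → ΔF u) λ where
    (≈ₚ⇒~ {u = u} {v} e) → ~trans (ΔF-word u) (≡.subst
      (λ w → S² [ cuts S² w FF ≈ ΔF v ])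
      (≡.sym (word-cong u v e)) (~sym (ΔF-word v)))

  ε : 𝔖Sym-space ⊸ ℚ¹
  ε = extend ℚ¹ (λ (_ , u) → εF u) λ where
    (≈ₚ⇒~ {zero} _)  → ≡.refl
    (≈ₚ⇒~ {suc _} _) → ≡.refl

  Δ-Fst : ∀ w → Unique w → S² [ Δ $ Fst w ≈ cuts S² w FF ]
  Δ-Fst w unique = ~trans (_⊸_.⟦⟧-cong Δ (~sym (F-Fst (st w unique) w unique (word-st w unique))))
    (ΔF-cuts (st w unique) w unique (word-st w unique))

  cuts-unique : (W : VectorSpace) → ∀ w {f g : List ℕ → List ℕ → ∣ W ∣} → Unique w →
                (∀ x y → Unique x → Unique y → W [ f x y ≈ g x y ]) → W [ cuts W w f ≈ cuts W w g ]
  cuts-unique W w unique e = ∑-cong W (upTo (suc (length w)))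
    (λ p → e _ _ (Unique.take⁺ p unique) (Unique.drop⁺ p unique))

  coassoc : (u : 𝔖 n) → S³ [ assoc $ ((Δ ⊗₁ id) $ ΔF u) ≈ (id ⊗₁ Δ) $ ΔF u ]
  coassoc u = begin
    assoc $ ((Δ ⊗₁ id) $ ΔF u)
      ≈⟨ _⊸_.⟦⟧-cong (assoc ∘ₗ (Δ ⊗₁ id)) (ΔF-word u) ⟩
    assoc $ ((Δ ⊗₁ id) $ cuts S² w FF)
      ≈⟨ $-cuts (assoc ∘ₗ (Δ ⊗₁ id)) w FF ⟩
    cuts S³ w (λ x y → (id ⊗₁ -⊗ₜ Fst y) $ (Δ $ Fst x))
      ≈⟨ cuts-unique S³ w (word-unique u) (λ x y unique _ →
           ~trans (_⊸_.⟦⟧-cong (id ⊗₁ -⊗ₜ Fst y) (Δ-Fst x unique)) ($-cuts (id ⊗₁ -⊗ₜ Fst y) x FF)) ⟩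
    cuts S³ w (λ x y → cuts S³ x (λ x₁ x₂ → Fst x₁ ⊗ₜ (Fst x₂ ⊗ₜ Fst y)))
      ≈⟨ cuts-cuts S³ w (λ x y z → Fst x ⊗ₜ (Fst y ⊗ₜ Fst z)) ⟩
    cuts S³ w (λ x y → cuts S³ y (λ y₁ y₂ → Fst x ⊗ₜ (Fst y₁ ⊗ₜ Fst y₂)))
      ≈⟨ cuts-unique S³ w (word-unique u) (λ x y _ unique →
           ~trans (_⊸_.⟦⟧-cong (Fst x ⊗ₜ-) (Δ-Fst y unique)) ($-cuts (Fst x ⊗ₜ-) y FF)) ⟨
    cuts S³ w (λ x y → Fst x ⊗ₜ (Δ $ Fst y))
      ≈⟨ $-cuts (id ⊗₁ Δ) w FF ⟨
    (id ⊗₁ Δ) $ cuts S² w FF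
      ≈⟨ _⊸_.⟦⟧-cong (id ⊗₁ Δ) (ΔF-word u) ⟨
    (id ⊗₁ Δ) $ ΔF u ∎
    where
    w = word u
    open ≈-Reasoning (LeftModule.≈ᴹ-setoid S³)

  ε-Fst-∷ : ∀ a w → ε $ Fst (a ∷ w) ≡ 0ℚ
  ε-Fst-∷ a w with unique? (a ∷ w)
  ... | yes _ = ≡.refl
  ... | no _  = ≡.refl

  counitˡ : (u : 𝔖 n) → ℚ¹ ⊗ 𝔖Sym-space [ (ε ⊗₁ id) $ ΔF u ≈ 1ℚ ⊗ₜ F u ]
  counitˡ u = ~trans (_⊸_.⟦⟧-cong (ε ⊗₁ id) (ΔF-word u))
    (~trans ($-cuts (ε ⊗₁ id) (word u) FF)
    (~trans (first (word u)) (_⊸_.⟦⟧-cong (1ℚ ⊗ₜ-) (~sym (F-Fst-word u)))))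
    where
    W = ℚ¹ ⊗ 𝔖Sym-space
    zeros : ∀ {A : Set} (w : List A) {f : List A → List A → ∣ W ∣} →
            (∀ x y → W [ f x y ≈ 𝟎 ]) → W [ cuts W w f ≈ 𝟎 ]
    zeros w {f} e = go (upTo (suc (length w)))
      where
      go : ∀ ps → W [ ∑ W ps (λ p → f (take p w) (drop p w)) ≈ 𝟎 ]
      go []       = ~refl
      go (p ∷ ps) = ~trans (⊕-cong (e _ _) (go ps)) (⊕-identityˡ 𝟎)
    εF⊗F : List ℕ → List ℕ → ∣ W ∣
    εF⊗F x y = (ε $ Fst x) ⊗ₜ Fst y
    first : ∀ w → W [ cuts W w εF⊗F ≈ 1ℚ ⊗ₜ Fst w ]
    first []      = cuts-[] W εF⊗F
    first (a ∷ w) = ~trans (LeftModule.≈ᴹ-reflexive W (cuts-∷ W a w εF⊗F))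
      (~trans (⊕-cong ~refl (zeros w (λ x y → ~trans (relation (⊗-cong (ε-Fst-∷ a x) ~refl))
                (_⊸_.0ᴹ-homo (-⊗ₜ_ {ℚ¹} {𝔖Sym-space} (Fst y))))))
              (LeftModule.+ᴹ-identityʳ W _))

  counitʳ : (u : 𝔖 n) → 𝔖Sym-space ⊗ ℚ¹ [ (id ⊗₁ ε) $ ΔF u ≈ F u ⊗ₜ 1ℚ ]
  counitʳ u = ~trans (_⊸_.⟦⟧-cong (id ⊗₁ ε) (ΔF-word u))
    (~trans ($-cuts (id ⊗₁ ε) (word u) FF)
    (~trans (last Fst (word u)) (_⊸_.⟦⟧-cong (-⊗ₜ 1ℚ) (~sym (F-Fst-word u)))))
    where
    W = 𝔖Sym-space ⊗ ℚ¹
    last : ∀ (f : List ℕ → ∣ 𝔖Sym-space ∣) w → W [ cuts W w (λ x y → f x ⊗ₜ (ε $ Fst y)) ≈ f w ⊗ₜ 1ℚ ]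
    last f []      = cuts-[] W (λ x y → f x ⊗ₜ (ε $ Fst y))
    last f (a ∷ w) = ~trans (LeftModule.≈ᴹ-reflexive W (cuts-∷ W a w (λ x y → f x ⊗ₜ (ε $ Fst y))))
      (~trans (⊕-cong (~trans (relation (⊗-cong ~refl (ε-Fst-∷ a w))) (_⊸_.0ᴹ-homo (_⊗ₜ- {𝔖Sym-space} {ℚ¹} (f []))))
                      (last (f ∘ (a ∷_)) w))
              (⊕-identityˡ _))

Inv : 𝔖 n → Pred (Fin n × Fin n) 0ℓ
Inv u (i , j) = i <ᶠ j × u ⟨$⟩ʳ i >ᶠ u ⟨$⟩ʳ j

infix 4 _≤ʷ_ _<ʷ_ _≤ʷ?_ _<ʷ?_ _≈ₚ?_

_≤ʷ_ : Rel (𝔖 n) 0ℓ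
u ≤ʷ v = Inv u ⊆ Inv v

_<ʷ_ : Rel (𝔖 n) 0ℓ
u <ʷ v = u ≤ʷ v × ¬ (u ≈ₚ v)

Inv? : (u : 𝔖 n) → Decidable (Inv u)
Inv? u (i , j) = (i Fin.<? j) ×-dec ((u ⟨$⟩ʳ j) Fin.<? (u ⟨$⟩ʳ i))

_≤ʷ?_ : (u v : 𝔖 n) → Dec (u ≤ʷ v)
u ≤ʷ? v = map′ (λ f {(i , j)} → f i j) (λ f i j → f)
  (Fin.all? λ i → Fin.all? λ j → Inv? u (i , j) →-dec Inv? v (i , j))

_≈ₚ?_ : (u v : 𝔖 n) → Dec (u ≈ₚ v)
u ≈ₚ? v = Fin.all? λ i → (u ⟨$⟩ʳ i) Fin.≟ (v ⟨$⟩ʳ i)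

_<ʷ?_ : (u v : 𝔖 n) → Dec (u <ʷ v)
u <ʷ? v = (u ≤ʷ? v) ×-dec ¬? (u ≈ₚ? v)

≤ʷ-antisym : (u v : 𝔖 n) → u ≤ʷ v → v ≤ʷ u → u ≈ₚ v
≤ʷ-antisym u v u≤v v≤u = sameOrder⇒≈ u v (order u v u≤v v≤u) (order v u v≤u u≤v)
  where
  order : (u v : 𝔖 n) → u ≤ʷ v → v ≤ʷ u →
          ∀ {i j} → u ⟨$⟩ʳ i <ᶠ u ⟨$⟩ʳ j → v ⟨$⟩ʳ i <ᶠ v ⟨$⟩ʳ j
  order u v u≤v v≤u {i} {j} ui<uj with Fin.<-cmp i j
  ... | tri> _ _ j<i = proj₂ (u≤v (j<i , ui<uj))
  ... | tri≈ _ ≡.refl _ = contradiction ui<uj (ℕ.<-irrefl ≡.refl)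
  ... | tri< i<j i≢j _ with Fin.<-cmp (v ⟨$⟩ʳ i) (v ⟨$⟩ʳ j)
  ...   | tri< vi<vj _ _ = vi<vj
  ...   | tri≈ _ e _     = contradiction (injective v e) i≢j
  ...   | tri> _ _ vj<vi = contradiction (proj₂ (v≤u (i<j , vj<vi))) (ℕ.<-asym ui<uj)

#Inv : 𝔖 n → ℕ
#Inv {n} u = count (Inv? u) (cartesianProduct (allFin n) (allFin n))

<ʷ⇒#Inv< : {u v : 𝔖 n} → u <ʷ v → #Inv u < #Inv v
<ʷ⇒#Inv< {n} {u} {v} (u≤v , u≉v)
  with Fin.any? (λ i → Fin.any? λ j → Inv? v (i , j) ×-dec ¬? (Inv? u (i , j)))
... | yes (i , j , q , ¬p) = count-< (Inv? u) (Inv? v) _ (λ _ → u≤v)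
        (∈ˡ.∈-cartesianProduct⁺ (∈ˡ.∈-allFin i) (∈ˡ.∈-allFin j)) ¬p q
... | no none = contradiction (≤ʷ-antisym u v u≤v v≤u) u≉v
  where
  v≤u : v ≤ʷ u
  v≤u {i , j} q with Inv? u (i , j)
  ... | yes p = p
  ... | no ¬p = contradiction (i , j , q , ¬p) none

<ʷ-wellFounded : WellFounded (_<ʷ_ {n})
<ʷ-wellFounded = Subrelation.wellFounded (λ {u} {v} → <ʷ⇒#Inv< {u = u} {v}) (On.wellFounded #Inv <-wellFounded)

permutations : ∀ n → List (𝔖 n)
permutations zero    = [ idₚ ]
permutations (suc n) = cartesianProductWith (insert zero) (allFin (suc n)) (permutations n)

-- μ(u,u) = 1, μ(u,v) = - ∑_{u ≤ w < v} μ(u,w) for u < v, and μ(u,v) = 0 for u ≰ v.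
μ′ : (u v : 𝔖 n) → Acc _<ʷ_ v → ℚ
μ′ {n} u v (acc below) with u ≈ₚ? v | u ≤ʷ? v
... | yes _ | _     = 1ℚ
... | no _  | no _  = 0ℚ
... | no _  | yes _ = -ℚ ∑ ℚ¹ (permutations n) (λ w → term w (u ≤ʷ? w) (w <ʷ? v))
  where
  term : ∀ w → Dec (u ≤ʷ w) → Dec (w <ʷ v) → ℚ
  term w (yes _) (yes w<v) = μ′ u w (below w<v)
  term w _       _         = 0ℚ

μ : 𝔖 n → 𝔖 n → ℚ
μ u v = μ′ u v (<ʷ-wellFounded v)

M : 𝔖 n → ∣ 𝔖Sym-space ∣
M {n} u = ∑ (𝔖Sym-space) (filter (u ≤ʷ?_) (permutations n)) (λ v → μ u v ⊙ F v)

-- With positions 0, …, n-1 instead of 1, …, n, "i ≤ p < j" reads "i < p ≤ j".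
IsGDes : 𝔖 n → Pred ℕ 0ℓ
IsGDes u p = ∀ i j → toℕ i < p → p ≤ toℕ j → u ⟨$⟩ʳ i >ᶠ u ⟨$⟩ʳ j

IsGDes? : (u : 𝔖 n) → Decidable (IsGDes u)
IsGDes? u p = Fin.all? λ i → Fin.all? λ j →
  (toℕ i ℕ.<? p) →-dec (p ℕ.≤? toℕ j) →-dec ((u ⟨$⟩ʳ j) Fin.<? (u ⟨$⟩ʳ i))

GDes : 𝔖 n → List ℕ
GDes {n} u = filter (IsGDes? u) (applyUpTo suc (n ∸ 1))

infix 4 _∈𝔖^_
_∈𝔖^_ : Σ ℕ 𝔖 → ℕ → Set
(n , u) ∈𝔖^ zero  = n ≡ 0
(n , u) ∈𝔖^ suc k = 1 ≤ n × length (GDes u) ≡ k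

𝔖Sym^ : ℕ → Subspace (𝔖Sym-space)
𝔖Sym^ k = span {I = Σ (Σ ℕ 𝔖) (_∈𝔖^ k)} (λ ((_ , u) , _) → M u)

{-# OPTIONS --safe #-}
-- Write u ∗ v for the permutation whose word is that of u, shifted above v, followed by
-- that of v. A permutation x has a global descent at p exactly when x = a ∗ b with a of size p,
-- and x ≥ u in the weak order then means that a and b lie above the two standardized halves
-- of u. Möbius inversion turns this into Δ M_u = ∑ M_a ⊗ M_b over the factorizations
-- u = a ∗ b, and shows that the bilinear product F_u ⋆ F_v = F_{u ∗ v} also satisfies
-- M_u ⋆ M_v = M_{u ∗ v}. Hence Δ(v ⋆ y) = 1 ⊗ (v ⋆ y) + (v ⋆ ⊗ id) Δ y for v ∈ V, which is the
-- recursion satisfied by deconcatenation, so v₁ ⊗ ⋯ ⊗ vₖ ↦ v₁ ⋆ ⋯ ⋆ vₖ is a morphism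
-- of coalgebras φ : Q(V) → 𝔖Sym. Each permutation factors uniquely into ∗-indecomposable ones, and
-- the number of factors is its degree; so φ is a graded isomorphism, along which the
-- grading of Q(V) is transported to 𝔖Sym.
module Submission where

open import Defs
open import Algebra.Bundles using (CommutativeMonoid)
open import Algebra.Module.Bundles using (LeftModule)
import Algebra.Properties.CommutativeSemigroup as CommSemigroup
import Algebra.Properties.Group as GroupProperties
open import Data.Fin.Base using (Fin; zero; suc; toℕ; punchIn)
  renaming (_<_ to _<ᶠ_)
open import Data.Fin.Permutation using (_⟨$⟩ʳ_; insert; remove; insert-punchIn; insert-remove)
  renaming (_≈_ to _≈ₚ_; id to idₚ)
import Data.Fin.Properties as Fin
open import Data.List.Base using (List; []; _∷_; _++_; foldr; map; filter; length; allFin;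
  cartesianProduct; cartesianProductWith; take; drop; tabulate; upTo; applyUpTo)
open import Data.List.Membership.Propositional using (find; lose)
  renaming (_∈_ to _∈ˡ_)
import Data.List.Membership.Propositional.Properties as ∈ˡ
open import Data.List.Membership.Propositional.Properties.WithK using (unique∧set⇒bag)
import Data.List.Properties as List
open import Data.List.Relation.Binary.BagAndSetEquality using (∼bag⇒↭)
open import Data.List.Relation.Binary.Permutation.Propositional as ↭ using (_↭_)
open import Data.List.Relation.Binary.Pointwise as Pointwise using (Pointwise; []; _∷_)
open import Data.List.Relation.Unary.All as All using ([]; _∷_; All)
import Data.List.Relation.Unary.All.Properties as All
open import Data.List.Relation.Unary.AllPairs using ([]; _∷_)
open import Data.List.Relation.Unary.Any as Any using (Any; here; there)
open import Data.List.Relation.Unary.Unique.Propositional using (Unique)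
import Data.List.Relation.Unary.Unique.Propositional.Properties as Unique
import Data.List.Relation.Unary.Unique.Setoid as Uniqueₛ
import Data.List.Relation.Unary.Unique.Setoid.Properties as Uniqueₛ
open import Data.Nat.Base as ℕ using (ℕ; zero; suc; _≤_; _<_; _+_; z≤n; s≤s; s<s; _∸_)
import Data.Nat.Properties as ℕ
open import Data.List.Relation.Unary.Unique.DecPropositional ℕ._≟_ using (unique?)
open import Data.Product.Base using (∃; _×_; _,_; proj₁; proj₂; ∃₂; Σ-syntax)
open import Data.Rational.Base using (ℚ; 0ℚ; 1ℚ)
  renaming (_+_ to _+ℚ_; _*_ to _*ℚ_; -_ to -ℚ_)
import Data.Rational.Properties as ℚ
open import Function.Base using (_∘_; flip)
open import Function.Bundles using (mk⇔)
open import Induction.WellFounded using (Acc; acc)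
open import Level using (0ℓ)
open import Relation.Binary.Bundles using (Setoid)
open import Relation.Binary.Definitions using (tri<; tri≈; tri>)
open import Relation.Binary.PropositionalEquality as ≡ using (_≡_)
import Relation.Binary.Reasoning.Setoid as ≈-Reasoning
open import Relation.Nullary using (¬_; Dec; yes; no; contradiction)
open import Relation.Nullary.Decidable using (map′; _×-dec_; _→-dec_)
open import Relation.Unary using (Pred; Decidable)

-- Every formula on M is read off from one on F: if a linear map sends each `F u` to the sum of some
-- family R over the permutations above `u`, then Möbius inversion makes it send `M u` to R at `u`.
-- The combinatorial content is thereby concentrated in one statement about upper sets: the words
-- above `x ++ y` with a cut at |x| correspond to the pairs of a word above `x` and a word above
-- `y`. The same principle produces the inverse of φ, whose natural formula is on M but which has to
-- be prescribed on the generators F. Cutting a permutation changes both its size and its letters,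
-- so the arguments run on lists of naturals. The relation `_≼_` sees only the relative order of
-- letters, which makes a word interchangeable with its standardization and with its shifts.
-- Factorizations are found by search and carry proofs; their uniqueness is what makes the inverse
-- independent of these choices.

private variable
  k m n : ℕ
  x y z w : List ℕ

-- Finite sums

𝟙 : {A : Set} → Dec A → ℚ
𝟙 (yes _) = 1ℚ
𝟙 (no _)  = 0ℚ

module _ (W : VectorSpace) where
  private
    module W = LeftModule W
    open CommSemigroup (CommutativeMonoid.commutativeSemigroup W.+ᴹ-commutativeMonoid) using (x∙yz≈y∙xz)

  module _ {I : Set} where

    ∑-cong-∈ : ∀ is {x y : I → ∣ W ∣} → (∀ {i} → i ∈ˡ is → W [ x i ≈ y i ]) → W [ ∑ W is x ≈ ∑ W is y ]
    ∑-cong-∈ []       e = W.≈ᴹ-refl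
    ∑-cong-∈ (i ∷ is) e = W.+ᴹ-cong (e (here ≡.refl)) (∑-cong-∈ is (e ∘ there))

    ∑-0 : ∀ is {x : I → ∣ W ∣} → (∀ {i} → i ∈ˡ is → W [ x i ≈ W.0ᴹ ]) → W [ ∑ W is x ≈ W.0ᴹ ]
    ∑-0 []       e = W.≈ᴹ-refl
    ∑-0 (i ∷ is) e = W.≈ᴹ-trans (W.+ᴹ-cong (e (here ≡.refl)) (∑-0 is (e ∘ there))) (W.+ᴹ-identityˡ _)

    ∑-•ˡ : ∀ c is (x : I → ∣ W ∣) → W [ c W.*ₗ ∑ W is x ≈ ∑ W is (λ i → c W.*ₗ x i) ]
    ∑-•ˡ c []       x = W.*ₗ-zeroʳ c
    ∑-•ˡ c (i ∷ is) x = W.≈ᴹ-trans (W.*ₗ-distribˡ c _ _) (W.+ᴹ-cong W.≈ᴹ-refl (∑-•ˡ c is x))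

    ∑-•ʳ : ∀ is (c : I → ℚ) x → W [ ∑ ℚ¹ is c W.*ₗ x ≈ ∑ W is (λ i → c i W.*ₗ x) ]
    ∑-•ʳ []       c x = W.*ₗ-zeroˡ x
    ∑-•ʳ (i ∷ is) c x = W.≈ᴹ-trans (W.*ₗ-distribʳ x _ _) (W.+ᴹ-cong W.≈ᴹ-refl (∑-•ʳ is c x))

    ∑-++ : ∀ is js (x : I → ∣ W ∣) → W [ ∑ W (is ++ js) x ≈ ∑ W is x W.+ᴹ ∑ W js x ]
    ∑-++ []       js x = W.≈ᴹ-sym (W.+ᴹ-identityˡ _)
    ∑-++ (i ∷ is) js x = W.≈ᴹ-trans (W.+ᴹ-cong W.≈ᴹ-refl (∑-++ is js x)) (W.≈ᴹ-sym (W.+ᴹ-assoc _ _ _))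

    ∑-↭ : ∀ {is js} (x : I → ∣ W ∣) → is ↭ js → W [ ∑ W is x ≈ ∑ W js x ]
    ∑-↭ x ↭.refl          = W.≈ᴹ-refl
    ∑-↭ x (↭.prep i p)    = W.+ᴹ-cong W.≈ᴹ-refl (∑-↭ x p)
    ∑-↭ x (↭.swap i j p)  = W.≈ᴹ-trans (x∙yz≈y∙xz _ _ _)
      (W.+ᴹ-cong W.≈ᴹ-refl (W.+ᴹ-cong W.≈ᴹ-refl (∑-↭ x p)))
    ∑-↭ x (↭.trans p q)   = W.≈ᴹ-trans (∑-↭ x p) (∑-↭ x q)

    -- Indicator weights over a fixed list replace nested upper sets, so that double sums can be
    -- exchanged.
    ∑-filter : {P : Pred I 0ℓ} (P? : Decidable P) → ∀ is (x : I → ∣ W ∣) →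
               W [ ∑ W (filter P? is) x ≈ ∑ W is (λ i → 𝟙 (P? i) W.*ₗ x i) ]
    ∑-filter P? []       x = W.≈ᴹ-refl
    ∑-filter P? (i ∷ is) x with P? i
    ... | yes _ = W.+ᴹ-cong (W.≈ᴹ-sym (W.*ₗ-identityˡ _)) (∑-filter P? is x)
    ... | no _  = W.≈ᴹ-trans (W.≈ᴹ-sym (W.+ᴹ-identityˡ _))
                    (W.+ᴹ-cong (W.≈ᴹ-sym (W.*ₗ-zeroˡ _)) (∑-filter P? is x))

  module _ {I J : Set} where

    ∑-map : (g : J → I) → ∀ js (x : I → ∣ W ∣) → ∑ W (map g js) x ≡ ∑ W js (x ∘ g)
    ∑-map g []       x = ≡.refl
    ∑-map g (j ∷ js) x = ≡.cong (x (g j) W.+ᴹ_) (∑-map g js x)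

    ∑-swap : ∀ is js (x : I → J → ∣ W ∣) →
             W [ ∑ W is (λ i → ∑ W js (x i)) ≈ ∑ W js (λ j → ∑ W is (λ i → x i j)) ]
    ∑-swap []       js x = W.≈ᴹ-sym (∑-0 js (λ _ → W.≈ᴹ-refl))
    ∑-swap (i ∷ is) js x = W.≈ᴹ-trans (W.+ᴹ-cong W.≈ᴹ-refl (∑-swap is js x))
      (W.≈ᴹ-sym (∑-+ W (x i) (λ j → ∑ W is (λ i → x i j)) js))

  module _ {I J K : Set} where

    ∑-cartesianProductWith : (g : I → J → K) → ∀ is js (x : K → ∣ W ∣) →
      W [ ∑ W (cartesianProductWith g is js) x ≈ ∑ W is (λ i → ∑ W js (x ∘ g i)) ]
    ∑-cartesianProductWith g []       js x = W.≈ᴹ-refl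
    ∑-cartesianProductWith g (i ∷ is) js x = W.≈ᴹ-trans (∑-++ (map (g i) js) _ x)
      (W.+ᴹ-cong (W.≈ᴹ-reflexive (∑-map (g i) js x)) (∑-cartesianProductWith g is js x))

-- Permutations and Möbius inversion in the weak order

-- A permutation is a record containing functions, so equality is taken pointwise; the list
-- `permutations` is duplicate-free and complete in this sense.
𝔖-setoid : ℕ → Setoid 0ℓ 0ℓ
𝔖-setoid n = record
  { Carrier = 𝔖 n
  ; _≈_ = _≈ₚ_
  ; isEquivalence = record
    { refl  = λ _ → ≡.refl
    ; sym   = λ e i → ≡.sym (e i)
    ; trans = λ e e′ i → ≡.trans (e i) (e′ i)
    }
  }

insert-injective : ∀ {i j} {u v : 𝔖 n} → insert zero i u ≈ₚ insert zero j v → i ≡ j × u ≈ₚ v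
insert-injective {i = i} {u = u} {v} e with e zero
... | ≡.refl = ≡.refl , λ k → Fin.punchIn-injective i _ _
  (≡.trans (≡.sym (insert-punchIn zero i u k)) (≡.trans (e (suc k)) (insert-punchIn zero i v k)))

insert-cong : ∀ {i} {u v : 𝔖 n} → u ≈ₚ v → insert zero i u ≈ₚ insert zero i v
insert-cong e zero = ≡.refl
insert-cong {i = i} {u} {v} e (suc k) = ≡.trans (insert-punchIn zero i u k)
  (≡.trans (≡.cong (punchIn i) (e k)) (≡.sym (insert-punchIn zero i v k)))

permutations-unique : ∀ n → Uniqueₛ.Unique (𝔖-setoid n) (permutations n)
permutations-unique zero    = [] ∷ []
permutations-unique (suc n) = Uniqueₛ.cartesianProductWith⁺ (≡.setoid _) (𝔖-setoid n) (𝔖-setoid (suc n))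
  (insert zero) (λ {i} {j} {u} {v} → insert-injective {i = i} {j} {u} {v})
  (Unique.allFin⁺ (suc n)) (permutations-unique n)

permutations-complete : (u : 𝔖 n) → Any (u ≈ₚ_) (permutations n)
permutations-complete {zero}  u = here λ ()
permutations-complete {suc n} u with find (permutations-complete (remove zero u))
... | v , v∈ , e = lose (∈ˡ.∈-cartesianProductWith⁺ (insert zero) (∈ˡ.∈-allFin (u ⟨$⟩ʳ zero)) v∈) λ i →
  ≡.trans (≡.sym (insert-remove zero u i)) (insert-cong {u = remove zero u} {v} e i)

module _ (W : VectorSpace) where
  private module W = LeftModule W

  ∑-δ : (x : 𝔖 n → ∣ W ∣) → (∀ {u v} → u ≈ₚ v → W [ x u ≈ x v ]) → ∀ u →
        W [ ∑ W (permutations n) (λ v → 𝟙 (u ≈ₚ? v) W.*ₗ x v) ≈ x u ]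
  ∑-δ {n} x x-cong u = go (permutations n) (permutations-unique n) (permutations-complete u)
    where
    go : ∀ vs → Uniqueₛ.Unique (𝔖-setoid n) vs → Any (u ≈ₚ_) vs →
         W [ ∑ W vs (λ v → 𝟙 (u ≈ₚ? v) W.*ₗ x v) ≈ x u ]
    go (v ∷ vs) (v∉ ∷ !) u∈ with u ≈ₚ? v | u∈
    ... | yes e | _ = W.≈ᴹ-trans (W.+ᴹ-cong (W.≈ᴹ-trans (W.*ₗ-identityˡ _) (W.≈ᴹ-sym (x-cong e))) (∑-0 W vs zeros))
                        (W.+ᴹ-identityʳ _)
      where
      zeros : ∀ {w} → w ∈ˡ vs → W [ 𝟙 (u ≈ₚ? w) W.*ₗ x w ≈ W.0ᴹ ]
      zeros {w} w∈ with u ≈ₚ? w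
      ... | yes e′ = contradiction (λ i → ≡.trans (≡.sym (e i)) (e′ i)) (All.lookup v∉ w∈)
      ... | no _   = W.*ₗ-zeroˡ _
    ... | no ¬e | here e  = contradiction e ¬e
    ... | no ¬e | there i = W.≈ᴹ-trans (W.+ᴹ-cong (W.*ₗ-zeroˡ _) (go vs ! i)) (W.+ᴹ-identityˡ _)

≈ₚ-sym : {u v : 𝔖 n} → u ≈ₚ v → v ≈ₚ u
≈ₚ-sym e i = ≡.sym (e i)

≈ₚ⇒≤ʷ : {u v : 𝔖 n} → u ≈ₚ v → u ≤ʷ v
≈ₚ⇒≤ʷ e {i , j} (i<j , uj<ui) = i<j , ≡.subst₂ (λ a b → toℕ b < toℕ a) (e i) (e j) uj<ui

<ʷ-respʳ : {u v w : 𝔖 n} → v ≈ₚ w → u <ʷ v → u <ʷ w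
<ʷ-respʳ {v = v} {w} e (u≤v , u≉v) = ≈ₚ⇒≤ʷ {u = v} {w} e ∘ u≤v , λ e′ → u≉v (λ i → ≡.trans (e′ i) (≡.sym (e i)))

-- A copy of the local summand of `μ′` with the two decisions as arguments, so that proofs can split
-- on them.
lowerTerm′ : (u v w : 𝔖 n) → (∀ {w} → w <ʷ v → Acc _<ʷ_ w) → Dec (u ≤ʷ w) → Dec (w <ʷ v) → ℚ
lowerTerm′ u v w below (yes _) (yes w<v) = μ′ u w (below w<v)
lowerTerm′ u v w below (yes _) (no _)    = 0ℚ
lowerTerm′ u v w below (no _)  _         = 0ℚ

lowerTerm : (u v : 𝔖 n) → (∀ {w} → w <ʷ v → Acc _<ʷ_ w) → 𝔖 n → ℚ
lowerTerm u v below w = lowerTerm′ u v w below (u ≤ʷ? w) (w <ʷ? v)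

private
  summand : {f : 𝔖 n → ℚ → ℚ} {y : ℚ} → -ℚ foldr f 0ℚ (permutations n) ≡ y → 𝔖 n → ℚ → ℚ
  summand {f = f} _ = f

  -- The summand of the recursion defining μ′ is local to its definition; here it is
  -- recovered by unification from the value of μ′.
  μ′-summand : (u v : 𝔖 n) (below : ∀ {w} → w <ʷ v → Acc _<ʷ_ w) (y : ℚ) →
            μ′ u v (acc below) ≡ y → 𝔖 n → ℚ → ℚ
  μ′-summand u v below y e with u ≈ₚ? v | u ≤ʷ? v
  ... | yes _ | _     = λ _ _ → 0ℚ
  ... | no _  | no _  = λ _ _ → 0ℚ
  ... | no _  | yes _ = summand e

  μ′-summand≡ : (u v : 𝔖 n) (below : ∀ {w} → w <ʷ v → Acc _<ʷ_ w) (y : ℚ)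
             (e : μ′ u v (acc below) ≡ y) → ¬ u ≈ₚ v → u ≤ʷ v → ∀ w s →
             μ′-summand u v below y e w s ≡ lowerTerm u v below w +ℚ s
  μ′-summand≡ u v below y e u≉v u≤v w s with u ≈ₚ? v | u ≤ʷ? v
  ... | yes u≈v | _     = contradiction u≈v u≉v
  ... | no _  | no u≰v  = contradiction (λ {i} → u≤v {i}) u≰v
  ... | no _  | yes _ with u ≤ʷ? w | w <ʷ? v
  ...   | yes _ | yes _ = ≡.refl
  ...   | yes _ | no _  = ≡.refl
  ...   | no _  | yes _ = ≡.refl
  ...   | no _  | no _  = ≡.refl

  -- With `y` a variable, matching on the decisions unfolds the recursion in the type of `e`, and
  -- `e` reversed becomes the claim.
  μ′-unfold : (u v : 𝔖 n) (below : ∀ {w} → w <ʷ v → Acc _<ʷ_ w) (y : ℚ)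
              (e : μ′ u v (acc below) ≡ y) → ¬ u ≈ₚ v → u ≤ʷ v →
              y ≡ -ℚ foldr (μ′-summand u v below y e) 0ℚ (permutations n)
  μ′-unfold u v below y e u≉v u≤v with u ≈ₚ? v | u ≤ʷ? v
  ... | yes u≈v | _     = contradiction u≈v u≉v
  ... | no _  | no u≰v  = contradiction (λ {i} → u≤v {i}) u≰v
  ... | no _  | yes _   = ≡.sym e

μ′-< : {u v : 𝔖 n} (below : ∀ {w} → w <ʷ v → Acc _<ʷ_ w) → ¬ u ≈ₚ v → u ≤ʷ v →
       μ′ u v (acc below) ≡ -ℚ ∑ ℚ¹ (permutations n) (lowerTerm u v below)
μ′-< {n} {u} {v} below u≉v u≤v = ≡.trans (μ′-unfold u v below _ ≡.refl u≉v u≤v)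
  (≡.cong -ℚ_ (List.foldr-cong (μ′-summand≡ u v below _ ≡.refl u≉v u≤v) ≡.refl (permutations n)))

μ′-≈ : {u v : 𝔖 n} (a : Acc _<ʷ_ v) → u ≈ₚ v → μ′ u v a ≡ 1ℚ
μ′-≈ {u = u} {v} (acc _) e with u ≈ₚ? v
... | yes _ = ≡.refl
... | no ¬e = contradiction e ¬e

μ′-≰ : {u v : 𝔖 n} (a : Acc _<ʷ_ v) → ¬ u ≤ʷ v → μ′ u v a ≡ 0ℚ
μ′-≰ {u = u} {v} (acc _) u≰v with u ≈ₚ? v | u ≤ʷ? v
... | yes e | _       = contradiction (λ {i} → ≈ₚ⇒≤ʷ {u = u} {v} e {i}) u≰v
... | no _  | yes u≤v = contradiction (λ {i} → u≤v {i}) u≰v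
... | no _  | no _    = ≡.refl

-- Besides compatibility with pointwise equality, this gives independence of the accessibility
-- proof, which identifies the values inside the recursion with values of `μ`.
μ′-cong : {u u′ v v′ : 𝔖 n} → u ≈ₚ u′ → v ≈ₚ v′ → (a : Acc _<ʷ_ v) (a′ : Acc _<ʷ_ v′) →
          μ′ u v a ≡ μ′ u′ v′ a′
μ′-cong {n} {u} {u′} {v} {v′} eu ev (acc below) (acc below′) = go (u ≈ₚ? v) (u ≤ʷ? v)
  where
  eu′ : u′ ≈ₚ u
  eu′ = ≈ₚ-sym {u = u} {u′} eu
  ev′ : v′ ≈ₚ v
  ev′ = ≈ₚ-sym {u = v} {v′} ev
  ≤⇒≤′ : u ≤ʷ v → u′ ≤ʷ v′
  ≤⇒≤′ u≤v = ≈ₚ⇒≤ʷ {u = v} {v′} ev ∘ u≤v ∘ ≈ₚ⇒≤ʷ {u = u′} {u} eu′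
  ≤′⇒≤ : u′ ≤ʷ v′ → u ≤ʷ v
  ≤′⇒≤ u≤v = ≈ₚ⇒≤ʷ {u = v′} {v} ev′ ∘ u≤v ∘ ≈ₚ⇒≤ʷ {u = u} {u′} eu

  lower : ∀ w → lowerTerm u v below w ≡ lowerTerm u′ v′ below′ w
  lower w with u ≤ʷ? w | w <ʷ? v | u′ ≤ʷ? w | w <ʷ? v′
  ... | yes _   | yes w<v | yes _    | yes w<v′ = μ′-cong {u = u} {u′} {w} {w} eu (λ _ → ≡.refl) (below w<v) (below′ w<v′)
  ... | yes _   | yes w<v | yes _    | no w≮v′  = contradiction (<ʷ-respʳ {u = w} {v} {v′} ev w<v) w≮v′
  ... | yes _   | no w≮v  | yes _    | yes w<v′ = contradiction (<ʷ-respʳ {u = w} {v′} {v} ev′ w<v′) w≮v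
  ... | yes _   | no _    | yes _    | no _     = ≡.refl
  ... | yes u≤w | _       | no u′≰w  | _        = contradiction (λ {i} → u≤w {i} ∘ ≈ₚ⇒≤ʷ {u = u′} {u} eu′ {i}) u′≰w
  ... | no u≰w  | _       | yes u′≤w | _        = contradiction (λ {i} → u′≤w {i} ∘ ≈ₚ⇒≤ʷ {u = u} {u′} eu {i}) u≰w
  ... | no _    | _       | no _     | _        = ≡.refl

  go : Dec (u ≈ₚ v) → Dec (u ≤ʷ v) → μ′ u v (acc below) ≡ μ′ u′ v′ (acc below′)
  go (yes e) _ = ≡.trans (μ′-≈ (acc below) e)
    (≡.sym (μ′-≈ (acc below′) (λ i → ≡.trans (eu′ i) (≡.trans (e i) (ev i)))))
  go (no _) (no u≰v) = ≡.trans (μ′-≰ (acc below) u≰v) (≡.sym (μ′-≰ (acc below′) (λ u′≤v′ → u≰v (≤′⇒≤ u′≤v′))))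
  go (no u≉v) (yes u≤v) = ≡.trans (μ′-< below u≉v u≤v)
    (≡.trans (≡.cong -ℚ_ (∑-cong ℚ¹ (permutations n) lower))
      (≡.sym (μ′-< below′ (λ e → u≉v (λ i → ≡.trans (eu i) (≡.trans (e i) (ev′ i)))) (≤⇒≤′ u≤v))))

μ-cong : {u u′ v v′ : 𝔖 n} → u ≈ₚ u′ → v ≈ₚ v′ → μ u v ≡ μ u′ v′
μ-cong eu ev = μ′-cong eu ev _ _

-- For u < x the terms with v < x are those whose negated sum defines μ(u,x), and the term at v = x
-- is μ(u,x) itself. For u = x no v with u ≤ v < x remains.
μ∗ζ≡δ : (u x : 𝔖 n) →
      ∑ ℚ¹ (permutations n) (λ v → 𝟙 (u ≤ʷ? v) *ℚ (μ u v *ℚ 𝟙 (v ≤ʷ? x))) ≡ 𝟙 (u ≈ₚ? x)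
μ∗ζ≡δ {n} u x = go (<ʷ-wellFounded x) (u ≤ʷ? x)
  where
  u≰x⇒0 : ¬ u ≤ʷ x → ∀ v (u≤v? : Dec (u ≤ʷ v)) (v≤x? : Dec (v ≤ʷ x)) (m : ℚ) →
          𝟙 u≤v? *ℚ (m *ℚ 𝟙 v≤x?) ≡ 0ℚ
  u≰x⇒0 u≰x v (yes u≤v) (yes v≤x) m = contradiction (λ {i} → v≤x {i} ∘ u≤v {i}) u≰x
  u≰x⇒0 u≰x v (yes _)   (no _)    m = ≡.trans (ℚ.*-identityˡ (m *ℚ 0ℚ)) (ℚ.*-zeroʳ m)
  u≰x⇒0 u≰x v (no _)    v≤x?      m = ℚ.*-zeroˡ (m *ℚ 𝟙 v≤x?)

  -- Here `m` stands for `μ u v`; the last hypothesis allows it to be traded for the value at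
  -- `below v<x` that occurs in the recursion.
  term-split : ∀ (below : ∀ {w} → w <ʷ x → Acc _<ʷ_ w) → u ≤ʷ x → ∀ v
    (u≤v? : Dec (u ≤ʷ v)) (v≤x? : Dec (v ≤ʷ x)) (x≈v? : Dec (x ≈ₚ v)) (v<x? : Dec (v <ʷ x))
    (m : ℚ) → (∀ a → m ≡ μ′ u v a) →
    𝟙 u≤v? *ℚ (m *ℚ 𝟙 v≤x?) ≡ 𝟙 x≈v? *ℚ m +ℚ lowerTerm′ u x v below u≤v? v<x?
  term-split below u≤x v (yes _) (yes _) (yes e) (yes v<x) m _ = contradiction (≈ₚ-sym {u = x} {v} e) (proj₂ v<x)
  term-split below u≤x v (yes _) (yes _) (yes e) (no _) m _ = ≡.trans (ℚ.*-identityˡ (m *ℚ 1ℚ))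
    (≡.trans (ℚ.*-comm m 1ℚ) (≡.sym (ℚ.+-identityʳ (1ℚ *ℚ m))))
  term-split below u≤x v (yes _) (yes _) (no _) (yes v<x) m m≡ = begin
    1ℚ *ℚ (m *ℚ 1ℚ)                    ≡⟨ ℚ.*-identityˡ (m *ℚ 1ℚ) ⟩
    m *ℚ 1ℚ                            ≡⟨ ℚ.*-identityʳ m ⟩
    m                                  ≡⟨ m≡ (below v<x) ⟩
    μ′ u v (below v<x)                 ≡⟨ ℚ.+-identityˡ (μ′ u v (below v<x)) ⟨
    0ℚ +ℚ μ′ u v (below v<x)           ≡⟨ ≡.cong (_+ℚ μ′ u v (below v<x)) (ℚ.*-zeroˡ m) ⟨
    0ℚ *ℚ m +ℚ μ′ u v (below v<x)      ∎
    where open ≡.≡-Reasoning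
  term-split below u≤x v (yes _) (yes v≤x) (no ¬e) (no v≮x) m _ =
    contradiction ((λ {i} → v≤x {i}) , ¬e ∘ ≈ₚ-sym {u = v} {x}) v≮x
  term-split below u≤x v (yes _) (no v≰x) (yes e) _ m _ =
    contradiction (λ {i} → ≈ₚ⇒≤ʷ {u = v} {x} (≈ₚ-sym {u = x} {v} e) {i}) v≰x
  term-split below u≤x v (yes _) (no v≰x) (no ¬e) (yes v<x) m _ = contradiction (λ {i} → proj₁ v<x {i}) v≰x
  term-split below u≤x v (yes _) (no _) (no ¬e) (no _) m _ = ≡.trans (ℚ.*-identityˡ (m *ℚ 0ℚ))
    (≡.trans (ℚ.*-comm m 0ℚ) (≡.sym (ℚ.+-identityʳ (0ℚ *ℚ m))))
  term-split below u≤x v (no u≰v) _ (yes e) _ m _ =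
    contradiction (λ {i} → ≈ₚ⇒≤ʷ {u = x} {v} e {i} ∘ u≤x {i}) u≰v
  term-split below u≤x v (no _) v≤x? (no _) _ m _ = ≡.trans (ℚ.*-zeroˡ (m *ℚ 𝟙 v≤x?))
    (≡.sym (≡.trans (ℚ.+-identityʳ (0ℚ *ℚ m)) (ℚ.*-zeroˡ m)))

  lower-0 : ∀ (below : ∀ {w} → w <ʷ x → Acc _<ʷ_ w) → u ≈ₚ x → ∀ v → lowerTerm u x below v ≡ 0ℚ
  lower-0 below u≈x v with u ≤ʷ? v | v <ʷ? x
  ... | yes u≤v | yes (v≤x , v≉x) = contradiction
    (≤ʷ-antisym v x v≤x (λ {i} → u≤v {i} ∘ ≈ₚ⇒≤ʷ {u = x} {u} (≈ₚ-sym {u = u} {x} u≈x) {i})) v≉x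
  ... | yes _   | no _  = ≡.refl
  ... | no _    | _     = ≡.refl

  cancel : ∀ (below : ∀ {w} → w <ʷ x → Acc _<ʷ_ w) → u ≤ʷ x → (d : Dec (u ≈ₚ x)) →
           μ′ u x (acc below) +ℚ ∑ ℚ¹ (permutations n) (lowerTerm u x below) ≡ 𝟙 d
  cancel below u≤x (yes e) = ≡.cong₂ _+ℚ_ (μ′-≈ (acc below) e)
    (∑-0 ℚ¹ (permutations n) {lowerTerm u x below} (λ {v} _ → lower-0 below e v))
  cancel below u≤x (no ¬e) = ≡.trans
    (≡.cong (_+ℚ ∑ ℚ¹ (permutations n) (lowerTerm u x below)) (μ′-< below ¬e u≤x))
    (ℚ.+-inverseˡ (∑ ℚ¹ (permutations n) (lowerTerm u x below)))

  term : 𝔖 n → ℚ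
  term v = 𝟙 (u ≤ʷ? v) *ℚ (μ u v *ℚ 𝟙 (v ≤ʷ? x))

  go : Acc _<ʷ_ x → Dec (u ≤ʷ x) → ∑ ℚ¹ (permutations n) term ≡ 𝟙 (u ≈ₚ? x)
  go _ (no u≰x) with u ≈ₚ? x
  ... | yes e = contradiction (λ {i} → ≈ₚ⇒≤ʷ {u = u} {x} e {i}) u≰x
  ... | no _  = ∑-0 ℚ¹ (permutations n) {term} (λ {v} _ → u≰x⇒0 u≰x v (u ≤ʷ? v) (v ≤ʷ? x) (μ u v))
  go (acc below) (yes u≤x) = begin
    ∑ ℚ¹ P term
      ≡⟨ ∑-cong ℚ¹ P (λ v → term-split below u≤x v (u ≤ʷ? v) (v ≤ʷ? x) (x ≈ₚ? v) (v <ʷ? x) (μ u v)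
           (λ a → μ′-cong {u = u} {u} {v} {v} (λ _ → ≡.refl) (λ _ → ≡.refl) (<ʷ-wellFounded v) a)) ⟩
    ∑ ℚ¹ P (λ v → δ v +ℚ lowerTerm u x below v)
      ≡⟨ ∑-+ ℚ¹ δ (lowerTerm u x below) P ⟩
    ∑ ℚ¹ P δ +ℚ ∑ ℚ¹ P (lowerTerm u x below)
      ≡⟨ ≡.cong (_+ℚ ∑ ℚ¹ P (lowerTerm u x below)) (≡.trans
           (∑-δ ℚ¹ (μ u) (λ {v} {w} → μ-cong {u = u} {u} {v} {w} (λ _ → ≡.refl)) x)
           (μ′-cong {u = u} {u} {x} {x} (λ _ → ≡.refl) (λ _ → ≡.refl) (<ʷ-wellFounded x) (acc below))) ⟩
    μ′ u x (acc below) +ℚ ∑ ℚ¹ P (lowerTerm u x below)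
      ≡⟨ cancel below u≤x (u ≈ₚ? x) ⟩
    𝟙 (u ≈ₚ? x) ∎
    where
    P = permutations n
    δ : 𝔖 n → ℚ
    δ v = 𝟙 (x ≈ₚ? v) *ℚ μ u v
    open ≡.≡-Reasoning

-- Möbius inversion and the change of basis between F and M

module _ (W : VectorSpace) where
  private module W = LeftModule W

  above : 𝔖 n → (𝔖 n → ∣ W ∣) → ∣ W ∣
  above {n} u R = ∑ W (filter (u ≤ʷ?_) (permutations n)) R

  above-cong : {u v : 𝔖 n} → u ≈ₚ v → ∀ R → W [ above u R ≈ above v R ]
  above-cong {n} {u} {v} e R = W.≈ᴹ-reflexive (≡.cong (λ vs → ∑ W vs R)
    (List.filter-≐ (u ≤ʷ?_) (v ≤ʷ?_)
      ((λ {w} u≤w {i} → u≤w {i} ∘ ≈ₚ⇒≤ʷ {u = v} {u} (≈ₚ-sym {u = u} {v} e) {i}) ,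
       (λ {w} v≤w {i} → v≤w {i} ∘ ≈ₚ⇒≤ʷ {u = u} {v} e {i})) (permutations n)))

  -- Exchanging the two sums leaves `μ∗ζ≡δ` as inner sum. R takes values in any space, so that it
  -- can describe the images of M under a linear map.
  möbius-inversion : (R : 𝔖 n → ∣ W ∣) → (∀ {u v} → u ≈ₚ v → W [ R u ≈ R v ]) → ∀ u →
                     W [ above u (λ v → μ u v W.*ₗ above v R) ≈ R u ]
  möbius-inversion {n} R R-cong u = begin
    above u (λ v → μ u v W.*ₗ above v R)
      ≈⟨ ∑-filter W (u ≤ʷ?_) P _ ⟩
    ∑ W P (λ v → 𝟙 (u ≤ʷ? v) W.*ₗ μ u v W.*ₗ above v R)
      ≈⟨ ∑-cong W P (λ v → W.*ₗ-cong ≡.refl (W.*ₗ-cong ≡.refl (∑-filter W (v ≤ʷ?_) P R))) ⟩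
    ∑ W P (λ v → 𝟙 (u ≤ʷ? v) W.*ₗ μ u v W.*ₗ ∑ W P (λ x → 𝟙 (v ≤ʷ? x) W.*ₗ R x))
      ≈⟨ ∑-cong W P (λ v → W.≈ᴹ-trans (W.*ₗ-cong ≡.refl (∑-•ˡ W (μ u v) P _)) (∑-•ˡ W (𝟙 (u ≤ʷ? v)) P _)) ⟩
    ∑ W P (λ v → ∑ W P (λ x → 𝟙 (u ≤ʷ? v) W.*ₗ μ u v W.*ₗ 𝟙 (v ≤ʷ? x) W.*ₗ R x))
      ≈⟨ ∑-cong W P (λ v → ∑-cong W P (λ x → W.≈ᴹ-trans (W.*ₗ-cong ≡.refl (W.≈ᴹ-sym (W.*ₗ-assoc (μ u v) (𝟙 (v ≤ʷ? x)) (R x))))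
           (W.≈ᴹ-sym (W.*ₗ-assoc (𝟙 (u ≤ʷ? v)) _ (R x))))) ⟩
    ∑ W P (λ v → ∑ W P (λ x → (𝟙 (u ≤ʷ? v) *ℚ (μ u v *ℚ 𝟙 (v ≤ʷ? x))) W.*ₗ R x))
      ≈⟨ ∑-swap W P P _ ⟩
    ∑ W P (λ x → ∑ W P (λ v → (𝟙 (u ≤ʷ? v) *ℚ (μ u v *ℚ 𝟙 (v ≤ʷ? x))) W.*ₗ R x))
      ≈⟨ ∑-cong W P (λ x → W.≈ᴹ-trans (W.≈ᴹ-sym (∑-•ʳ W P _ (R x))) (W.*ₗ-cong (μ∗ζ≡δ u x) W.≈ᴹ-refl)) ⟩
    ∑ W P (λ x → 𝟙 (u ≈ₚ? x) W.*ₗ R x)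
      ≈⟨ ∑-δ W R R-cong u ⟩
    R u ∎
    where
    P = permutations n
    open ≈-Reasoning W.≈ᴹ-setoid

  -- Isolates the diagonal term, where μ(u,u) = 1, so that two Möbius transforms can be compared by
  -- induction from above.
  above-split : (G : 𝔖 n → ∣ W ∣) → (∀ {u v} → u ≈ₚ v → W [ G u ≈ G v ]) → ∀ u →
    W [ above u (λ v → μ u v W.*ₗ G v)
      ≈ G u W.+ᴹ ∑ W (permutations n) (λ v → 𝟙 (u <ʷ? v) W.*ₗ μ u v W.*ₗ G v) ]
  above-split {n} G G-cong u = begin
    above u (λ v → μ u v W.*ₗ G v)
      ≈⟨ ∑-filter W (u ≤ʷ?_) P _ ⟩
    ∑ W P (λ v → 𝟙 (u ≤ʷ? v) W.*ₗ μ u v W.*ₗ G v)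
      ≈⟨ ∑-cong W P (λ v → split v (u ≤ʷ? v) (u ≈ₚ? v) (u <ʷ? v)) ⟩
    ∑ W P (λ v → 𝟙 (u ≈ₚ? v) W.*ₗ G v W.+ᴹ 𝟙 (u <ʷ? v) W.*ₗ μ u v W.*ₗ G v)
      ≈⟨ ∑-+ W _ _ P ⟩
    ∑ W P (λ v → 𝟙 (u ≈ₚ? v) W.*ₗ G v) W.+ᴹ ∑ W P (λ v → 𝟙 (u <ʷ? v) W.*ₗ μ u v W.*ₗ G v)
      ≈⟨ W.+ᴹ-cong (∑-δ W G G-cong u) W.≈ᴹ-refl ⟩
    G u W.+ᴹ ∑ W P (λ v → 𝟙 (u <ʷ? v) W.*ₗ μ u v W.*ₗ G v) ∎
    where
    P = permutations n
    open ≈-Reasoning W.≈ᴹ-setoid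
    split : ∀ v (u≤v? : Dec (u ≤ʷ v)) (u≈v? : Dec (u ≈ₚ v)) (u<v? : Dec (u <ʷ v)) →
      W [ 𝟙 u≤v? W.*ₗ μ u v W.*ₗ G v
        ≈ 𝟙 u≈v? W.*ₗ G v W.+ᴹ 𝟙 u<v? W.*ₗ μ u v W.*ₗ G v ]
    split v (yes _) (yes e) (yes u<v) = contradiction e (proj₂ u<v)
    split v (yes _) (yes e) (no _) = W.≈ᴹ-trans
      (W.*ₗ-cong ≡.refl (W.≈ᴹ-trans (W.*ₗ-cong (μ′-≈ {u = u} {v} (<ʷ-wellFounded v) e) W.≈ᴹ-refl) (W.*ₗ-identityˡ _)))
      (W.≈ᴹ-sym (W.≈ᴹ-trans (W.+ᴹ-cong W.≈ᴹ-refl (W.*ₗ-zeroˡ _)) (W.+ᴹ-identityʳ _)))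
    split v (yes _) (no _) (yes _) = W.≈ᴹ-sym (W.≈ᴹ-trans (W.+ᴹ-cong (W.*ₗ-zeroˡ _) W.≈ᴹ-refl) (W.+ᴹ-identityˡ _))
    split v (yes u≤v) (no ¬e) (no u≮v) = contradiction ((λ {i} → u≤v {i}) , ¬e) u≮v
    split v (no u≰v) (yes e) _ = contradiction (λ {i} → ≈ₚ⇒≤ʷ {u = u} {v} e {i}) u≰v
    split v (no u≰v) (no _) (yes u<v) = contradiction (λ {i} → proj₁ u<v {i}) u≰v
    split v (no _) (no _) (no _) = W.≈ᴹ-sym (W.≈ᴹ-trans (W.+ᴹ-cong (W.*ₗ-zeroˡ _) W.≈ᴹ-refl)
      (W.+ᴹ-identityˡ _))

F-cong : {u v : 𝔖 n} → u ≈ₚ v → 𝔖Sym-space [ F u ≈ F v ]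
F-cong e = relation (≈ₚ⇒~ e)

M-cong : {u v : 𝔖 n} → u ≈ₚ v → 𝔖Sym-space [ M u ≈ M v ]
M-cong {n} {u} {v} e = ~trans (above-cong 𝔖Sym-space {u = u} {v} e (λ w → μ u w ⊙ F w))
  (∑-cong 𝔖Sym-space (filter (v ≤ʷ?_) (permutations n)) λ w →
    LeftModule.*ₗ-cong 𝔖Sym-space (μ-cong {u = u} {v} {w} {w} e (λ _ → ≡.refl)) ~refl)

-- Downward induction: by Möbius inversion the family u ↦ ∑_{v ≥ u} M v has the same Möbius
-- transform M as F, and the terms indexed by v > u in the two transforms agree by induction.
F-expand : (u : 𝔖 n) → 𝔖Sym-space [ F u ≈ above 𝔖Sym-space u M ]
F-expand {n} u = go _ u (ℕ.m≤n+m _ (#Inv u))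
  where
  S = 𝔖Sym-space
  module S = LeftModule S
  pairs = cartesianProduct (allFin n) (allFin n)
  -- The fuel `k` bounds the number of pairs not yet inverted. Each step up the order adds an
  -- inversion, so at zero nothing lies above `u`.
  go : ∀ k (u : 𝔖 n) → length pairs ≤ #Inv u + k → S [ F u ≈ above S u M ]
  go k u bound = GroupProperties.∙-cancelʳ S.+ᴹ-group _ _ _ (begin
    F u ⊕ ∑ S P (λ v → 𝟙 (u <ʷ? v) ⊙ μ u v ⊙ F v)
      ≈⟨ above-split S F (λ {u} {v} → F-cong {u = u} {v}) u ⟨
    M u
      ≈⟨ möbius-inversion S M (λ {u} {v} → M-cong {u = u} {v}) u ⟨
    above S u (λ v → μ u v ⊙ above S v M)
      ≈⟨ above-split S (λ v → above S v M) (λ {u} {v} e → above-cong S {u = u} {v} e M) u ⟩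
    above S u M ⊕ ∑ S P (λ v → 𝟙 (u <ʷ? v) ⊙ μ u v ⊙ above S v M)
      ≈⟨ ⊕-cong ~refl (∑-cong S P ih) ⟩
    above S u M ⊕ ∑ S P (λ v → 𝟙 (u <ʷ? v) ⊙ μ u v ⊙ F v) ∎)
    where
    P = permutations n
    open ≈-Reasoning S.≈ᴹ-setoid
    above-u : ∀ k {v} → length pairs ≤ #Inv u + k → u <ʷ v → S [ F v ≈ above S v M ]
    above-u zero {v} bound u<v = contradiction
      (ℕ.<-≤-trans (<ʷ⇒#Inv< {u = u} {v} u<v) (List.length-filter (Inv? v) pairs))
      (ℕ.≤⇒≯ (ℕ.≤-trans bound (ℕ.≤-reflexive (ℕ.+-identityʳ _))))
    above-u (suc k) {v} bound u<v = go k v (ℕ.≤-trans bound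
      (ℕ.≤-trans (ℕ.≤-reflexive (ℕ.+-suc _ k)) (ℕ.+-monoˡ-≤ k (<ʷ⇒#Inv< {u = u} {v} u<v))))
    ih : ∀ v → S [ 𝟙 (u <ʷ? v) ⊙ μ u v ⊙ above S v M ≈ 𝟙 (u <ʷ? v) ⊙ μ u v ⊙ F v ]
    ih v with u <ʷ? v
    ... | yes u<v = ⊙-cong (⊙-cong (~sym (above-u k bound u<v)))
    ... | no _    = ~trans (⊙-zeroˡ _) (~sym (⊙-zeroˡ _))

-- Expanding `M u` in F and applying `f` termwise gives the Möbius transform of the upper sums of R,
-- which inversion undoes.
$-M : {W : VectorSpace} (f : 𝔖Sym-space ⊸ W) (R : 𝔖 n → ∣ W ∣) →
      (∀ {u v} → u ≈ₚ v → W [ R u ≈ R v ]) →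
      (∀ u → W [ f $ F u ≈ above W u R ]) → ∀ u → W [ f $ M u ≈ R u ]
$-M {n} {W} f R R-cong e u = begin
  f $ M u                                    ≈⟨ $-∑ 𝔖Sym-space f vs _ ⟩
  ∑ W vs (λ v → f $ (μ u v ⊙ F v))           ≈⟨ ∑-cong W vs (λ v → W.≈ᴹ-trans (_⊸_.*ₗ-homo f (μ u v) (F v))
                                                  (W.*ₗ-cong ≡.refl (e v))) ⟩
  above W u (λ v → μ u v W.*ₗ above W v R)   ≈⟨ möbius-inversion W R R-cong u ⟩
  R u                                        ∎
  where
  module W = LeftModule W
  vs = filter (u ≤ʷ?_) (permutations n)
  open ≈-Reasoning W.≈ᴹ-setoid

-- By `F-expand` the M span the space.
M-ext : {W : VectorSpace} (f g : 𝔖Sym-space ⊸ W) → (∀ {n} (u : 𝔖 n) → W [ f $ M u ≈ g $ M u ]) →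
        ∀ x → W [ f $ x ≈ g $ x ]
M-ext {W} f g e = linear-ext f g λ (n , u) → begin
  f $ F u                        ≈⟨ _⊸_.⟦⟧-cong f (F-expand u) ⟩
  f $ above 𝔖Sym-space u M       ≈⟨ $-∑ 𝔖Sym-space f (filter (u ≤ʷ?_) (permutations n)) M ⟩
  above W u (λ v → f $ M v)      ≈⟨ ∑-cong W (filter (u ≤ʷ?_) (permutations n)) e ⟩
  above W u (λ v → g $ M v)      ≈⟨ $-∑ 𝔖Sym-space g (filter (u ≤ʷ?_) (permutations n)) M ⟨
  g $ above 𝔖Sym-space u M       ≈⟨ _⊸_.⟦⟧-cong g (F-expand u) ⟨
  g $ F u                        ∎
  where open ≈-Reasoning (LeftModule.≈ᴹ-setoid W)

-- Words

infix 4 _≫_ _≫?_ _≼_ _≼?_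
infixr 5 _∗_

_≫_ : List ℕ → List ℕ → Set
x ≫ y = All (λ a → All (_< a) y) x

_≫?_ : ∀ x y → Dec (x ≫ y)
x ≫? y = All.all? (λ a → All.all? (ℕ._<? a) y) x

-- The weak order on words: every inversion of the first word is an inversion of the second.
data _≼_ : List ℕ → List ℕ → Set where
  []  : [] ≼ []
  _∷_ : ∀ {a b x y} → Pointwise (λ c d → c < a → d < b) x y → x ≼ y → a ∷ x ≼ b ∷ y

_≼?_ : ∀ x y → Dec (x ≼ y)
[]      ≼? []      = yes []
[]      ≼? (_ ∷ _) = no λ ()
(_ ∷ _) ≼? []      = no λ ()
(a ∷ x) ≼? (b ∷ y) = map′ (λ (p , q) → p ∷ q) (λ where (p ∷ q) → p , q)
  (Pointwise.decidable (λ c d → (c ℕ.<? a) →-dec (d ℕ.<? b)) x y ×-dec (x ≼? y))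

≼-length : x ≼ y → length x ≡ length y
≼-length []      = ≡.refl
≼-length (_ ∷ p) = ≡.cong suc (≼-length p)

≼-trans : x ≼ y → y ≼ z → x ≼ z
≼-trans []       []       = []
≼-trans (p ∷ ps) (q ∷ qs) = Pointwise.transitive (λ f g → g ∘ f) p q ∷ ≼-trans ps qs

≼-take : ∀ p → x ≼ y → take p x ≼ take p y
≼-take zero    _        = []
≼-take (suc p) []       = []
≼-take (suc p) (r ∷ rs) = pointwise-take p r ∷ ≼-take p rs
  where
  pointwise-take : ∀ {R : ℕ → ℕ → Set} {x y} p → Pointwise R x y → Pointwise R (take p x) (take p y)
  pointwise-take zero    _        = []
  pointwise-take (suc p) []       = []
  pointwise-take (suc p) (r ∷ rs) = r ∷ pointwise-take p rs

≼-drop : ∀ p → x ≼ y → drop p x ≼ drop p y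
≼-drop zero    r        = r
≼-drop (suc p) []       = []
≼-drop (suc p) (_ ∷ rs) = ≼-drop p rs

-- Pairs across the junction impose no condition, since in `a ++ b` they are all inversions already.
≼-++⁺ : ∀ {a b} → x ≼ a → y ≼ b → a ≫ b → x ++ y ≼ a ++ b
≼-++⁺ []       q []         = q
≼-++⁺ (p ∷ ps) q (c>b ∷ cs) = Pointwise.++⁺ p (all (≼-length q) c>b) ∷ ≼-++⁺ ps q cs
  where
  all : ∀ {a b x y} → length x ≡ length y → All (_< b) y → Pointwise (λ c d → c < a → d < b) x y
  all {x = []}    e []       = []
  all {x = _ ∷ _} e (l ∷ ls) = (λ _ → l) ∷ all (ℕ.suc-injective e) ls

≼-map : ∀ (f g : ℕ → ℕ) w → (∀ {a b} → a ∈ˡ w → b ∈ˡ w → f a < f b → g a < g b) → map f w ≼ map g w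
≼-map f g []      mono = []
≼-map f g (a ∷ w) mono =
  Pointwise.map⁺ f g (go w (λ i → i)) ∷ ≼-map f g w (λ i j → mono (there i) (there j))
  where
  go : ∀ v → (∀ {c} → c ∈ˡ v → c ∈ˡ w) → Pointwise (λ c d → f c < f a → g d < g a) v v
  go []      _ = []
  go (c ∷ v) s = mono (there (s (here ≡.refl))) (here ≡.refl) ∷ go v (s ∘ there)

≼-map⁺ : ∀ (g : ℕ → ℕ) w → (∀ {a b} → a ∈ˡ w → b ∈ˡ w → a < b → g a < g b) → w ≼ map g w
≼-map⁺ g w mono = ≡.subst (_≼ map g w) (List.map-id w) (≼-map (λ a → a) g w mono)

≼-map⁻ : ∀ (g : ℕ → ℕ) w → (∀ {a b} → a ∈ˡ w → b ∈ˡ w → g a < g b → a < b) → map g w ≼ w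
≼-map⁻ g w mono = ≡.subst (map g w ≼_) (List.map-id w) (≼-map g (λ a → a) w mono)

tabulate-≼⁺ : {f g : Fin n → ℕ} → (∀ i j → i <ᶠ j → f j < f i → g j < g i) → tabulate f ≼ tabulate g
tabulate-≼⁺ {zero}  h = []
tabulate-≼⁺ {suc n} h = Pointwise.tabulate⁺ (λ j → h zero (suc j) ℕ.z<s) ∷ tabulate-≼⁺ (λ i j i<j → h (suc i) (suc j) (s<s i<j))

tabulate-≼⁻ : {f g : Fin n → ℕ} → tabulate f ≼ tabulate g → ∀ i j → i <ᶠ j → f j < f i → g j < g i
tabulate-≼⁻ {suc n} (p ∷ _)  zero    (suc j) _         = Pointwise.tabulate⁻ p j
tabulate-≼⁻ {suc n} (_ ∷ ps) (suc i) (suc j) (s<s i<j) = tabulate-≼⁻ ps i j i<j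

≤ʷ⇒≼ : (u v : 𝔖 n) → u ≤ʷ v → word u ≼ word v
≤ʷ⇒≼ u v u≤v = tabulate-≼⁺ (λ i j i<j uj<ui → proj₂ (u≤v (i<j , uj<ui)))

≼⇒≤ʷ : (u v : 𝔖 n) → word u ≼ word v → u ≤ʷ v
≼⇒≤ʷ u v p {i , j} (i<j , uj<ui) = i<j , tabulate-≼⁻ p i j i<j uj<ui

-- For 0 < p < `length w` this is a global descent; at the two ends and beyond it holds vacuously.
Cut : ℕ → List ℕ → Set
Cut p w = take p w ≫ drop p w

Cut? : ∀ p w → Dec (Cut p w)
Cut? p w = take p w ≫? drop p w

-- A cut says that all pairs across position p are inversions, and inversions persist upwards in the
-- order.
Cut-mono : ∀ p → x ≼ y → Cut p x → Cut p y
Cut-mono zero    _        _        = []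
Cut-mono (suc p) []       _        = []
Cut-mono (suc p) (r ∷ rs) (l ∷ ls) = drop-< p r l ∷ Cut-mono p rs ls
  where
  drop-< : ∀ {a b x y} p → Pointwise (λ c d → c < a → d < b) x y → All (_< a) (drop p x) → All (_< b) (drop p y)
  drop-< zero    []       []       = []
  drop-< zero    (r ∷ rs) (l ∷ ls) = r l ∷ drop-< zero rs ls
  drop-< (suc p) []       _        = []
  drop-< (suc p) (_ ∷ rs) ls       = drop-< p rs ls

module _ {A : Set} where

  take-length-++ : ∀ (x y : List A) → take (length x) (x ++ y) ≡ x
  take-length-++ []      y = ≡.refl
  take-length-++ (a ∷ x) y = ≡.cong (a ∷_) (take-length-++ x y)

  drop-length-++ : ∀ (x y : List A) → drop (length x) (x ++ y) ≡ y
  drop-length-++ []      y = ≡.refl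
  drop-length-++ (a ∷ x) y = drop-length-++ x y

≫⇒Cut : x ≫ y → Cut (length x) (x ++ y)
≫⇒Cut {x} {y} = ≡.subst₂ _≫_ (≡.sym (take-length-++ x y)) (≡.sym (drop-length-++ x y))

≫-unique : Unique x → Unique y → x ≫ y → Unique (x ++ y)
≫-unique !x !y x≫y = Unique.++⁺ !x !y λ (a∈x , a∈y) → ℕ.<-irrefl ≡.refl (All.lookup (All.lookup x≫y a∈x) a∈y)

++-uniqueˡ : ∀ x → Unique (x ++ y) → Unique x
++-uniqueˡ {y} x ! = ≡.subst Unique (take-length-++ x y) (Unique.take⁺ (length x) !)

++-uniqueʳ : ∀ x → Unique (x ++ y) → Unique y
++-uniqueʳ {y} x ! = ≡.subst Unique (drop-length-++ x y) (Unique.drop⁺ (length x) !)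

-- Standardization and the product of words

std : List ℕ → List ℕ
std w = map (rank w) w

length-std : ∀ w → length (std w) ≡ length w
length-std w = List.length-map (rank w) w

≼-std : ∀ w → w ≼ std w
≼-std w = ≼-map⁺ (rank w) w (λ a∈ _ → rank-< w a∈)

std-≼ : ∀ w → std w ≼ w
std-≼ w = ≼-map⁻ (rank w) w (λ _ b∈ → rank-<⁻ w b∈)

std-unique : Unique w → Unique (std w)
std-unique {w} ! = ≡.subst Unique (word-st w !) (word-unique (st w !))

std-std : ∀ w → std (std w) ≡ std w
std-std w = map-rank-map (rank w) w (λ a∈ _ → rank-< w a∈) (λ _ b∈ → rank-<⁻ w b∈)

std-shift : ∀ k w → std (map (k +_) w) ≡ std w
std-shift k w = map-rank-map (k +_) w (λ _ _ → ℕ.+-monoʳ-< k) (λ _ _ → ℕ.+-cancelˡ-< k _ _)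

-- The shift lifts `x` above `y` once the letters of `y` are below `length y`, as in a standard
-- word.
_∗_ : List ℕ → List ℕ → List ℕ
x ∗ y = map (length y +_) x ++ y

rank-++ : ∀ x y a → rank (x ++ y) a ≡ rank x a + rank y a
rank-++ x y a = ≡.trans (≡.cong length (List.filter-++ (ℕ._<? a) x y)) (List.length-++ (filter (ℕ._<? a) x))

-- All of `y` counts towards the rank of a letter of `x`, and nothing of `x` towards the rank of a
-- letter of `y`.
std-++ : x ≫ y → std (x ++ y) ≡ std x ∗ std y
std-++ {x} {y} x≫y = ≡.trans (List.map-++ (rank (x ++ y)) x y) (≡.cong₂ _++_
  (≡.trans (List.map-cong-local (All.tabulate upper)) (List.map-∘ x))
  (List.map-cong-local (All.tabulate lower)))
  where
  open ≡.≡-Reasoning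
  upper : ∀ {a} → a ∈ˡ x → rank (x ++ y) a ≡ length (std y) + rank x a
  upper {a} a∈x = begin
    rank (x ++ y) a            ≡⟨ rank-++ x y a ⟩
    rank x a + rank y a        ≡⟨ ≡.cong (λ z → rank x a + length z) (List.filter-all (ℕ._<? a) (All.lookup x≫y a∈x)) ⟩
    rank x a + length y        ≡⟨ ℕ.+-comm (rank x a) (length y) ⟩
    length y + rank x a        ≡⟨ ≡.cong (_+ rank x a) (length-std y) ⟨
    length (std y) + rank x a  ∎
  lower : ∀ {a} → a ∈ˡ y → rank (x ++ y) a ≡ rank y a
  lower {a} a∈y = begin
    rank (x ++ y) a      ≡⟨ rank-++ x y a ⟩
    rank x a + rank y a  ≡⟨ ≡.cong (λ z → length z + rank y a) (List.filter-none (ℕ._<? a)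
                              (All.map (λ b>y → ℕ.<-asym (All.lookup b>y a∈y)) x≫y)) ⟩
    rank y a             ∎

-- These are the words of permutations, with no size in the type.
Standard : List ℕ → Set
Standard w = Unique w × std w ≡ w

word-standard : (u : 𝔖 n) → Standard (word u)
word-standard u = word-unique u , map-rank-word u

std-standard : Unique w → Standard (std w)
std-standard {w} ! = std-unique ! , std-std w

standard-bound : Standard w → All (_< length w) w
standard-bound {w} (_ , e) = ≡.subst (All (_< length w)) e (All.map⁺ (All.tabulate (rank-bound w)))

∗-≫ : ∀ x → Standard y → map (length y +_) x ≫ y
∗-≫ x sy = All.map⁺ (All.tabulate λ _ → All.map (λ l → ℕ.<-≤-trans l (ℕ.m≤m+n _ _)) (standard-bound sy))

∗-standard : Standard x → Standard y → Standard (x ∗ y)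
∗-standard {x} {y} (!x , ex) sy@(!y , ey) =
  ≫-unique (Unique.map⁺ (ℕ.+-cancelˡ-≡ (length y) _ _) !x) !y (∗-≫ x sy) ,
  ≡.trans (std-++ (∗-≫ x sy)) (≡.cong₂ _∗_ (≡.trans (std-shift (length y) x) ex) ey)

≼-shift : ∀ k w → w ≼ map (k +_) w
≼-shift k w = ≼-map⁺ (k +_) w (λ _ _ → ℕ.+-monoʳ-< k)

shift-≼ : ∀ k w → map (k +_) w ≼ w
shift-≼ k w = ≼-map⁻ (k +_) w (λ _ _ → ℕ.+-cancelˡ-< k _ _)

-- The principal upper set in the weak order. Only the relative order of `w` enters, so pieces of a
-- word can be used without standardizing them.
upper : List ℕ → List (List ℕ)
upper w = map word (filter (λ v → w ≼? word v) (permutations (length w)))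

∈-upper⁻ : ∀ w {z} → z ∈ˡ upper w → Standard z × w ≼ z
∈-upper⁻ w z∈ with ∈ˡ.∈-map⁻ word z∈
... | v , v∈ , ≡.refl = word-standard v , proj₂ (∈ˡ.∈-filter⁻ (λ v → w ≼? word v) {xs = permutations (length w)} v∈)

∈-upper⁺ : ∀ w {z} → Standard z → w ≼ z → z ∈ˡ upper w
∈-upper⁺ w {z} (! , e) w≼z = go (≼-length w≼z)
  where
  go : ∀ {k} → k ≡ length z → z ∈ˡ map word (filter (λ v → w ≼? word v) (permutations k))
  go ≡.refl with find (permutations-complete (st z !))
  ... | v , v∈ , st≈v = ≡.subst (_∈ˡ _) v≡z
      (∈ˡ.∈-map⁺ word (∈ˡ.∈-filter⁺ (λ v → w ≼? word v) v∈ (≡.subst (w ≼_) (≡.sym v≡z) w≼z)))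
    where
    v≡z : word v ≡ z
    v≡z = ≡.trans (≡.sym (word-cong (st z !) v st≈v)) (≡.trans (word-st z !) e)

word-injective : (u v : 𝔖 n) → word u ≡ word v → u ≈ₚ v
word-injective u v e i = Fin.toℕ-injective (tabulate-injective e i)

upper-unique : ∀ w → Unique (upper w)
upper-unique w = Uniqueₛ.map⁺ (𝔖-setoid _) (≡.setoid _) (λ {u} {v} → word-injective u v)
  (Uniqueₛ.filter⁺ (𝔖-setoid _) (λ v → w ≼? word v) (permutations-unique (length w)))

upper-cong : x ≼ y → y ≼ x → upper x ≡ upper y
upper-cong {x} {y} x≼y y≼x = ≡.trans
  (≡.cong (map word) (List.filter-≐ (λ v → x ≼? word v) (λ v → y ≼? word v)
    (≼-trans y≼x , ≼-trans x≼y) (permutations (length x))))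
  (≡.cong (λ k → map word (filter (λ v → y ≼? word v) (permutations k))) (≼-length x≼y))

cartesianProductWith-unique : {A B C : Set} (f : A → B → C) (g : C → A × B) → ∀ {xs ys} →
  Unique xs → Unique ys → (∀ {a b} → a ∈ˡ xs → b ∈ˡ ys → g (f a b) ≡ (a , b)) →
  Unique (cartesianProductWith f xs ys)
cartesianProductWith-unique f g {xs} {ys} !xs !ys inv = Uniqueₛ.map⁻ (≡.setoid _) (≡.setoid _) (≡.cong g)
  (≡.subst Unique (≡.sym (go xs inv)) (Unique.cartesianProduct⁺ !xs !ys))
  where
  go : ∀ xs → (∀ {a b} → a ∈ˡ xs → b ∈ˡ ys → g (f a b) ≡ (a , b)) →
       map g (cartesianProductWith f xs ys) ≡ cartesianProduct xs ys
  go []       inv = ≡.refl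
  go (a ∷ xs) inv = ≡.trans (List.map-++ g (map (f a) ys) _) (≡.cong₂ _++_
    (≡.trans (≡.sym (List.map-∘ ys)) (List.map-cong-local (All.tabulate (inv (here ≡.refl)))))
    (go xs (inv ∘ there)))

-- Forcing a cut at |x| makes all pairs across it inversions, which decouples the two sides.
upper-Cut : ∀ x y → filter (Cut? (length x)) (upper (x ++ y)) ↭
                    cartesianProductWith (flip _∗_) (upper y) (upper x)
upper-Cut x y = ∼bag⇒↭ (unique∧set⇒bag
  (Unique.filter⁺ (Cut? (length x)) (upper-unique (x ++ y)))
  (cartesianProductWith-unique (flip _∗_) parts (upper-unique y) (upper-unique x)
    (λ {b} {a} b∈ a∈ → ≡.cong₂ _,_ (drop-∗ a b a∈) (≡.trans (≡.cong std (take-∗ a b a∈))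
      (≡.trans (std-shift (length b) a) (proj₂ (proj₁ (∈-upper⁻ x a∈)))))))
  (mk⇔ ⇒ ⇐))
  where
  -- Recovers the factors of `a ∗ b`: the second is the tail, the first the standardized head. This
  -- shows that the products are distinct.
  parts : List ℕ → List ℕ × List ℕ
  parts z = drop (length x) z , std (take (length x) z)

  |a| : ∀ a b → a ∈ˡ upper x → length x ≡ length (map (length b +_) a)
  |a| a b a∈ = ≡.trans (≼-length (proj₂ (∈-upper⁻ x a∈))) (≡.sym (List.length-map _ a))

  take-∗ : ∀ a b → a ∈ˡ upper x → take (length x) (a ∗ b) ≡ map (length b +_) a
  take-∗ a b a∈ = ≡.trans (≡.cong (λ k → take k (a ∗ b)) (|a| a b a∈)) (take-length-++ (map (length b +_) a) b)

  drop-∗ : ∀ a b → a ∈ˡ upper x → drop (length x) (a ∗ b) ≡ b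
  drop-∗ a b a∈ = ≡.trans (≡.cong (λ k → drop k (a ∗ b)) (|a| a b a∈)) (drop-length-++ (map (length b +_) a) b)

  ⇒ : ∀ {z} → z ∈ˡ filter (Cut? (length x)) (upper (x ++ y)) →
      z ∈ˡ cartesianProductWith (flip _∗_) (upper y) (upper x)
  ⇒ {z} z∈ with ∈ˡ.∈-filter⁻ (Cut? (length x)) {xs = upper (x ++ y)} z∈
  ... | z∈′ , cut with ∈-upper⁻ (x ++ y) z∈′
  ...   | (!z , ez) , xy≼z = ≡.subst (_∈ˡ _) z≡
          (∈ˡ.∈-cartesianProductWith⁺ (flip _∗_)
            (∈-upper⁺ y (std-standard (Unique.drop⁺ (length x) !z))
              (≼-trans (≡.subst (_≼ b) (drop-length-++ x y) (≼-drop (length x) xy≼z)) (≼-std b)))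
            (∈-upper⁺ x (std-standard (Unique.take⁺ (length x) !z))
              (≼-trans (≡.subst (_≼ a) (take-length-++ x y) (≼-take (length x) xy≼z)) (≼-std a))))
    where
    a = take (length x) z
    b = drop (length x) z
    -- As `z` is standard and cut at |x|, it is the product of its two standardized halves.
    z≡ : std a ∗ std b ≡ z
    z≡ = ≡.trans (≡.sym (std-++ cut)) (≡.trans (≡.cong std (List.take++drop≡id (length x) z)) ez)

  ⇐ : ∀ {z} → z ∈ˡ cartesianProductWith (flip _∗_) (upper y) (upper x) →
      z ∈ˡ filter (Cut? (length x)) (upper (x ++ y))
  ⇐ z∈ with ∈ˡ.∈-cartesianProductWith⁻ (flip _∗_) (upper y) (upper x) z∈
  ... | b , a , b∈ , a∈ , ≡.refl with ∈-upper⁻ y b∈ | ∈-upper⁻ x a∈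
  ...   | sb , y≼b | sa , x≼a = ∈ˡ.∈-filter⁺ (Cut? (length x))
          (∈-upper⁺ (x ++ y) (∗-standard sa sb) (≼-++⁺ (≼-trans x≼a (≼-shift (length b) a)) y≼b (∗-≫ a sb)))
          (≡.subst₂ _≫_ (≡.sym (take-∗ a b a∈)) (≡.sym (drop-∗ a b a∈)) (∗-≫ a sb))

-- The product ⋆ and the coproduct of the basis M

S : VectorSpace
S = 𝔖Sym-space

-- The counterpart of `Fst`: the value 0 on words with repetitions makes it total, so that sums can
-- be indexed by plain words.
Mst : List ℕ → ∣ S ∣
Mst w with unique? w
... | yes ! = M (st w !)
... | no _  = 𝟎

M-word : (u : 𝔖 m) (v : 𝔖 n) → word u ≡ word v → S [ M u ≈ M v ]
M-word u v e with ≡.trans (≡.sym (List.length-tabulate (λ i → toℕ (u ⟨$⟩ʳ i))))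
                  (≡.trans (≡.cong length e) (List.length-tabulate (λ i → toℕ (v ⟨$⟩ʳ i))))
... | ≡.refl = M-cong {u = u} {v} (word-injective u v e)

M-Mst : (u : 𝔖 n) → ∀ w → Unique w → word u ≡ std w → S [ M u ≈ Mst w ]
M-Mst u w ! e with unique? w
... | yes p = M-word u (st w p) (≡.trans e (≡.sym (word-st w p)))
... | no ¬p = contradiction ! ¬p

M-Mst-word : (u : 𝔖 n) → S [ M u ≈ Mst (word u) ]
M-Mst-word u = M-Mst u (word u) (word-unique u) (≡.sym (map-rank-word u))

Mst-st : (! : Unique w) → S [ Mst w ≈ M (st w !) ]
Mst-st {w} ! = ~sym (M-Mst (st w !) w ! (word-st w !))

Mst-cong : Unique x → Unique y → std x ≡ std y → S [ Mst x ≈ Mst y ]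
Mst-cong {x} {y} !x !y e = ~trans (Mst-st !x) (M-Mst (st x !x) y !y (≡.trans (word-st x !x) e))

module _ (W : VectorSpace) where

  above-upper : (R : List ℕ → ∣ W ∣) (u : 𝔖 n) → above W u (R ∘ word) ≡ ∑ W (upper (word u)) R
  above-upper {n} R u = ≡.trans (≡.sym (∑-map W word (filter (u ≤ʷ?_) (permutations n)) R)) (≡.trans
    (≡.cong (λ vs → ∑ W (map word vs) R) (List.filter-≐ (u ≤ʷ?_) (λ v → word u ≼? word v)
      ((λ {v} → ≤ʷ⇒≼ u v) , (λ {v} → ≼⇒≤ʷ u v)) (permutations n)))
    (≡.cong (λ k → ∑ W (map word (filter (λ v → word u ≼? word v) (permutations k))) R)
      (≡.sym (List.length-tabulate (λ i → toℕ (u ⟨$⟩ʳ i))))))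

$-M-word : {W : VectorSpace} (f : S ⊸ W) (R : List ℕ → ∣ W ∣) →
           (∀ {n} (u : 𝔖 n) → W [ f $ F u ≈ ∑ W (upper (word u)) R ]) →
           ∀ {n} (u : 𝔖 n) → W [ f $ M u ≈ R (word u) ]
$-M-word {W} f R e = $-M f (R ∘ word)
  (λ {u} {v} u≈v → W.≈ᴹ-reflexive (≡.cong R (word-cong u v u≈v)))
  (λ u → W.≈ᴹ-trans (e u) (W.≈ᴹ-reflexive (≡.sym (above-upper W R u))))
  where module W = LeftModule W

Fst-expand : Unique w → S [ Fst w ≈ ∑ S (upper w) Mst ]
Fst-expand {w} ! = begin
  Fst w                                 ≈⟨ F-Fst (st w !) w ! (word-st w !) ⟨
  F (st w !)                            ≈⟨ F-expand (st w !) ⟩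
  above S (st w !) M                    ≈⟨ ∑-cong S (filter (st w ! ≤ʷ?_) (permutations (length w))) M-Mst-word ⟩
  above S (st w !) (Mst ∘ word)         ≡⟨ above-upper S Mst (st w !) ⟩
  ∑ S (upper (word (st w !))) Mst       ≡⟨ ≡.cong (λ x → ∑ S (upper x) Mst) (word-st w !) ⟩
  ∑ S (upper (std w)) Mst               ≡⟨ ≡.cong (λ ws → ∑ S ws Mst) (upper-cong (std-≼ w) (≼-std w)) ⟩
  ∑ S (upper w) Mst                     ∎
  where open ≈-Reasoning (LeftModule.≈ᴹ-setoid S)

left-word : List ℕ → S ⊸ S
left-word x = extend S (λ (_ , v) → Fst (x ∗ word v)) λ where
  (≈ₚ⇒~ {u = u} {v} e) → LeftModule.≈ᴹ-reflexive S (≡.cong (λ y → Fst (x ∗ y)) (word-cong u v e))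

-- Left multiplication for the product F u ⋆ F v = F (u ∗ v)
left : ∣ S ∣ → S ⊸ S
left (gen (_ , u)) = left-word (word u)
left 𝟎             = 0ₗ
left (s ⊕ t)       = left s +ₗ left t
left (c ⊙ s)       = c •ₗ left s

infixr 7 _⋆_
_⋆_ : ∣ S ∣ → ∣ S ∣ → ∣ S ∣
s ⋆ t = left s $ t

-- Since `left` recurses on formal combinations, it does not respect `~` by construction; for fixed
-- `t` it agrees with a map built by `extend`, which does.
left-cong : ∀ {s s′} → S [ s ≈ s′ ] → ∀ t → S [ s ⋆ t ≈ s′ ⋆ t ]
left-cong {s} {s′} e t = ≡.subst₂ (S [_≈_]) (≡.sym (left-right s)) (≡.sym (left-right s′)) (_⊸_.⟦⟧-cong right e)
  where
  right : S ⊸ S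
  right = extend S (λ (_ , u) → left-word (word u) $ t) λ where
    (≈ₚ⇒~ {u = u} {v} e) → LeftModule.≈ᴹ-reflexive S (≡.cong (λ x → left-word x $ t) (word-cong u v e))
  left-right : ∀ s → s ⋆ t ≡ right $ s
  left-right (gen _) = ≡.refl
  left-right 𝟎       = ≡.refl
  left-right (s ⊕ s′) = ≡.cong₂ _⊕_ (left-right s) (left-right s′)
  left-right (c ⊙ s)  = ≡.cong (c ⊙_) (left-right s)

right : ∣ S ∣ → S ⊸ S
right t = linear (_⋆ t) (λ e → left-cong e t) (λ _ _ → ~refl) (λ _ _ → ~refl)

-- Every word above `x ∗ y` keeps the cut at |x| by `Cut-mono`, so the filter in `upper-Cut`
-- discards nothing and the upper set is a product.
Fst-∗ : Standard x → Standard y →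
        S [ Fst (x ∗ y) ≈ ∑ S (upper y) (λ b → ∑ S (upper x) (λ a → Mst (a ∗ b))) ]
Fst-∗ {x} {y} sx sy = begin
  Fst (x ∗ y)
    ≈⟨ Fst-expand (proj₁ (∗-standard sx sy)) ⟩
  ∑ S (upper (x′ ++ y)) Mst
    ≡⟨ ≡.cong (λ ws → ∑ S ws Mst) (List.filter-all (Cut? (length x′)) (All.tabulate λ z∈ →
         Cut-mono (length x′) (proj₂ (∈-upper⁻ (x′ ++ y) z∈)) (≫⇒Cut (∗-≫ x sy)))) ⟨
  ∑ S (filter (Cut? (length x′)) (upper (x′ ++ y))) Mst
    ≈⟨ ∑-↭ S Mst (upper-Cut x′ y) ⟩
  ∑ S (cartesianProductWith (flip _∗_) (upper y) (upper x′)) Mst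
    ≈⟨ ∑-cartesianProductWith S (flip _∗_) (upper y) (upper x′) Mst ⟩
  ∑ S (upper y) (λ b → ∑ S (upper x′) (λ a → Mst (a ∗ b)))
    ≡⟨ ≡.cong (λ ws → ∑ S (upper y) (λ b → ∑ S ws (λ a → Mst (a ∗ b))))
         (upper-cong (shift-≼ (length y) x) (≼-shift (length y) x)) ⟩
  ∑ S (upper y) (λ b → ∑ S (upper x) (λ a → Mst (a ∗ b))) ∎
  where
  x′ = map (length y +_) x
  open ≈-Reasoning (LeftModule.≈ᴹ-setoid S)

-- Möbius inversion in one argument at a time: first in `v` against a fixed `F u`, then in `u`
-- against the fixed `M v`.
M-⋆ : (u : 𝔖 m) (v : 𝔖 n) → S [ M u ⋆ M v ≈ Mst (word u ∗ word v) ]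
M-⋆ u v = $-M-word (right (M v)) (λ a → Mst (a ∗ word v)) (λ u →
  $-M-word (left (F u)) (λ b → ∑ S (upper (word u)) (λ a → Mst (a ∗ b)))
    (λ v → Fst-∗ (word-standard u) (word-standard v)) v) u

Mst-⋆ : Unique x → Unique y → x ≫ y → S [ Mst x ⋆ Mst y ≈ Mst (x ++ y) ]
Mst-⋆ {x} {y} !x !y x≫y = begin
  Mst x ⋆ Mst y                            ≈⟨ left-cong (Mst-st !x) (Mst y) ⟩
  M (st x !x) ⋆ Mst y                      ≈⟨ _⊸_.⟦⟧-cong (left (M (st x !x))) (Mst-st !y) ⟩
  M (st x !x) ⋆ M (st y !y)                ≈⟨ M-⋆ (st x !x) (st y !y) ⟩
  Mst (word (st x !x) ∗ word (st y !y))    ≡⟨ ≡.cong Mst (≡.cong₂ _∗_ (word-st x !x) (word-st y !y)) ⟩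
  Mst (std x ∗ std y)                      ≡⟨ ≡.cong Mst (std-++ x≫y) ⟨
  Mst (std (x ++ y))                       ≈⟨ Mst-cong (std-unique !xy) !xy (std-std (x ++ y)) ⟩
  Mst (x ++ y)                             ∎
  where
  !xy = ≫-unique !x !y x≫y
  open ≈-Reasoning (LeftModule.≈ᴹ-setoid S)

S² : VectorSpace
S² = S ⊗ S

open Coalgebra 𝔖Sym using (Δ)

-- The outer sum runs over the second factor, matching `flip _∗_` in `upper-Cut`.
⊗-∑ : {U V : VectorSpace} {I J : Set} → ∀ is js (f : I → ∣ U ∣) (g : J → ∣ V ∣) →
      U ⊗ V [ ∑ U is f ⊗ₜ ∑ V js g ≈ ∑ (U ⊗ V) js (λ j → ∑ (U ⊗ V) is (λ i → f i ⊗ₜ g j)) ]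
⊗-∑ {U} {V} is js f g = ~trans ($-∑ V (∑ U is f ⊗ₜ-) js g)
  (∑-cong (U ⊗ V) js (λ j → $-∑ U (-⊗ₜ g j) is f))

-- By `upper-Cut`, a pair of words above the two halves amounts to one word above the whole with a
-- cut at |x|. The sum now runs over a subset of an upper set that does not depend on where the word
-- was divided.
FF-expand : ∀ x y → Unique x → Unique y →
  S² [ FF x y ≈ ∑ S² (filter (Cut? (length x)) (upper (x ++ y)))
                     (λ z → Mst (take (length x) z) ⊗ₜ Mst (drop (length x) z)) ]
FF-expand x y !x !y = begin
  Fst x ⊗ₜ Fst y
    ≈⟨ relation (⊗-cong (Fst-expand !x) (Fst-expand !y)) ⟩
  ∑ S (upper x) Mst ⊗ₜ ∑ S (upper y) Mst
    ≈⟨ ⊗-∑ (upper x) (upper y) Mst Mst ⟩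
  ∑ S² (upper y) (λ b → ∑ S² (upper x) (λ a → Mst a ⊗ₜ Mst b))
    ≈⟨ ∑-cong-∈ S² (upper y) (λ b∈ → ∑-cong-∈ S² (upper x) (λ a∈ → cut a∈)) ⟩
  ∑ S² (upper y) (λ b → ∑ S² (upper x) (λ a → term (a ∗ b)))
    ≈⟨ ∑-cartesianProductWith S² (flip _∗_) (upper y) (upper x) term ⟨
  ∑ S² (cartesianProductWith (flip _∗_) (upper y) (upper x)) term
    ≈⟨ ∑-↭ S² term (upper-Cut x y) ⟨
  ∑ S² (filter (Cut? (length x)) (upper (x ++ y))) term ∎
  where
  term : List ℕ → ∣ S² ∣
  term z = Mst (take (length x) z) ⊗ₜ Mst (drop (length x) z)
  cut : ∀ {a b} → a ∈ˡ upper x → S² [ Mst a ⊗ₜ Mst b ≈ term (a ∗ b) ]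
  cut {a} {b} a∈ with ∈-upper⁻ x a∈
  ... | (!a , _) , x≼a = ≡.subst (λ k → S² [ Mst a ⊗ₜ Mst b ≈ Mst (take k (a ∗ b)) ⊗ₜ Mst (drop k (a ∗ b)) ])
      (≡.trans (List.length-map _ a) (≡.sym (≼-length x≼a)))
      (≡.subst₂ (λ p q → S² [ Mst a ⊗ₜ Mst b ≈ Mst p ⊗ₜ Mst q ])
        (≡.sym (take-length-++ (map (length b +_) a) b)) (≡.sym (drop-length-++ (map (length b +_) a) b))
        (relation (⊗-cong (Mst-cong !a (Unique.map⁺ (ℕ.+-cancelˡ-≡ (length b) _ _) !a) (≡.sym (std-shift (length b) a))) ~refl)))
  open ≈-Reasoning (LeftModule.≈ᴹ-setoid S²)

-- The indicator lets `cuts` sum over all positions while only actual factorizations contribute.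
MM : List ℕ → List ℕ → ∣ S² ∣
MM a b = 𝟙 (a ≫? b) ⊙ (Mst a ⊗ₜ Mst b)

-- After `FF-expand` at each position, ΔF is a sum over positions and words z above `u`. Summing
-- over positions first gives the cuts of each z, and Möbius inversion keeps those of `u`.
Δ-M : (u : 𝔖 n) → S² [ Δ $ M u ≈ cuts S² (word u) MM ]
Δ-M = $-M-word Δ (λ w → cuts S² w MM) λ u → ~trans (ΔF-word u) (expand (word u) (word-unique u))
  where
  open ≈-Reasoning (LeftModule.≈ᴹ-setoid S²)
  expand : ∀ w → Unique w → S² [ cuts S² w FF ≈ ∑ S² (upper w) (λ z → cuts S² z MM) ]
  expand w ! = begin
    cuts S² w FF
      ≈⟨ ∑-cong-∈ S² ps (λ p∈ → at (ℕ.s≤s⁻¹ (∈ˡ.∈-upTo⁻ p∈))) ⟩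
    ∑ S² ps (λ p → ∑ S² (upper w) (λ z → MM (take p z) (drop p z)))
      ≈⟨ ∑-swap S² ps (upper w) (λ p z → MM (take p z) (drop p z)) ⟩
    ∑ S² (upper w) (λ z → ∑ S² ps (λ p → MM (take p z) (drop p z)))
      ≈⟨ ∑-cong-∈ S² (upper w) (λ {z} z∈ → LeftModule.≈ᴹ-reflexive S²
           (≡.cong (λ k → ∑ S² (upTo (suc k)) (λ p → MM (take p z) (drop p z)))
             (≼-length (proj₂ (∈-upper⁻ w z∈))))) ⟩
    ∑ S² (upper w) (λ z → cuts S² z MM) ∎
    where
    ps = upTo (suc (length w))
    at : ∀ {p} → p ≤ length w →
         S² [ FF (take p w) (drop p w) ≈ ∑ S² (upper w) (λ z → MM (take p z) (drop p z)) ]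
    at {p} p≤ = ~trans
      (≡.subst₂ (λ k v → S² [ FF (take p w) (drop p w) ≈ ∑ S² (filter (Cut? k) (upper v)) (λ z → Mst (take k z) ⊗ₜ Mst (drop k z)) ])
        (≡.trans (List.length-take p w) (ℕ.m≤n⇒m⊓n≡m p≤)) (List.take++drop≡id p w)
        (FF-expand (take p w) (drop p w) (Unique.take⁺ p !) (Unique.drop⁺ p !)))
      (∑-filter S² (Cut? p) (upper w) (λ z → Mst (take p z) ⊗ₜ Mst (drop p z)))

Indecomposable : List ℕ → Set
Indecomposable w = 1 ≤ length w × (∀ p → 1 ≤ p → p < length w → ¬ Cut p w)

Indecomposable-resp : x ≼ y → y ≼ x → Indecomposable x → Indecomposable y
Indecomposable-resp x≼y y≼x (1≤ , ¬cut) = ≡.subst (1 ≤_) (≼-length x≼y) 1≤ ,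
  λ p 1≤p p< cut → ¬cut p 1≤p (≡.subst (p <_) (≼-length y≼x) p<) (Cut-mono p y≼x cut)

module _ (W : VectorSpace) where
  private module W = LeftModule W

  cuts-cong-++ : ∀ w {f g : List ℕ → List ℕ → ∣ W ∣} → (∀ a b → a ++ b ≡ w → W [ f a b ≈ g a b ]) →
                 W [ cuts W w f ≈ cuts W w g ]
  cuts-cong-++ w e = ∑-cong W (upTo (suc (length w))) (λ p → e (take p w) (drop p w) (List.take++drop≡id p w))

  -- The hypothesis kills the divisions strictly inside the first block `c ∷ x`; what survives is
  -- the empty prefix and the divisions at or after the end of the block.
  cuts-++ : ∀ c x y (f : List ℕ → List ℕ → ∣ W ∣) →
            (∀ a b a′ b′ → (a ∷ a′) ++ (b ∷ b′) ≡ c ∷ x → W [ f (a ∷ a′) ((b ∷ b′) ++ y) ≈ W.0ᴹ ]) →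
            W [ cuts W (c ∷ x ++ y) f ≈ f [] (c ∷ x ++ y) W.+ᴹ cuts W y (λ a b → f (c ∷ x ++ a) b) ]
  cuts-++ c []      y f zeros = W.≈ᴹ-reflexive (cuts-∷ W c y f)
  cuts-++ c (d ∷ x) y f zeros = W.≈ᴹ-trans (W.≈ᴹ-reflexive (cuts-∷ W c (d ∷ x ++ y) f))
    (W.+ᴹ-cong W.≈ᴹ-refl (W.≈ᴹ-trans
      (cuts-++ d x y (λ a b → f (c ∷ a) b) (λ a b a′ b′ e → zeros c b (a ∷ a′) b′ (≡.cong (c ∷_) e)))
      (W.≈ᴹ-trans (W.+ᴹ-cong (zeros c d [] x ≡.refl) W.≈ᴹ-refl) (W.+ᴹ-identityˡ _))))

unit : ∣ S ∣
unit = F {0} idₚ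

unit≈Mst[] : S [ unit ≈ Mst [] ]
unit≈Mst[] = ~trans (F-Fst-word {0} idₚ) (~trans (Fst-expand []) (LeftModule.+ᴹ-identityʳ S (Mst [])))

Δ-Mst : Standard w → S² [ Δ $ Mst w ≈ cuts S² w MM ]
Δ-Mst {w} (! , e) = ~trans (_⊸_.⟦⟧-cong Δ (Mst-st !)) (~trans (Δ-M (st w !))
  (LeftModule.≈ᴹ-reflexive S² (≡.cong (λ w → cuts S² w MM) (≡.trans (word-st w !) e))))

-- As `u` is indecomposable, `u ∗ v` has no cut strictly inside `u`. The cut at 0 gives the first
-- term; the others are cuts of `v`, with `M u` multiplied onto the left half.
Δ-⋆-M : (u : 𝔖 m) (v : 𝔖 n) → Indecomposable (word u) →
        S² [ Δ $ (M u ⋆ M v) ≈ unit ⊗ₜ (M u ⋆ M v) ⊕ (left (M u) ⊗₁ idₗ {S}) $ (Δ $ M v) ]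
Δ-⋆-M u v ind = begin
  Δ $ (M u ⋆ M v)
    ≈⟨ _⊸_.⟦⟧-cong Δ (M-⋆ u v) ⟩
  Δ $ Mst (wu ∗ wv)
    ≈⟨ Δ-Mst (∗-standard (word-standard u) (word-standard v)) ⟩
  cuts S² (wu′ ++ wv) MM
    ≈⟨ expand wu′ (Indecomposable-resp (≼-shift (length wv) wu) (shift-≼ (length wv) wu) ind) ⟩
  MM [] (wu ∗ wv) ⊕ cuts S² wv (λ a b → MM (wu′ ++ a) b)
    ≈⟨ ⊕-cong (⊙-identityˡ _) (cuts-cong-++ S² wv prefix) ⟩
  Mst [] ⊗ₜ Mst (wu ∗ wv) ⊕ cuts S² wv (λ a b → (left (M u) ⊗₁ idₗ {S}) $ MM a b)
    ≈⟨ ⊕-cong (relation (⊗-cong unit≈Mst[] (M-⋆ u v))) ($-cuts (left (M u) ⊗₁ idₗ {S}) wv MM) ⟨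
  unit ⊗ₜ (M u ⋆ M v) ⊕ (left (M u) ⊗₁ idₗ {S}) $ cuts S² wv MM
    ≈⟨ ⊕-cong ~refl (_⊸_.⟦⟧-cong (left (M u) ⊗₁ idₗ {S}) (Δ-M v)) ⟨
  unit ⊗ₜ (M u ⋆ M v) ⊕ (left (M u) ⊗₁ idₗ {S}) $ (Δ $ M v) ∎
  where
  wu = word u
  wv = word v
  wu′ = map (length wv +_) wu
  wu≫wv : wu′ ≫ wv
  wu≫wv = ∗-≫ wu (word-standard v)
  !wu′ : Unique wu′
  !wu′ = Unique.map⁺ (ℕ.+-cancelˡ-≡ (length wv) _ _) (word-unique u)
  Mu≈ : S [ M u ≈ Mst wu′ ]
  Mu≈ = M-Mst u wu′ !wu′ (≡.trans (≡.sym (map-rank-word u)) (≡.sym (std-shift (length wv) wu)))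
  open ≈-Reasoning (LeftModule.≈ᴹ-setoid S²)

  expand : ∀ z → Indecomposable z →
           S² [ cuts S² (z ++ wv) MM ≈ MM [] (z ++ wv) ⊕ cuts S² wv (λ a b → MM (z ++ a) b) ]
  expand []      (() , _)
  expand (c ∷ z) (_ , ¬cut) = cuts-++ S² c z wv MM zeros
    where
    zeros : ∀ a b a′ b′ → (a ∷ a′) ++ (b ∷ b′) ≡ c ∷ z → S² [ MM (a ∷ a′) ((b ∷ b′) ++ wv) ≈ 𝟎 ]
    zeros a b a′ b′ e with a ∷ a′ ≫? (b ∷ b′) ++ wv
    ... | no _ = ⊙-zeroˡ _
    ... | yes p = contradiction (≡.subst (Cut (length (a ∷ a′))) e (≫⇒Cut (All.map (All.++⁻ˡ (b ∷ b′)) p)))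
      (¬cut (length (a ∷ a′)) (s≤s z≤n)
        (≡.subst (length (a ∷ a′) <_) (≡.trans (≡.sym (List.length-++ (a ∷ a′))) (≡.cong length e))
          (ℕ.m<m+n _ (s≤s z≤n))))

  -- Since `wu′` lies above all of `wv`, the conditions `wu′ ++ a ≫ b` and `a ≫ b` are equivalent
  -- and the two indicators agree.
  prefix : ∀ a b → a ++ b ≡ wv → S² [ MM (wu′ ++ a) b ≈ (left (M u) ⊗₁ idₗ {S}) $ MM a b ]
  prefix a b e with wu′ ++ a ≫? b | a ≫? b
  ... | yes p | no ¬q  = contradiction (All.++⁻ʳ wu′ p) ¬q
  ... | no ¬p | yes q  = contradiction (All.++⁺ (All.map (All.++⁻ʳ a) wu≫ab) q) ¬p
    where wu≫ab = ≡.subst (wu′ ≫_) (≡.sym e) wu≫wv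
  ... | no _  | no _   = ~trans (⊙-zeroˡ _) (~sym (⊙-zeroˡ _))
  ... | yes _ | yes _  = ⊙-cong (relation (⊗-cong (~trans
          (~sym (Mst-⋆ !wu′ (++-uniqueˡ a (≡.subst Unique (≡.sym e) (word-unique v)))
            (All.map (All.++⁻ˡ a) (≡.subst (wu′ ≫_) (≡.sym e) wu≫wv))))
          (left-cong (~sym Mu≈) (Mst a))) ~refl))

-- Factorization into indecomposable words

module _ {A : Set} where

  applyUpTo-+ : ∀ (f : ℕ → A) m n → applyUpTo f (m + n) ≡ applyUpTo f m ++ applyUpTo (f ∘ (m +_)) n
  applyUpTo-+ f zero    n = ≡.refl
  applyUpTo-+ f (suc m) n = ≡.cong (f 0 ∷_) (applyUpTo-+ (f ∘ suc) m n)

count-applyUpTo : {P Q : Pred ℕ 0ℓ} (P? : Decidable P) (Q? : Decidable Q) (f g : ℕ → ℕ) →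
                  (∀ i → P (f i) → Q (g i)) → (∀ i → Q (g i) → P (f i)) →
                  ∀ n → count P? (applyUpTo f n) ≡ count Q? (applyUpTo g n)
count-applyUpTo P? Q? f g to from zero = ≡.refl
count-applyUpTo P? Q? f g to from (suc n) with P? (f 0) | Q? (g 0)
... | yes p | yes q = ≡.cong suc (count-applyUpTo P? Q? (f ∘ suc) (g ∘ suc) (to ∘ suc) (from ∘ suc) n)
... | yes p | no ¬q = contradiction (to 0 p) ¬q
... | no ¬p | yes q = contradiction (from 0 q) ¬p
... | no ¬p | no ¬q = count-applyUpTo P? Q? (f ∘ suc) (g ∘ suc) (to ∘ suc) (from ∘ suc) n

Cut-++ˡ : ∀ p x → p ≤ length x → Cut p (x ++ y) → Cut p x
Cut-++ˡ zero    x       _          _        = []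
Cut-++ˡ (suc p) (a ∷ x) (s≤s p≤) (l ∷ ls) = drop-++ p x p≤ l ∷ Cut-++ˡ p x p≤ ls
  where
  drop-++ : ∀ {y a} p x → p ≤ length x → All (_< a) (drop p (x ++ y)) → All (_< a) (drop p x)
  drop-++ zero    x       _        l = All.++⁻ˡ x l
  drop-++ (suc p) (_ ∷ x) (s≤s p≤) l = drop-++ p x p≤ l

Cut-++ʳ⁻ : ∀ p x → Cut (length x + p) (x ++ y) → Cut p y
Cut-++ʳ⁻ p []      c        = c
Cut-++ʳ⁻ p (_ ∷ x) (_ ∷ c) = Cut-++ʳ⁻ p x c

Cut-++ʳ⁺ : ∀ p → x ≫ y → Cut p y → Cut (length x + p) (x ++ y)
Cut-++ʳ⁺ {[]}    p _        c = c
Cut-++ʳ⁺ {a ∷ x} p (l ∷ ls) c = drop-++ x l ∷ Cut-++ʳ⁺ p ls c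
  where
  drop-++ : ∀ {y a} x → All (_< a) y → All (_< a) (drop (length x + p) (x ++ y))
  drop-++ []      l = All.drop⁺ p l
  drop-++ (_ ∷ x) l = drop-++ x l

#Cut : List ℕ → ℕ
#Cut w = count (λ p → Cut? p w) (applyUpTo suc (length w ∸ 1))

#Cut-indecomposable : Indecomposable w → #Cut w ≡ 0
#Cut-indecomposable {w} (1≤ , ¬cut) = ≡.cong length (List.filter-none (λ p → Cut? p w)
  (All.applyUpTo⁺₁ suc (length w ∸ 1) (λ {i} i< → ¬cut (suc i) (s≤s z≤n) (lift w i<))))
  where
  lift : ∀ {i} (w : List ℕ) → i < length w ∸ 1 → suc i < length w
  lift (_ ∷ _) i< = s≤s i<

-- A position strictly inside the first word would cut that word, the junction is a cut by
-- hypothesis, and later cuts are those of the second word shifted.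
#Cut-++ : ∀ {c} → Indecomposable x → x ≫ c ∷ y → #Cut (x ++ c ∷ y) ≡ suc (#Cut (c ∷ y))
#Cut-++ {[]}    {y} {c} (() , _) _
#Cut-++ {a ∷ x} {y} {c} (_ , ¬cut) x≫y = begin
  count P? (applyUpTo suc (length (x ++ c ∷ y)))
    ≡⟨ ≡.cong (count P? ∘ applyUpTo suc) (List.length-++ x) ⟩
  count P? (applyUpTo suc (length x + suc (length y)))
    ≡⟨ ≡.cong (count P?) (applyUpTo-+ suc (length x) (suc (length y))) ⟩
  count P? (applyUpTo suc (length x) ++ ps)
    ≡⟨ ≡.cong length (List.filter-++ P? (applyUpTo suc (length x)) ps) ⟩
  length (filter P? (applyUpTo suc (length x)) ++ filter P? ps)
    ≡⟨ ≡.cong (λ qs → length (qs ++ filter P? ps)) (List.filter-none P? (All.applyUpTo⁺₁ suc (length x)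
         (λ {i} i< cut → ¬cut (suc i) (s≤s z≤n) (s≤s i<) (Cut-++ˡ (suc i) (a ∷ x) (s≤s (ℕ.<⇒≤ i<)) cut)))) ⟩
  count P? ps
    ≡⟨ ≡.cong length (List.filter-accept P? (Cut-++ʳ⁺ 0 x≫y [])) ⟩
  suc (count P? (applyUpTo (λ i → suc (length x + suc i)) (length y)))
    ≡⟨ ≡.cong suc (count-applyUpTo P? (λ p → Cut? p (c ∷ y)) _ suc
         (λ i → Cut-++ʳ⁻ (suc i) (a ∷ x)) (λ i → Cut-++ʳ⁺ (suc i) x≫y) (length y)) ⟩
  suc (#Cut (c ∷ y)) ∎
  where
  P? : Decidable (λ p → Cut p (a ∷ x ++ c ∷ y))
  P? p = Cut? p (a ∷ x ++ c ∷ y)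
  ps = applyUpTo (λ i → suc (length x + i)) (suc (length y))
  open ≡.≡-Reasoning

-- Blocks are concatenated with their letters unchanged; standardization is left to `Mst`.
data Blocks : ℕ → List ℕ → Set where
  []    : Blocks 0 []
  block : ∀ x → Indecomposable x → x ≫ y → Blocks k y → Blocks (suc k) (x ++ y)

properCut? : ∀ w → Dec (∃ λ p → p < length w × (1 ≤ p × Cut p w))
properCut? w = ℕ.anyUpTo? (λ p → (1 ℕ.≤? p) ×-dec Cut? p w) (length w)

-- A proper cut of `x` gives a shorter head that still dominates everything after it, so the search
-- ends at an indecomposable head; `m` bounds the length of `x`.
firstBlock : ∀ m x y → length x ≤ m → 1 ≤ length x → x ≫ y →
             ∃₂ λ a b → x ++ y ≡ a ++ b × Indecomposable a × a ≫ b
firstBlock zero    []      y _   () _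
firstBlock (suc m) x       y ≤m 1≤ x≫y with properCut? x
... | no none = x , y , ≡.refl , (1≤ , λ p 1≤p p< cut → none (p , p< , 1≤p , cut)) , x≫y
... | yes (p , p< , 1≤p , cut) with firstBlock m (take p x) (drop p x ++ y)
        (ℕ.≤-trans (ℕ.≤-reflexive |take|) (ℕ.s≤s⁻¹ (ℕ.<-≤-trans p< ≤m)))
        (ℕ.≤-trans 1≤p (ℕ.≤-reflexive (≡.sym |take|)))
        (All.zipWith (λ (l , l′) → All.++⁺ l l′) (cut , All.take⁺ p x≫y))
  where
  |take| : length (take p x) ≡ p
  |take| = ≡.trans (List.length-take p x) (ℕ.m≤n⇒m⊓n≡m (ℕ.<⇒≤ p<))
...   | a , b , e , rest = a , b , ≡.trans (≡.trans (≡.cong (_++ y) (≡.sym (List.take++drop≡id p x)))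
          (List.++-assoc (take p x) (drop p x) y)) e , rest

blocks : ∀ w → ∃ λ k → Blocks k w
blocks w = go (length w) w ℕ.≤-refl
  where
  go : ∀ m w → length w ≤ m → ∃ λ k → Blocks k w
  go m       []      _ = 0 , []
  go (suc m) (c ∷ w) ≤m with firstBlock (length (c ∷ w)) (c ∷ w) [] ℕ.≤-refl (s≤s z≤n) (All.tabulate λ _ → [])
  ... | a , b , e , ind@(1≤a , _) , a≫b with go m b (ℕ.s≤s⁻¹ (ℕ.≤-trans
          (ℕ.≤-trans (ℕ.+-monoˡ-≤ (length b) 1≤a)
            (ℕ.≤-reflexive (≡.sym (≡.trans (≡.cong length (≡.trans (≡.sym (List.++-identityʳ (c ∷ w))) e)) (List.length-++ a)))))
          ≤m))
  ...   | k , bs = suc k , ≡.subst (Blocks (suc k)) (≡.trans (≡.sym e) (List.++-identityʳ (c ∷ w))) (block a ind a≫b bs)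

degree : List ℕ → ℕ
degree []      = 0
degree (c ∷ w) = suc (#Cut (c ∷ w))

degree-nonempty : 1 ≤ length w → degree w ≡ suc (#Cut w)
degree-nonempty {_ ∷ _} _ = ≡.refl

degree-++ : ∀ y → Indecomposable x → x ≫ y → degree (x ++ y) ≡ suc (degree y)
degree-++ {x} []      ind@(1≤ , _) _   = ≡.trans (≡.cong degree (List.++-identityʳ x))
  (≡.trans (degree-nonempty 1≤) (≡.cong suc (#Cut-indecomposable ind)))
degree-++ {x} (c ∷ y) ind@(1≤ , _) x≫y = ≡.trans (degree-nonempty (ℕ.≤-trans 1≤ (List.length-++-≤ˡ x)))
  (≡.cong suc (#Cut-++ ind x≫y))

blocks-degree : Blocks k w → k ≡ degree w
blocks-degree []                     = ≡.refl
blocks-degree (block {y} x ind x≫y b) = ≡.trans (≡.cong suc (blocks-degree b)) (≡.sym (degree-++ y ind x≫y))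

-- Any factorization of `w` has as many blocks as its degree, here a single one.
degree-1 : degree w ≡ 1 → Indecomposable w
degree-1 {w} d with blocks w
... | k , b = go b (≡.trans (blocks-degree b) d)
  where
  go : Blocks k w → k ≡ 1 → Indecomposable w
  go (block x ind _ []) _ = ≡.subst Indecomposable (≡.sym (List.++-identityʳ x)) ind

-- If the lengths differed, the shorter block would end at a proper cut of the longer one.
firstBlock-unique : ∀ {x′ y′} → Indecomposable x → Indecomposable x′ → x ≫ y → x′ ≫ y′ →
                    x ++ y ≡ x′ ++ y′ → x ≡ x′ × y ≡ y′
firstBlock-unique {x} {y} {x′} {y′} (1≤ , ¬cut) (1≤′ , ¬cut′) x≫y x′≫y′ e with ℕ.<-cmp (length x) (length x′)
... | tri< l _ _ = contradiction (Cut-++ˡ (length x) x′ (ℕ.<⇒≤ l) (≡.subst (Cut (length x)) e (≫⇒Cut x≫y)))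
                     (¬cut′ (length x) 1≤ l)
... | tri> _ _ g = contradiction (Cut-++ˡ (length x′) x (ℕ.<⇒≤ g) (≡.subst (Cut (length x′)) (≡.sym e) (≫⇒Cut x′≫y′)))
                     (¬cut (length x′) 1≤′ g)
... | tri≈ _ l _ =
  ≡.trans (≡.sym (take-length-++ x y)) (≡.trans (≡.cong₂ take l e) (take-length-++ x′ y′)) ,
  ≡.trans (≡.sym (drop-length-++ x y)) (≡.trans (≡.cong₂ drop l e) (drop-length-++ x′ y′))

-- Comparison of cuts with global descents

Cut-tabulate⁺ : ∀ p (f : Fin n → ℕ) → (∀ i j → toℕ i < p → p ≤ toℕ j → f j < f i) → Cut p (tabulate f)
Cut-tabulate⁺ zero f h = []
Cut-tabulate⁺ {zero}  (suc p) f h = []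
Cut-tabulate⁺ {suc n} (suc p) f h = drop-< p (f ∘ suc) (λ j p≤ → h zero (suc j) (s≤s z≤n) (s≤s p≤)) ∷
  Cut-tabulate⁺ p (f ∘ suc) (λ i j i< ≤j → h (suc i) (suc j) (s≤s i<) (s≤s ≤j))
  where
  drop-< : ∀ {n a} p (f : Fin n → ℕ) → (∀ j → p ≤ toℕ j → f j < a) → All (_< a) (drop p (tabulate f))
  drop-< zero f h = All.tabulate⁺ (λ j → h j z≤n)
  drop-< {zero}  (suc p) f h = []
  drop-< {suc n} (suc p) f h = drop-< p (f ∘ suc) (λ j p≤ → h (suc j) (s≤s p≤))

Cut-tabulate⁻ : ∀ p (f : Fin n → ℕ) → Cut p (tabulate f) → ∀ i j → toℕ i < p → p ≤ toℕ j → f j < f i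
Cut-tabulate⁻ {suc n} (suc p) f (l ∷ ls) zero    (suc j) _        (s≤s ≤j) = drop-< p (f ∘ suc) l j ≤j
  where
  drop-< : ∀ {n a} p (f : Fin n → ℕ) → All (_< a) (drop p (tabulate f)) → ∀ j → p ≤ toℕ j → f j < a
  drop-< zero f l j _ = All.tabulate⁻ l j
  drop-< {suc n} (suc p) f l (suc j) (s≤s ≤j) = drop-< p (f ∘ suc) l j ≤j
Cut-tabulate⁻ {suc n} (suc p) f (l ∷ ls) (suc i) (suc j) (s≤s i<) (s≤s ≤j) = Cut-tabulate⁻ p (f ∘ suc) ls i j i< ≤j

#GDes : (u : 𝔖 n) → length (GDes u) ≡ #Cut (word u)
#GDes {n} u = ≡.trans
  (≡.cong length (List.filter-≐ (IsGDes? u) (λ p → Cut? p (word u))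
    ((λ {p} → Cut-tabulate⁺ p _) , (λ {p} → Cut-tabulate⁻ p _)) (applyUpTo suc (n ∸ 1))))
  (≡.cong (λ k → count (λ p → Cut? p (word u)) (applyUpTo suc (k ∸ 1)))
    (≡.sym (List.length-tabulate (λ i → toℕ (u ⟨$⟩ʳ i)))))

∈𝔖^⇒degree : (u : 𝔖 n) → ∀ k → (n , u) ∈𝔖^ k → degree (word u) ≡ k
∈𝔖^⇒degree {zero}  u zero    _       = ≡.refl
∈𝔖^⇒degree {suc n} u (suc k) (_ , e) = ≡.cong suc (≡.trans (≡.sym (#GDes u)) e)

degree⇒∈𝔖^ : (u : 𝔖 n) → (n , u) ∈𝔖^ degree (word u)
degree⇒∈𝔖^ {zero}  u = ≡.refl
degree⇒∈𝔖^ {suc n} u = s≤s z≤n , #GDes u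

-- Transport of gradings

module _ {V W : VectorSpace} {I : Set} {g : I → ∣ V ∣} where
  private
    module V = LeftModule V
    module W = LeftModule W

  span-⊆ : (f : V ⊸ W) (T : Subspace W) → (∀ i → f $ g i ∈ T) → ∀ {v} → v ∈ span {V} g → f $ v ∈ T
  span-⊆ f T h (s , e) = T.≈-closed (f.⟦⟧-cong e) (go s)
    where
    module T = Subspace T
    module f = _⊸_ f
    go : ∀ s → f $ ⟦ s ⟧ V g ∈ T
    go (gen i) = h i
    go 𝟎       = T.≈-closed (W.≈ᴹ-sym f.0ᴹ-homo) T.0-closed
    go (s ⊕ t) = T.≈-closed (W.≈ᴹ-sym (f.+ᴹ-homo _ _)) (T.+-closed (go s) (go t))
    go (c ⊙ s) = T.≈-closed (W.≈ᴹ-sym (f.*ₗ-homo c _)) (T.•-closed c (go s))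

  -- Equality in a subspace ignores membership proofs, so each vector may be replaced by the
  -- canonical one built from its combination of generators.
  span-ext : (f f′ : subspace (span {V} g) ⊸ W) →
             (∀ i → W [ f $ (g i , gen i , V.≈ᴹ-refl) ≈ f′ $ (g i , gen i , V.≈ᴹ-refl) ]) →
             ∀ v → W [ f $ v ≈ f′ $ v ]
  span-ext f f′ h (v , s , e) = W.≈ᴹ-trans (f.⟦⟧-cong (V.≈ᴹ-sym e)) (W.≈ᴹ-trans (go s) (f′.⟦⟧-cong e))
    where
    module f = _⊸_ f
    module f′ = _⊸_ f′
    element : Combination I → ∣ subspace (span {V} g) ∣
    element s = ⟦ s ⟧ V g , s , V.≈ᴹ-refl
    go : ∀ s → W [ f $ element s ≈ f′ $ element s ]
    go (gen i) = h i
    -- Here and below, `⟦⟧-cong` at reflexivity only exchanges one membership proof for another.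
    go 𝟎       = W.≈ᴹ-trans (f.⟦⟧-cong V.≈ᴹ-refl) (W.≈ᴹ-trans f.0ᴹ-homo
                   (W.≈ᴹ-trans (W.≈ᴹ-sym f′.0ᴹ-homo) (f′.⟦⟧-cong V.≈ᴹ-refl)))
    go (s ⊕ t) = W.≈ᴹ-trans (f.⟦⟧-cong V.≈ᴹ-refl) (W.≈ᴹ-trans (f.+ᴹ-homo (element s) (element t))
                   (W.≈ᴹ-trans (W.+ᴹ-cong (go s) (go t))
                   (W.≈ᴹ-trans (W.≈ᴹ-sym (f′.+ᴹ-homo (element s) (element t))) (f′.⟦⟧-cong V.≈ᴹ-refl))))
    go (c ⊙ s) = W.≈ᴹ-trans (f.⟦⟧-cong V.≈ᴹ-refl) (W.≈ᴹ-trans (f.*ₗ-homo c (element s))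
                   (W.≈ᴹ-trans (W.*ₗ-cong ≡.refl (go s))
                   (W.≈ᴹ-trans (W.≈ᴹ-sym (f′.*ₗ-homo c (element s))) (f′.⟦⟧-cong V.≈ᴹ-refl))))

restrict : {V W : VectorSpace} (f : V ⊸ W) (A : Subspace V) (B : Subspace W) →
           (∀ x → x ∈ A → f $ x ∈ B) → subspace A ⊸ subspace B
restrict f A B h = linear (λ (x , p) → f $ x , h x p) f.⟦⟧-cong
  (λ _ _ → f.+ᴹ-homo _ _) (λ c _ → f.*ₗ-homo c _)
  where module f = _⊸_ f

⨁₁ : {I : Set} {V W : I → VectorSpace} → (∀ i → V i ⊸ W i) → ⨁ V ⊸ ⨁ W
⨁₁ f = cotuple (λ i → ι i ∘ₗ f i)

module _ {V W : VectorSpace} (f : V ⊸ W) (A : ℕ → Subspace V) (B : ℕ → Subspace W)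
         (f-graded : ∀ k x → x ∈ A k → f $ x ∈ B k) where

  restrict-graded : ∀ k → subspace (A k) ⊸ subspace (B k)
  restrict-graded k = restrict f (A k) (B k) (f-graded k)

  total-natural : ∀ s → W [ f $ (cotuple (λ k → incl (A k)) $ s)
                          ≈ cotuple (λ k → incl (B k)) $ (⨁₁ restrict-graded $ s) ]
  total-natural = linear-ext (f ∘ₗ cotuple (λ k → incl (A k)))
    (cotuple (λ k → incl (B k)) ∘ₗ ⨁₁ restrict-graded) (λ _ → LeftModule.≈ᴹ-refl W)

  ⊗-degree-map : ∀ k {t} → t ∈ ⊗-degree A k → (f ⊗₁ f) $ t ∈ ⊗-degree B k
  ⊗-degree-map k (s , e) = ⨁₁ r⊗r $ s , ~trans (~sym (natural s)) (_⊸_.⟦⟧-cong (f ⊗₁ f) e)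
    where
    r = restrict-graded
    r⊗r = λ i → r (toℕ i) ⊗₁ r (k ∸ toℕ i)
    natural = linear-ext
      ((f ⊗₁ f) ∘ₗ cotuple (λ i → incl (A (toℕ i)) ⊗₁ incl (A (k ∸ toℕ i))))
      (cotuple (λ i → incl (B (toℕ i)) ⊗₁ incl (B (k ∸ toℕ i))) ∘ₗ ⨁₁ r⊗r)
      λ (i , t) → ⊗-ext ((f ⊗₁ f) ∘ₗ (incl (A (toℕ i)) ⊗₁ incl (A (k ∸ toℕ i))))
        ((incl (B (toℕ i)) ⊗₁ incl (B (k ∸ toℕ i))) ∘ₗ r⊗r i) (λ _ _ → ~refl) t

module Transport (C : Coalgebra) (grade : ℕ → Subspace (Coalgebra.space C)) (D : GradedCoalgebra) where
  private
    module C = Coalgebra C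
    module D = GradedCoalgebra D
    module |C| = LeftModule C.space
    module |D| = LeftModule D.space

  module _ (φ : D.space ⊸ C.space) (ψ : C.space ⊸ D.space)
           (φψ : ∀ x → C.space [ φ $ (ψ $ x) ≈ x ]) (ψφ : ∀ y → D.space [ ψ $ (φ $ y) ≈ y ])
           (φ-Δ : ∀ y → C.space ⊗ C.space [ C.Δ $ (φ $ y) ≈ (φ ⊗₁ φ) $ (D.Δ $ y) ])
           (φ-ε : ∀ y → C.ε $ (φ $ y) ≡ D.ε $ y)
           (φ-graded : ∀ k y → y ∈ D.grade k → φ $ y ∈ grade k)
           (ψ-graded : ∀ k x → x ∈ grade k → ψ $ x ∈ D.grade k) where

    private
      Cs = ⨁ (λ k → subspace (grade k))
      Φ = ⨁₁ (restrict-graded φ D.grade grade φ-graded)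
      Ψ = ⨁₁ (restrict-graded ψ grade D.grade ψ-graded)
      totalC = cotuple (λ k → incl (grade k))
      totalD = cotuple (λ k → incl (D.grade k))
      directSumD = IsCoalgebraGrading.directSum D.isGrading

      ΦΨ : ∀ s → Cs [ Φ $ (Ψ $ s) ≈ s ]
      ΦΨ = linear-ext (Φ ∘ₗ Ψ) idₗ λ (k , x , p) → relation (⨁-cong (φψ x))

    isGrading : IsCoalgebraGrading C grade
    isGrading = record
      { directSum = injective′ , surjective′
      -- As x is φ of ψ x, its coproduct is the image under φ ⊗ φ of the coproduct of ψ x.
      ; Δ-graded  = λ k x x∈ → Subspace.≈-closed (⊗-degree grade k)
          (~trans (~sym (φ-Δ (ψ $ x))) (_⊸_.⟦⟧-cong C.Δ (φψ x)))
          (⊗-degree-map φ D.grade grade φ-graded k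
            (IsCoalgebraGrading.Δ-graded D.isGrading k (ψ $ x) (ψ-graded k x x∈)))
      }
      where
      -- Equal totals stay equal under ψ, where the direct sum of `D` is known to be injective; Φ
      -- then brings the equality back.
      injective′ : ∀ {s t} → C.space [ totalC $ s ≈ totalC $ t ] → Cs [ s ≈ t ]
      injective′ {s} {t} e = ~trans (~sym (ΦΨ s)) (~trans (_⊸_.⟦⟧-cong Φ {Ψ $ s} {Ψ $ t} (proj₁ directSumD
        (|D|.≈ᴹ-trans (|D|.≈ᴹ-sym (total-natural ψ grade D.grade ψ-graded s))
          (|D|.≈ᴹ-trans (_⊸_.⟦⟧-cong ψ e) (total-natural ψ grade D.grade ψ-graded t))))) (ΦΨ t))
      surjective′ : ∀ x → ∃ λ s → ∀ {t} → Cs [ t ≈ s ] → C.space [ totalC $ t ≈ x ]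
      surjective′ x with proj₂ directSumD (ψ $ x)
      ... | s , h = Φ $ s , λ e → |C|.≈ᴹ-trans (_⊸_.⟦⟧-cong totalC e)
        (|C|.≈ᴹ-trans (|C|.≈ᴹ-sym (total-natural φ D.grade grade φ-graded s))
          (|C|.≈ᴹ-trans (_⊸_.⟦⟧-cong φ (h ~refl)) (φψ x)))

    isomorphism : mkGraded C grade isGrading ≅ D
    isomorphism = record
      { to = record
        { hom    = ψ
        ; Δ-homo = λ x → ~trans (~sym (⊗-ext ((ψ ⊗₁ ψ) ∘ₗ (φ ⊗₁ φ)) idₗ
              (λ y y′ → relation (⊗-cong (ψφ y) (ψφ y′))) (D.Δ $ (ψ $ x))))
            (_⊸_.⟦⟧-cong (ψ ⊗₁ ψ) (~trans (~sym (φ-Δ (ψ $ x))) (_⊸_.⟦⟧-cong C.Δ (φψ x))))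
        ; ε-homo = λ x → ≡.trans (≡.sym (φ-ε (ψ $ x))) (_⊸_.⟦⟧-cong C.ε (φψ x))
        ; graded = ψ-graded
        }
      ; from = record { hom = φ ; Δ-homo = φ-Δ ; ε-homo = φ-ε ; graded = φ-graded }
      ; from-to = φψ
      ; to-from = ψφ
      }

    transport : Σ[ isGrading ∈ IsCoalgebraGrading C grade ] mkGraded C grade isGrading ≅ D
    transport = isGrading , isomorphism

-- The isomorphism with the cofree coalgebra

V : VectorSpace
V = subspace (𝔖Sym^ 1)

module QV = Cofree V
open Coalgebra 𝔖Sym using (ε)

-- The products are nested to the right like `_^⊗_` and end in `unit`, so that prepending a vector
-- becomes one left multiplication.
φₖ : ∀ k → V ^⊗ k ⊸ S
φₖ zero    = linear (_⊙ unit) (λ where ≡.refl → ~refl) (λ c d → ⊙-distribʳ unit c d) (λ c d → ⊙-assoc c d unit)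
φₖ (suc k) = uncurryₗ (λ (v , _) → left v ∘ₗ φₖ k) (λ e w → left-cong e (φₖ k $ w))
  (λ _ _ _ → ~refl) (λ _ _ _ → ~refl)

φ : QV.space ⊸ S
φ = cotuple φₖ

φ-prepend : ∀ v q → S [ φ $ (QV.prepend v $ q) ≈ proj₁ v ⋆ (φ $ q) ]
φ-prepend v = linear-ext (φ ∘ₗ QV.prepend v) (left (proj₁ v) ∘ₗ φ) (λ _ → ~refl)

∈𝔖^1⇒indecomposable : (u : 𝔖 n) → (n , u) ∈𝔖^ 1 → Indecomposable (word u)
∈𝔖^1⇒indecomposable u u∈ = degree-1 (∈𝔖^⇒degree u 1 u∈)

-- Makes the last term of `Δ-⋆` a linear map in its first factor, the form that `span-ext` takes.
left⊗id : ∣ S² ∣ → S ⊸ S²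
left⊗id t = linear (λ s → (left s ⊗₁ idₗ) $ t)
  (λ {s} {s′} e → ⊗₁-congˡ (left s) (left s′) idₗ (left-cong e) t)
  (λ s s′ → ⊗₁-+ˡ (left s) (left s′) idₗ t)
  (λ c s → ⊗₁-•ˡ c (left s) idₗ t)

-- Both sides are linear in `v` and in `y`, which reduces to `M u` of degree 1, hence
-- indecomposable, and an arbitrary `M v`.
Δ-⋆ : (v : ∣ V ∣) → ∀ y →
      S² [ Δ $ (proj₁ v ⋆ y) ≈ unit ⊗ₜ (proj₁ v ⋆ y) ⊕ (left (proj₁ v) ⊗₁ idₗ {S}) $ (Δ $ y) ]
Δ-⋆ v y = span-ext (Δ ∘ₗ right y ∘ₗ incl (𝔖Sym^ 1))
  (unit ⊗ₜ- ∘ₗ right y ∘ₗ incl (𝔖Sym^ 1) +ₗ left⊗id (Δ $ y) ∘ₗ incl (𝔖Sym^ 1))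
  (λ ((_ , u) , u∈) → M-ext (Δ ∘ₗ left (M u)) (unit ⊗ₜ- ∘ₗ left (M u) +ₗ (left (M u) ⊗₁ idₗ) ∘ₗ Δ)
    (λ v → Δ-⋆-M u v (∈𝔖^1⇒indecomposable u u∈)) y) v

φ-Δ : ∀ q → S² [ Δ $ (φ $ q) ≈ (φ ⊗₁ φ) $ (QV.Δ $ q) ]
φ-Δ = QV.prepend-induction (Δ ∘ₗ φ) ((φ ⊗₁ φ) ∘ₗ QV.Δ) base step
  where
  open ≈-Reasoning (LeftModule.≈ᴹ-setoid S²)
  base : ∀ c → S² [ Δ $ (c ⊙ unit) ≈ (φ ⊗₁ φ) $ (QV.Δ $ gen (0 , c)) ]
  base c = begin
    c ⊙ ΔF {0} idₚ                            ≈⟨ ⊙-cong (LeftModule.+ᴹ-identityʳ S² _) ⟩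
    c ⊙ (F (st [] []) ⊗ₜ F (st [] []))        ≈⟨ ⊙-cong (relation (⊗-cong (F-word (st [] []) idₚ ≡.refl) (F-word (st [] []) idₚ ≡.refl))) ⟩
    c ⊙ (unit ⊗ₜ unit)                        ≈⟨ relation (⊗-•ʳ c unit unit) ⟨
    unit ⊗ₜ (c ⊙ unit)                        ≈⟨ relation (⊗-cong (⊙-identityˡ unit) ~refl) ⟨
    (1ℚ ⊙ unit) ⊗ₜ (c ⊙ unit)                 ≈⟨ _⊸_.⟦⟧-cong (φ ⊗₁ φ) (QV.Δ-0 c) ⟨
    (φ ⊗₁ φ) $ (QV.Δ $ gen (0 , c))           ∎
  step : ∀ v q → S² [ Δ $ (φ $ q) ≈ (φ ⊗₁ φ) $ (QV.Δ $ q) ] →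
         S² [ Δ $ (φ $ (QV.prepend v $ q)) ≈ (φ ⊗₁ φ) $ (QV.Δ $ (QV.prepend v $ q)) ]
  step v q ih = begin
    Δ $ (φ $ (QV.prepend v $ q))
      ≈⟨ _⊸_.⟦⟧-cong Δ (φ-prepend v q) ⟩
    Δ $ (a ⋆ (φ $ q))
      ≈⟨ Δ-⋆ v (φ $ q) ⟩
    unit ⊗ₜ (a ⋆ (φ $ q)) ⊕ (left a ⊗₁ idₗ {S}) $ (Δ $ (φ $ q))
      ≈⟨ ⊕-cong (relation (⊗-cong (~sym (⊙-identityˡ unit)) (~sym (φ-prepend v q))))
           (_⊸_.⟦⟧-cong (left a ⊗₁ idₗ {S}) ih) ⟩
    (φ ⊗₁ φ) $ (QV.one ⊗ₜ (QV.prepend v $ q)) ⊕ (left a ⊗₁ idₗ {S}) $ ((φ ⊗₁ φ) $ (QV.Δ $ q))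
      ≈⟨ ⊕-cong ~refl (⊗-ext ((φ ⊗₁ φ) ∘ₗ (QV.prepend v ⊗₁ idₗ {QV.space})) ((left a ⊗₁ idₗ {S}) ∘ₗ (φ ⊗₁ φ))
           (λ p _ → relation (⊗-cong (φ-prepend v p) ~refl)) (QV.Δ $ q)) ⟨
    (φ ⊗₁ φ) $ (QV.one ⊗ₜ (QV.prepend v $ q) ⊕ (QV.prepend v ⊗₁ idₗ {QV.space}) $ (QV.Δ $ q))
      ≈⟨ _⊸_.⟦⟧-cong (φ ⊗₁ φ) (QV.Δ-prepend v q) ⟨
    (φ ⊗₁ φ) $ (QV.Δ $ (QV.prepend v $ q)) ∎
    where a = proj₁ v

ε-M : (u : 𝔖 (suc n)) → ε $ M u ≡ 0ℚ
ε-M {n} u = ≡.trans ($-∑ S ε vs (λ v → μ u v ⊙ F v)) (∑-0 ℚ¹ vs {λ v → μ u v *ℚ 0ℚ} (λ {v} _ → ℚ.*-zeroʳ (μ u v)))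
  where vs = filter (u ≤ʷ?_) (permutations (suc n))

ε-Mst : ∀ w → 1 ≤ length w → ε $ Mst w ≡ 0ℚ
ε-Mst w@(_ ∷ _) _ with unique? w
... | yes ! = ε-M (st w !)
... | no _  = ≡.refl

ε-⋆ : (v : ∣ V ∣) → ∀ y → ε $ (proj₁ v ⋆ y) ≡ 0ℚ
ε-⋆ v y = span-ext (ε ∘ₗ right y ∘ₗ incl (𝔖Sym^ 1)) 0ₗ generator v
  where
  generator : (((n , u) , _) : Σ[ (n , u) ∈ Σ[ n ∈ ℕ ] 𝔖 n ] (n , u) ∈𝔖^ 1) → ε $ (M u ⋆ y) ≡ 0ℚ
  generator ((suc n , u) , _) = M-ext (ε ∘ₗ left (M u)) 0ₗ
    (λ v → ≡.trans (_⊸_.⟦⟧-cong ε (M-⋆ u v)) (ε-Mst (word u ∗ word v) (s≤s z≤n))) y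

φ-ε : ∀ q → ε $ (φ $ q) ≡ QV.ε $ q
φ-ε = QV.prepend-induction (ε ∘ₗ φ) QV.ε ℚ.*-identityʳ
  λ v q _ → ≡.trans (_⊸_.⟦⟧-cong ε (φ-prepend v q)) (≡.trans (ε-⋆ v (φ $ q)) (≡.sym (QV.ε-prepend v q)))

-- The inverse map: tensors of blocks

Mst-∈ : ∀ w → degree (std w) ≡ k → Mst w ∈ 𝔖Sym^ k
Mst-∈ {k} w d with unique? w
... | yes ! = gen ((length w , st w !) , ≡.subst ((length w , st w !) ∈𝔖^_)
  (≡.trans (≡.cong degree (word-st w !)) d) (degree⇒∈𝔖^ (st w !))) , ~refl
... | no _  = 𝟎 , ~refl

blockVector : ∀ x → Indecomposable x → ∣ V ∣
blockVector x ind = Mst x , Mst-∈ x (≡.trans (≡.cong degree (≡.sym (List.++-identityʳ (std x))))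
  (degree-++ [] (Indecomposable-resp (≼-std x) (std-≼ x) ind) (All.tabulate λ _ → [])))

tensor : Blocks k w → ∣ V ^⊗ k ∣
tensor []                = 1ℚ
tensor (block x ind _ b) = blockVector x ind ⊗ₜ tensor b

-- Linearity in the prepended vector serves to change its membership proof and to argue on the
-- generators of V.
prependTo : ∣ QV.space ∣ → V ⊸ QV.space
prependTo q = linear (λ v → QV.prepend v $ q)
  (λ {v} {v′} e → linear-ext (QV.prepend v) (QV.prepend v′)
    (λ (k , t) → relation (⨁-cong (relation (⊗-cong e (LeftModule.≈ᴹ-refl (V ^⊗ k)))))) q)
  (λ v v′ → linear-ext (QV.prepend (v V.+ᴹ v′)) (QV.prepend v +ₗ QV.prepend v′)
    (λ (k , t) → ~trans (relation (⨁-cong (relation (⊗-+ˡ v v′ t)))) (relation (⨁-+ (suc k) _ _))) q)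
  (λ c v → linear-ext (QV.prepend (c V.*ₗ v)) (c •ₗ QV.prepend v)
    (λ (k , t) → ~trans (relation (⨁-cong (relation (⊗-•ˡ c v t)))) (relation (⨁-• (suc k) c _))) q)
  where module V = LeftModule V

-- The factorization chosen by `blocks` may thus be compared with any other: first blocks agree by
-- `firstBlock-unique`, and the rest by recursion.
tensor-unique : ∀ {k k′ w w′} (b : Blocks k w) (b′ : Blocks k′ w′) → w ≡ w′ →
                QV.space [ gen (k , tensor b) ≈ gen (k′ , tensor b′) ]
tensor-unique [] [] _ = ~refl
tensor-unique [] (block (_ ∷ _) _ _ _) ()
tensor-unique [] (block [] (() , _) _ _) _
tensor-unique (block (_ ∷ _) _ _ _) [] ()
tensor-unique (block [] (() , _) _ _) [] _
tensor-unique (block {k = k} x ind x≫y b) (block {k = k′} x′ ind′ x′≫y′ b′) e with firstBlock-unique ind ind′ x≫y x′≫y′ e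
... | ≡.refl , y≡y′ = ~trans
  (_⊸_.⟦⟧-cong (QV.prepend (blockVector x ind)) (tensor-unique b b′ y≡y′))
  -- The two head vectors are both `Mst x` and differ only in the proofs attached.
  (_⊸_.⟦⟧-cong (prependTo (gen (k′ , tensor b′))) ~refl)

blockTensor : List ℕ → ∣ QV.space ∣
blockTensor w = gen (proj₁ (blocks w) , tensor (proj₂ (blocks w)))

-- Meant to send `M u` to the tensor of its blocks; on the generator `F u` this forces the sum over
-- the upper set, by `F-expand`.
ψ : S ⊸ QV.space
ψ = extend QV.space (λ (_ , u) → ∑ QV.space (upper (word u)) blockTensor) λ where
  (≈ₚ⇒~ {u = u} {v} e) → LeftModule.≈ᴹ-reflexive QV.space
    (≡.cong (λ w → ∑ QV.space (upper w) blockTensor) (word-cong u v e))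

ψ-M : (u : 𝔖 n) → QV.space [ ψ $ M u ≈ blockTensor (word u) ]
ψ-M = $-M-word ψ blockTensor (λ _ → ~refl)

ψ-Mst : Standard w → QV.space [ ψ $ Mst w ≈ blockTensor w ]
ψ-Mst {w} (! , e) = ~trans (_⊸_.⟦⟧-cong ψ (Mst-st !)) (~trans (ψ-M (st w !))
  (LeftModule.≈ᴹ-reflexive QV.space (≡.cong blockTensor (≡.trans (word-st w !) e))))

φ-tensor : Unique w → (b : Blocks k w) → S [ φₖ k $ tensor b ≈ Mst w ]
φ-tensor !  []                    = ~trans (⊙-identityˡ unit) unit≈Mst[]
φ-tensor !  (block x ind x≫y b) = ~trans
  (_⊸_.⟦⟧-cong (left (Mst x)) (φ-tensor (++-uniqueʳ x !) b))
  (Mst-⋆ (++-uniqueˡ x !) (++-uniqueʳ x !) x≫y)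

φψ : ∀ x → S [ φ $ (ψ $ x) ≈ x ]
φψ = M-ext (φ ∘ₗ ψ) idₗ λ u → ~trans (_⊸_.⟦⟧-cong φ (ψ-M u))
  (~trans (φ-tensor (word-unique u) (proj₂ (blocks (word u)))) (~sym (M-Mst-word u)))

-- The blocks of `u ∗ v` are the shifted `u` followed by those of `v`. This is the step of the
-- induction proving that ψ inverts φ on the left.
ψ-⋆ : (v : ∣ V ∣) → ∀ y → QV.space [ ψ $ (proj₁ v ⋆ y) ≈ QV.prepend v $ (ψ $ y) ]
ψ-⋆ v y = span-ext (ψ ∘ₗ right y ∘ₗ incl (𝔖Sym^ 1)) (prependTo (ψ $ y)) generator v
  where
  generator : (i : Σ[ (n , u) ∈ Σ[ n ∈ ℕ ] 𝔖 n ] (n , u) ∈𝔖^ 1) →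
              QV.space [ ψ $ (M (proj₂ (proj₁ i)) ⋆ y) ≈ QV.prepend (M (proj₂ (proj₁ i)) , gen i , ~refl) $ (ψ $ y) ]
  generator i@((_ , u) , u∈) = M-ext (ψ ∘ₗ left (M u)) (QV.prepend Mu ∘ₗ ψ) (λ v → product v) y
    where
    Mu : ∣ V ∣
    Mu = M u , gen i , ~refl
    product : ∀ {n} (v : 𝔖 n) → QV.space [ ψ $ (M u ⋆ M v) ≈ QV.prepend Mu $ (ψ $ M v) ]
    product v = begin
      ψ $ (M u ⋆ M v)
        ≈⟨ _⊸_.⟦⟧-cong ψ (M-⋆ u v) ⟩
      ψ $ Mst (word u ∗ word v)
        ≈⟨ ψ-Mst (∗-standard (word-standard u) (word-standard v)) ⟩
      blockTensor (word u ∗ word v)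
        -- The factorization found by search is exchanged for the one whose first block is the
        -- shifted `u`.
        ≈⟨ tensor-unique (proj₂ (blocks (word u ∗ word v)))
             (block wu ind (∗-≫ (word u) (word-standard v)) (proj₂ (blocks (word v)))) ≡.refl ⟩
      QV.prepend (blockVector wu ind) $ blockTensor (word v)
        ≈⟨ _⊸_.⟦⟧-cong (prependTo (blockTensor (word v))) Mu≈ ⟨
      QV.prepend Mu $ blockTensor (word v)
        ≈⟨ _⊸_.⟦⟧-cong (QV.prepend Mu) (ψ-M v) ⟨
      QV.prepend Mu $ (ψ $ M v) ∎
      where
      open ≈-Reasoning (LeftModule.≈ᴹ-setoid QV.space)
      wu = map (length (word v) +_) (word u)
      ind = Indecomposable-resp (≼-shift (length (word v)) (word u)) (shift-≼ (length (word v)) (word u))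
        (∈𝔖^1⇒indecomposable u u∈)
      Mu≈ : S [ M u ≈ Mst wu ]
      Mu≈ = M-Mst u wu (Unique.map⁺ (ℕ.+-cancelˡ-≡ (length (word v)) _ _) (word-unique u))
        (≡.trans (≡.sym (map-rank-word u)) (≡.sym (std-shift (length (word v)) (word u))))

ψφ : ∀ q → QV.space [ ψ $ (φ $ q) ≈ q ]
ψφ = QV.prepend-induction (ψ ∘ₗ φ) idₗ base λ v q ih →
  ~trans (_⊸_.⟦⟧-cong ψ (φ-prepend v q)) (~trans (ψ-⋆ v (φ $ q)) (_⊸_.⟦⟧-cong (QV.prepend v) ih))
  where
  base : ∀ c → QV.space [ c ⊙ (ψ $ unit) ≈ gen (0 , c) ]
  base c = ~trans (⊙-cong (LeftModule.+ᴹ-identityʳ QV.space QV.one))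
    (~trans (~sym (relation (⨁-• 0 c 1ℚ))) (relation (⨁-cong (ℚ.*-identityʳ c))))

M-⋆-∈ : (u : 𝔖 n) → (n , u) ∈𝔖^ 1 → ∀ {m} (v : 𝔖 m) → (m , v) ∈𝔖^ k → M u ⋆ M v ∈ 𝔖Sym^ (suc k)
M-⋆-∈ {k = k} u u∈ v v∈ = Subspace.≈-closed (𝔖Sym^ (suc k)) (~sym (M-⋆ u v)) (Mst-∈ (word u ∗ word v)
  (≡.trans (≡.cong degree (proj₂ (∗-standard (word-standard u) (word-standard v))))
  (≡.trans (degree-++ (word v) (Indecomposable-resp (≼-shift (length (word v)) (word u)) (shift-≼ (length (word v)) (word u))
      (∈𝔖^1⇒indecomposable u u∈)) (∗-≫ (word u) (word-standard v)))
    (≡.cong suc (∈𝔖^⇒degree v k v∈)))))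

φₖ-∈ : ∀ k t → φₖ k $ t ∈ 𝔖Sym^ k
φₖ-∈ zero    c = c ⊙ gen ((0 , idₚ) , ≡.refl) , ⊙-cong (~trans (M-Mst-word {0} idₚ) (~sym unit≈Mst[]))
φₖ-∈ (suc k) t = go t
  where
  module T = Subspace (𝔖Sym^ (suc k))
  go : ∀ t → φₖ (suc k) $ t ∈ 𝔖Sym^ (suc k)
  -- The proof `v∈` and the recursive call present both factors as combinations of M, leaving
  -- products of two basis vectors.
  go (gen ((v , v∈) , t)) = span-⊆ (right (φₖ k $ t)) (𝔖Sym^ (suc k))
    (λ ((_ , u) , u∈) → span-⊆ (left (M u)) (𝔖Sym^ (suc k))
      (λ ((_ , u′) , u′∈) → M-⋆-∈ u u∈ u′ u′∈) (φₖ-∈ k t)) v∈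
  go 𝟎       = T.0-closed
  go (s ⊕ t) = T.+-closed (go s) (go t)
  go (c ⊙ t) = T.•-closed c (go t)

φ-graded : ∀ k q → q ∈ QV.grade k → φ $ q ∈ 𝔖Sym^ k
φ-graded k q (t , e) = Subspace.≈-closed (𝔖Sym^ k) (_⊸_.⟦⟧-cong φ e) (φₖ-∈ k t)

ψ-graded : ∀ k x → x ∈ 𝔖Sym^ k → ψ $ x ∈ QV.grade k
ψ-graded k x = span-⊆ ψ (QV.grade k) λ ((_ , u) , u∈) →
  Subspace.≈-closed (QV.grade k) (~sym (ψ-M u))
    (≡.subst (λ j → blockTensor (word u) ∈ QV.grade j)
      -- The tensor power that contains `blockTensor` is given by the number of blocks, which is the
      -- degree of the word.
      (≡.trans (blocks-degree (proj₂ (blocks (word u)))) (∈𝔖^⇒degree u k u∈))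
      (tensor (proj₂ (blocks (word u))) , ~refl))

mainTheorem10 : Σ[ isGrading ∈ IsCoalgebraGrading 𝔖Sym 𝔖Sym^ ]
    mkGraded 𝔖Sym 𝔖Sym^ isGrading ≅ Q (subspace (𝔖Sym^ 1))
mainTheorem10 = Transport.transport 𝔖Sym 𝔖Sym^ (Q (subspace (𝔖Sym^ 1))) φ ψ φψ ψφ φ-Δ φ-ε φ-graded ψ-graded
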